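{- There exist absolute constants $C,c>0$ and an integer $p_0$ such that: (i) for every integer $p\geq 2$ and every outerplanar graph $G$, $\chi_p(G)\leq C\,p\log p$; (ii) for every integer $p\geq p_0$ there is an outerplanar graph $G$ with $\chi_p(G)\geq c\,p\log p$; (iii) for every integer $p\geq 2$ and every planar graph $G$ of treewidth at most $3$, $\chi_p(G)\leq C\,p^2\log p$; (iv) for every integer $p\geq p_0$ there is a planar graph $G$ of treewidth $3$ with $\chi_p(G)\geq c\,p^2\log p$.
   Context: All graphs are finite and simple. For an integer $p\geq 1$, a vertex coloring $\phi$ of a graph $G$ is $p$-centered if for every connected subgraph $H$ of $G$, either $\phi$ uses more than $p$ colors on $V(H)$ or there is a color that appears on exactly one vertex of $H$. The $p$-centered chromatic number $\chi_p(G)$ is the minimum number of colors in a $p$-centered coloring of $G$. Planar graphs of treewidth at most $3$ are exactly the subgraphs of stacked triangulations. -}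

module Defs where

open import Data.Nat using (ℕ; zero; suc; _+_; _*_; _≤_; _<_)
open import Data.Fin using (Fin; toℕ; inject₁; fromℕ) renaming (zero to fzero; suc to fsuc)
open import Data.Fin.Subset using (Subset; _∈_; ∣_∣)
open import Data.Vec using (tabulate) renaming (lookup to lookupV)
open import Data.Bool using (Bool; true; false)
open import Data.List using (List; []; _∷_; _++_; map; length; removeAt; lookup)
open import Data.List.Membership.Propositional using () renaming (_∈_ to _∈ₗ_)
open import Data.Product using (Σ; ∃; ∃-syntax; _×_; _,_)
open import Data.Sum using (_⊎_)
open import Data.Empty using (⊥)
open import Relation.Binary.PropositionalEquality using (_≡_)
open import Function.Definitions using (Injective)

record Graph (n : ℕ) : Set where
  field
    adj     : Fin n → Fin n → Bool
    symm    : ∀ u v → adj u v ≡ adj v u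
    irrefl  : ∀ u → adj u u ≡ false

open Graph public

Edge : ∀ {n} → Graph n → Fin n → Fin n → Set
Edge G u v = adj G u v ≡ true

data Reach {n : ℕ} (R : Fin n → Fin n → Set) (S : Subset n) (u : Fin n) : Fin n → Set where
  here : u ∈ S → Reach R S u u
  step : ∀ {w v} → Reach R S u w → R w v → v ∈ S → Reach R S u v

ConnectedSet : ∀ {n} → Graph n → Subset n → Set
ConnectedSet {n} G S =
  (∃[ v ] v ∈ S) × (∀ u v → u ∈ S → v ∈ S → Reach (Edge G) S u v)

MoreThanColours : ∀ {n k} → ℕ → (Fin n → Fin k) → Subset n → Set
MoreThanColours {n} p φ S =
  Σ (Fin (suc p) → Fin n) λ f → (∀ i → f i ∈ S) × Injective _≡_ _≡_ (λ i → φ (f i))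

HasUniqueColour : ∀ {n k} → (Fin n → Fin k) → Subset n → Set
HasUniqueColour {n} φ S =
  Σ (Fin n) λ v → v ∈ S × (∀ w → w ∈ S → φ w ≡ φ v → w ≡ v)

PCentered : ∀ {n k} → ℕ → Graph n → (Fin n → Fin k) → Set
PCentered p G φ =
  ∀ S → ConnectedSet G S → MoreThanColours p φ S ⊎ HasUniqueColour φ S

χ≤ : ∀ {n} → ℕ → Graph n → ℕ → Set
χ≤ {n} p G k = Σ (Fin n → Fin k) λ φ → PCentered p G φ

-- Outerplanar graphs: vertices can be placed in convex position on a
-- circle (cyclic order σ) so that no two edges cross as chords.

Outerplanar : ∀ {n} → Graph n → Set
Outerplanar {n} G =
  Σ (Fin n → Fin n) λ σ → Injective _≡_ _≡_ σ ×
    (∀ a b c d → Edge G a b → Edge G c d →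
       toℕ (σ a) < toℕ (σ c) → toℕ (σ c) < toℕ (σ b) → toℕ (σ b) < toℕ (σ d) → ⊥)

-- Stacked triangulations (planar 3-trees), built from a triangle by
-- repeatedly inserting a new vertex into a (triangular) face and joining
-- it to the three vertices of that face.
-- Stacked n E F : a stacked triangulation on Fin n with edge list E and
-- list of (triangular) faces F.

Tri : ℕ → Set
Tri n = Fin n × Fin n × Fin n

liftE : ∀ {n} → List (Fin n × Fin n) → List (Fin (suc n) × Fin (suc n))
liftE = map (λ { (a , b) → (inject₁ a , inject₁ b) })

liftF : ∀ {n} → List (Tri n) → List (Tri (suc n))
liftF = map (λ { (a , b , c) → (inject₁ a , inject₁ b , inject₁ c) })

v0 v1 v2 : Fin 3
v0 = fzero
v1 = fsuc fzero
v2 = fsuc (fsuc fzero)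

data Stacked : (n : ℕ) → List (Fin n × Fin n) → List (Tri n) → Set where
  -- the triangle, with its two (inner and outer) faces
  base : Stacked 3 ((v0 , v1) ∷ (v1 , v2) ∷ (v0 , v2) ∷ [])
                   ((v0 , v1 , v2) ∷ (v0 , v1 , v2) ∷ [])
  add  : ∀ {n E F} → Stacked n E F → (i : Fin (length F)) →
         let (a , b , c) = lookup F i
             x  = fromℕ n
             a' = inject₁ a
             b' = inject₁ b
             c' = inject₁ c
         in Stacked (suc n)
              (liftE E ++ (a' , x) ∷ (b' , x) ∷ (c' , x) ∷ [])
              (liftF (removeAt F i) ++ (a' , b' , x) ∷ (b' , c' , x) ∷ (a' , c' , x) ∷ [])

-- G is (isomorphic to) a subgraph of a stacked triangulation,
-- i.e. G is a planar graph of treewidth at most 3.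
PlanarTw≤3 : ∀ {n} → Graph n → Set
PlanarTw≤3 {n} G =
  Σ ℕ λ m → Σ (List (Fin m × Fin m)) λ E → Σ (List (Tri m)) λ F →
  Stacked m E F ×
  Σ (Fin n → Fin m) λ f → Injective _≡_ _≡_ f ×
    (∀ u v → Edge G u v → ((f u , f v) ∈ₗ E) ⊎ ((f v , f u) ∈ₗ E))

-- Tree decompositions and treewidth.
-- The tree T has nodes Fin (suc m); node (fsuc i) is attached to node
-- parent i, which has index ≤ i (every finite tree admits such an
-- ordering of its nodes).

TreeEdge : ∀ {m} → (Fin m → Fin (suc m)) → Fin (suc m) → Fin (suc m) → Set
TreeEdge {m} parent s t =
  ∃[ i ] ((s ≡ fsuc i × t ≡ parent i) ⊎ (t ≡ fsuc i × s ≡ parent i))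

NodesOf : ∀ {n m} → (Fin m → Subset n) → Fin n → Subset m
NodesOf bag v = tabulate (λ t → lookupV (bag t) v)

record TreeDecomposition {n : ℕ} (G : Graph n) (k : ℕ) : Set where
  field
    m         : ℕ
    parent    : Fin m → Fin (suc m)
    parent≤   : ∀ i → toℕ (parent i) ≤ toℕ i
    bag       : Fin (suc m) → Subset n
    width≤    : ∀ t → ∣ bag t ∣ ≤ suc k
    covers    : ∀ v → ∃[ t ] v ∈ bag t
    edges     : ∀ u v → Edge G u v → ∃[ t ] (u ∈ bag t × v ∈ bag t)
    connected : ∀ v s t → s ∈ NodesOf bag v → t ∈ NodesOf bag v →
                Reach (TreeEdge parent) (NodesOf bag v) s t

Tw≤ : ∀ {n} → Graph n → ℕ → Set
Tw≤ G k = TreeDecomposition G k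

{-# OPTIONS --safe #-}
module Submission where

-- Upper bounds.  Order an outerplanar graph along its outer cycle and level its vertices so that the
-- interior of an edge lies strictly above the lower end of the edge.  Colour greedily, level by
-- level, so that a vertex differs from the p vertices before it in its own level and, in each of the
-- p levels below, from the O(log p) dyadic neighbours of its position.  A connected set of at most
-- p colours meets its lowest level in a short contiguous interval and stays within p levels, so the
-- dyadic centre of that interval has a unique colour.  A stacked triangulation is layered along its
-- construction sequence: edges span at most three layers and each layer is outerplanar.  Since the
-- sequence is a perfect elimination order, a connected set meets its lowest layer in a connected
-- set, and adding the layer modulo 3(p+1) to the colours costs one more factor O(p).
--
-- Lower bounds.  In a row joined to a hub let every vertex be the hub of a smaller structure.  Any
-- structure can cheaply repeat its colours, so that an interval of the row between two vertices
-- needs a unique colour occurring in neither of their structures.  For a path this covers all pairs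
-- of vertices by complete bipartite graphs, two per colour, whence by Hansel's lemma some vertex
-- misses Ω(log p) colours of the row in its structure.  Iterating Ω(p) times gives outerplanar
-- graphs needing Ω(p log p) colours, and using these as rows in place of paths gives planar
-- 3-trees needing Ω(p² log p).

open import Defs
open import Data.Nat using (ℕ; zero; suc; _+_; _*_; _∸_; _^_; _≤_; _<_; _≤?_; _<?_; _≟_; _⊔_; z≤n; s≤s; z<s; s≤s⁻¹; ⌊_/2⌋; ⌈_/2⌉; _/_; _%_)
open import Data.Nat.Properties hiding (_≤?_; _<?_; _≟_)
open import Data.Nat.DivMod using (m≡m%n+[m/n]*n; m%n<n; /-monoˡ-≤; m/n*n≤m)
open import Data.Nat.Logarithm using (⌊log₂_⌋; ⌊log₂⌋-mono-≤; ⌊log₂[2^n]⌋≡n; ⌊log₂⌊n/2⌋⌋≡⌊log₂n⌋∸1)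
open import Data.Nat.Tactic.RingSolver using (solve-∀)
open import Data.Fin using (Fin; zero; suc; toℕ; fromℕ; fromℕ<; inject₁; inject≤; combine)
open import Data.Fin.Patterns using (0F; 1F; 2F; 3F)
import Data.Fin.Base as Fin
import Data.Fin.Properties as Fin
open import Data.Fin.Relation.Unary.Top using (view; ‵fromℕ; ‵inj₁; ‵inject₁)
open import Data.Fin.Subset using (Subset; _∈_; ∣_∣; _-_)
open import Data.Fin.Subset.Properties using (_∈?_; x∈p∧x≢y⇒x∈p-y; x∈p⇒∣p-x∣<∣p∣)
open import Data.Vec using (tabulate) renaming (lookup to lookupᵥ)
open import Data.Vec.Properties using (lookup⇒[]=; []=⇒lookup; lookup∘tabulate)
open import Data.Bool using (Bool; true; false; not; if_then_else_)
import Data.Bool.Properties as Bool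
open import Data.List using (List; []; _∷_; _++_; map; length; filter; concatMap; upTo; allFin; lookup; removeAt)
open import Data.Nat.ListAction using (sum)
open import Data.List.Properties using (length-++; length-map; length-filter; length-tabulate; length-upTo; map-cong-local; map-++; ++-assoc; ++-identityʳ)
open import Data.List.Membership.Propositional using (find) renaming (_∈_ to _∈ₗ_; _∉_ to _∉ₗ_)
open import Data.List.Membership.Propositional.Properties
open import Data.List.Relation.Unary.Any using (Any; here; there; index; any?)
import Data.List.Relation.Unary.Any as Any
import Data.List.Relation.Unary.Any.Properties as Any
open import Data.List.Relation.Unary.All using (All; []; _∷_)
import Data.List.Relation.Unary.All as All
import Data.List.Relation.Unary.All.Properties as All
open import Data.List.Relation.Unary.AllPairs using (AllPairs; []; _∷_)
import Data.List.Relation.Unary.AllPairs as AllPairs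
import Data.List.Relation.Unary.AllPairs.Properties as AllPairs
open import Data.List.Relation.Unary.Unique.Propositional using (Unique)
import Data.List.Relation.Unary.Unique.Propositional.Properties as Unique
open import Data.List.Relation.Binary.Pointwise using (Pointwise; []; _∷_)
import Data.List.Relation.Binary.Pointwise as Pointwise
open import Data.Product using (Σ; ∃; ∃-syntax; _×_; _,_; proj₁; proj₂)
open import Data.Sum using (_⊎_; inj₁; inj₂; [_,_]′)
import Data.Sum as Sum
open import Data.Empty using (⊥; ⊥-elim)
open import Data.Unit using (⊤; tt)
open import Function using (_∘_; id; case_of_)
open import Function.Definitions using (Injective)
open import Relation.Nullary using (¬_; Dec; yes; no; does; contradiction; ¬?; _×-dec_; _⊎-dec_)
open import Relation.Nullary.Decidable using (dec-true; dec-false)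
open import Relation.Unary using (Decidable)
open import Relation.Binary using (tri<; tri≈; tri>)
open import Relation.Binary.PropositionalEquality hiding ([_])

-- The logarithm arises on both sides from intervals. Above: a vertex of a higher level meets a row
-- below only at one gap, and each interval of at most p places that touches this gap has its centre
-- among the nearest multiples of powers of two on either side. Below: if complete bipartite graphs
-- separate all pairs of 2^(2L) path vertices, some vertex lies in 2L of them, and each colour
-- supplies only two. A bare colour count is too weak as an induction hypothesis for the lower
-- bounds. `Star` therefore also asks that the unique colour be usable at two given vertices, and a
-- fan passes to its row only the usable colours that the smaller fans do not yet repeat; so every
-- round contributes L further colours. Repeating is not free: a structure of depth r brings up to r
-- colours of its own, and two structures hang on each interval. This takes 2r from the budget p,
-- which is affordable for r a small fraction of p. Those r colours must not become unique either,
-- so each row has more copies than there are colours, and the pigeonhole principle supplies a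
-- second vertex of the colour in question.

PC : ∀ {n k} → ℕ → (Fin n → Fin n → Set) → (Fin n → Fin k) → Set
PC p R φ = ∀ S → (∃[ v ] v ∈ S) × (∀ u v → u ∈ S → v ∈ S → Reach R S u v) →
  MoreThanColours p φ S ⊎ HasUniqueColour φ S

-- `Reach` over any vertex type and predicate: fans are not of the form `Fin n`, and connected sets
-- also appear as lists or cut down to a row or layer.
data Walk {V : Set} (R : V → V → Set) (P : V → Set) (u : V) : V → Set where
  stop : P u → Walk R P u u
  snoc : ∀ {w v} → Walk R P u w → R w v → P v → Walk R P u v

module _ {V : Set} {R : V → V → Set} where

  walk-last : ∀ {P : V → Set} {u v} → Walk R P u v → P v
  walk-last (stop Pu)     = Pu
  walk-last (snoc _ _ Pv) = Pv

  walk-map : ∀ {V′ : Set} {R′ : V′ → V′ → Set} {P : V → Set} {P′ : V′ → Set} (f : V → V′) →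
    (∀ {a b} → P a → P b → R a b → R′ (f a) (f b)) → (∀ {a} → P a → P′ (f a)) →
    ∀ {u v} → Walk R P u v → Walk R′ P′ (f u) (f v)
  walk-map f e g (stop Pu)      = stop (g Pu)
  walk-map f e g (snoc w r Pv)  = snoc (walk-map f e g w) (e (walk-last w) Pv r) (g Pv)

  walk-trans : ∀ {P : V → Set} {u v w} → Walk R P u v → Walk R P v w → Walk R P u w
  walk-trans p (stop _)     = p
  walk-trans p (snoc q r x) = snoc (walk-trans p q) r x

  walk-rev : (∀ {a b} → R a b → R b a) → ∀ {P : V → Set} {u v} → Walk R P u v → Walk R P v u
  walk-rev sy (stop x)     = stop x
  walk-rev sy (snoc w r x) = walk-trans (snoc (stop x) (sy r) (walk-last w)) (walk-rev sy w)

module _ {n : ℕ} {R : Fin n → Fin n → Set} {S : Subset n} where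

  reach⇒walk : ∀ {u v} → Reach R S u v → Walk R (_∈ S) u v
  reach⇒walk (here x)     = stop x
  reach⇒walk (step r e x) = snoc (reach⇒walk r) e x

  walk⇒reach : ∀ {u v} → Walk R (_∈ S) u v → Reach R S u v
  walk⇒reach (stop x)     = here x
  walk⇒reach (snoc r e x) = step (walk⇒reach r) e x

module _ {n : ℕ} {P : Fin n → Set} (P? : Decidable P) where

  subset : Subset n
  subset = tabulate (λ v → does (P? v))

  ∈-subset⁺ : ∀ {v} → P v → v ∈ subset
  ∈-subset⁺ {v} Pv = lookup⇒[]= v _ (trans (lookup∘tabulate _ v) (dec-true (P? v) Pv))

  ∈-subset⁻ : ∀ {v} → v ∈ subset → P v
  ∈-subset⁻ {v} v∈ with P? v | trans (sym (lookup∘tabulate (λ v → does (P? v)) v)) ([]=⇒lookup v∈)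
  ... | yes Pv | _ = Pv
  ... | no _   | ()

  argmin : (f : Fin n → ℕ) → ∃ P → ∃[ u ] P u × (∀ v → P v → f u ≤ f v)
  argmin f (v₀ , Pv₀) = go (f v₀) v₀ Pv₀ ≤-refl
    where
    go : ∀ t v → P v → f v ≤ t → ∃[ u ] P u × (∀ v → P v → f u ≤ f v)
    go t v Pv f≤ with Fin.any? (λ w → P? w ×-dec f w <? f v)
    ... | no ¬w = v , Pv , λ w Pw → ≮⇒≥ (λ lt → ¬w (w , Pw , lt))
    go zero v Pv f≤ | yes (w , Pw , lt) = contradiction (≤-trans lt f≤) λ ()
    go (suc t) v Pv f≤ | yes (w , Pw , lt) = go t w Pw (s≤s⁻¹ (≤-trans lt f≤))

strict-upper-bound : ∀ {n} (f : Fin n → ℕ) → ∃[ W ] (∀ x → f x < W)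
strict-upper-bound {zero}  f = 0 , λ ()
strict-upper-bound {suc n} f with strict-upper-bound (f ∘ suc)
... | W , f<W = suc (f zero) ⊔ W , λ where
  zero    → m≤m⊔n (suc (f zero)) W
  (suc x) → ≤-trans (f<W x) (m≤n⊔m (suc (f zero)) W)

injective-by-< : ∀ {k} {A : Set} {f : Fin k → A} → (∀ i j → toℕ i < toℕ j → f i ≢ f j) → Injective _≡_ _≡_ f
injective-by-< differ {i} {j} eq with <-cmp (toℕ i) (toℕ j)
... | tri< lt _ _  = ⊥-elim (differ i j lt eq)
... | tri≈ _ i≡j _ = Fin.toℕ-injective i≡j
... | tri> _ _ gt  = ⊥-elim (differ j i gt (sym eq))

PC-mono : ∀ {n k k′ p} {R : Fin n → Fin n → Set} → k ≤ k′ →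
  Σ (Fin n → Fin k) (PC p R) → Σ (Fin n → Fin k′) (PC p R)
PC-mono k≤ (φ , pc) = (λ v → inject≤ (φ v) k≤) , λ S conn → Sum.map
  (λ { (f , f∈ , inj) → f , f∈ , λ eq → inj (Fin.inject≤-injective k≤ k≤ _ _ eq) })
  (λ { (v , v∈ , uniq) → v , v∈ , λ w w∈ eq → uniq w w∈ (Fin.inject≤-injective k≤ k≤ _ _ eq) })
  (pc S conn)

-- Lists of conflicts and greedy colouring

module _ {A : Set} where

  length-concatMap-≤ : ∀ {B : Set} c (f : A → List B) xs → (∀ x → length (f x) ≤ c) →
    length (concatMap f xs) ≤ length xs * c
  length-concatMap-≤ c f []       h = z≤n
  length-concatMap-≤ c f (x ∷ xs) h = ≤-trans (≤-reflexive (length-++ (f x)))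
    (+-mono-≤ (h x) (length-concatMap-≤ c f xs h))

  ∈-concatMap : ∀ {B : Set} {f : A → List B} {x xs y} → x ∈ₗ xs → y ∈ₗ f x → y ∈ₗ concatMap f xs
  ∈-concatMap {f = f} x∈ y∈ = ∈-concatMap⁺ f (Any.map (λ { refl → y∈ }) x∈)

module _ {A : ℕ} where

  open import Data.List.Membership.DecPropositional (Fin._≟_ {suc A}) using () renaming (_∈?_ to _∈ₗ?_)

  freshColour : List (Fin (suc A)) → Fin (suc A)
  freshColour xs with Fin.any? (λ c → ¬? (c ∈ₗ? xs))
  ... | yes (c , _) = c
  -- Unreachable for lists of at most A entries, by `freshColour-∉`.
  ... | no _        = zero

  freshColour-∉ : ∀ xs → length xs ≤ A → freshColour xs ∉ₗ xs
  freshColour-∉ xs len with Fin.any? (λ c → ¬? (c ∈ₗ? xs))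
  ... | yes (c , c∉) = c∉
  ... | no all∈ = λ _ → <⇒≱ (s≤s len) (Fin.injective⇒≤ {f = λ c → index (mem c)} inj)
    where
    mem : ∀ c → c ∈ₗ xs
    mem c with c ∈ₗ? xs
    ... | yes c∈ = c∈
    ... | no c∉  = ⊥-elim (all∈ (c , c∉))
    inj : Injective _≡_ _≡_ (λ c → index (mem c))
    inj {c} {d} eq = trans (Any.lookup-index (mem c))
      (trans (cong (lookup xs) eq) (sym (Any.lookup-index (mem d))))

-- Vertices are coloured in the order of `μ`, and y avoids only the members of `B y` coloured before
-- it; there are at most A of these, so one of A + 1 colours is free. The recursion runs on fuel,
-- and `stable` shows that any fuel above `μ y` gives the same colour.
greedy-colouring : ∀ {n} A (B : Fin n → List (Fin n)) (μ : Fin n → ℕ) → (∀ y → length (B y) ≤ A) →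
  Σ (Fin n → Fin (suc A)) λ φ → ∀ {x y} → x ∈ₗ B y → μ x < μ y → φ x ≢ φ y
greedy-colouring {n} A B μ len = colour W , proper
  where
  W = proj₁ (strict-upper-bound μ)
  μ<W = proj₂ (strict-upper-bound μ)
  colour : ℕ → Fin n → Fin (suc A)
  -- A default for exhausted fuel, never reached from W, which exceeds every `μ`.
  colour zero    y = zero
  colour (suc t) y = freshColour (map (colour t) (filter (λ x → μ x <? μ y) (B y)))
  stable : ∀ t t′ y → μ y < t → μ y < t′ → colour t y ≡ colour t′ y
  stable (suc t) (suc t′) y (s≤s lt) (s≤s lt′) = cong freshColour (map-cong-local (All.tabulate λ {x} x∈ →
    let x<y = proj₂ (∈-filter⁻ (λ x → μ x <? μ y) {xs = B y} x∈)
    in stable t t′ x (<-≤-trans x<y lt) (<-≤-trans x<y lt′)))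
  fresh-at : ∀ t y {x} → μ y < t → x ∈ₗ B y → μ x < μ y → colour t x ≢ colour t y
  fresh-at (suc t) y {x} (s≤s lt) x∈ x<y eq =
    freshColour-∉ _ short
      (subst (_∈ₗ _) (trans (stable t (suc t) x (<-≤-trans x<y lt) (<-trans x<y (s≤s lt))) eq)
        (∈-map⁺ (colour t) (∈-filter⁺ (λ x → μ x <? μ y) x∈ x<y)))
    where
    short : length (map (colour t) (filter (λ x → μ x <? μ y) (B y))) ≤ A
    short = ≤-trans (≤-reflexive (length-map _ (filter (λ x → μ x <? μ y) (B y))))
      (≤-trans (length-filter _ (B y)) (len y))
  proper : ∀ {x y} → x ∈ₗ B y → μ x < μ y → colour W x ≢ colour W y
  proper {x} {y} x∈ x<y = fresh-at W y (μ<W y) x∈ x<y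

-- Greedy colourings of layered orders

double-floor-half-≤ : ∀ b → ⌊ b /2⌋ + ⌊ b /2⌋ ≤ b
double-floor-half-≤ b = ≤-trans (+-monoʳ-≤ ⌊ b /2⌋ (⌊n/2⌋≤⌈n/2⌉ b)) (≤-reflexive (⌊n/2⌋+⌈n/2⌉≡n b))

≤-double-ceil-half : ∀ a → a ≤ ⌈ a /2⌉ + ⌈ a /2⌉
≤-double-ceil-half a = ≤-trans (≤-reflexive (sym (⌊n/2⌋+⌈n/2⌉≡n a))) (+-monoˡ-≤ ⌈ a /2⌉ (⌊n/2⌋≤⌈n/2⌉ a))

-- Gap q lies between the ranks q - 1 and q. For every scale 2^i with i up to m, the list holds the
-- multiples of 2^i next to the gap on its two sides; the nested halves rounded up compute q / 2^i
-- rounded up.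
dyadicNeighbours : ℕ → ℕ → List ℕ
dyadicNeighbours zero    q = q ∸ 1 ∷ q ∷ []
dyadicNeighbours (suc m) q = q ∸ 1 ∷ q ∷ map (λ ρ → ρ + ρ) (dyadicNeighbours m ⌈ q /2⌉)

length-dyadicNeighbours : ∀ m q → length (dyadicNeighbours m q) ≡ 2 * suc m
length-dyadicNeighbours zero    q = refl
length-dyadicNeighbours (suc m) q = trans
  (cong (2 +_) (trans (length-map _ (dyadicNeighbours m ⌈ q /2⌉)) (length-dyadicNeighbours m ⌈ q /2⌉)))
  (sym (*-suc 2 (suc m)))

∸1∈dyadicNeighbours : ∀ m q → q ∸ 1 ∈ₗ dyadicNeighbours m q
∸1∈dyadicNeighbours zero    q = here refl
∸1∈dyadicNeighbours (suc m) q = here refl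

self∈dyadicNeighbours : ∀ m q → q ∈ₗ dyadicNeighbours m q
self∈dyadicNeighbours zero    q = there (here refl)
self∈dyadicNeighbours (suc m) q = there (here refl)

-- The centre is the point of the interval divisible by the highest power of two. Halving keeps the
-- even points, and the gaps from a to b + 1 become gaps of the halved interval, so the recursion
-- descends until one point remains.
dyadic-centre : ∀ m a b → a ≤ b → b < a + 2 ^ m →
  ∃[ ρ ] a ≤ ρ × ρ ≤ b × (∀ q → a ≤ q → q ≤ suc b → ρ ∈ₗ dyadicNeighbours m q)
dyadic-centre m a b a≤b b< = go m a b a≤b b<
  where
  singleton : ∀ m a b → a ≡ b → ∃[ ρ ] a ≤ ρ × ρ ≤ b × (∀ q → a ≤ q → q ≤ suc b → ρ ∈ₗ dyadicNeighbours m q)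
  singleton m a .a refl = a , ≤-refl , ≤-refl , λ q a≤q q≤ → case m≤n⇒m<n∨m≡n a≤q of λ where
    (inj₁ a<q) → subst (λ r → r ∸ 1 ∈ₗ dyadicNeighbours m q) (≤-antisym q≤ a<q) (∸1∈dyadicNeighbours m q)
    (inj₂ refl) → self∈dyadicNeighbours m q
  go : ∀ m a b → a ≤ b → b < a + 2 ^ m →
    ∃[ ρ ] a ≤ ρ × ρ ≤ b × (∀ q → a ≤ q → q ≤ suc b → ρ ∈ₗ dyadicNeighbours m q)
  go zero a b a≤b b< = singleton zero a b
    (≤-antisym a≤b (s≤s⁻¹ (≤-trans b< (≤-reflexive (+-comm a 1)))))
  go (suc m) a b a≤b b< with ⌈ a /2⌉ ≤? ⌊ b /2⌋
  -- No even number lies between a and b, so the interval is a single odd point.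
  ... | no a′≰b′ = singleton (suc m) a b (≤-antisym a≤b (≤-trans (b≤ (≰⇒> a′≰b′)) (≤-reflexive (⌊n/2⌋+⌈n/2⌉≡n a))))
    where
    half : ∀ b → ⌈ b /2⌉ ≤ suc ⌊ b /2⌋
    half b = ⌊n/2⌋-mono (n≤1+n (suc b))
    b≤ : ⌊ b /2⌋ < ⌈ a /2⌉ → b ≤ ⌊ a /2⌋ + ⌈ a /2⌉
    b≤ lt = ≤-trans (≤-reflexive (sym (⌊n/2⌋+⌈n/2⌉≡n b)))
      (+-mono-≤ (s≤s⁻¹ (≤-trans lt (half a))) (≤-trans (half b) lt))
  ... | yes a′≤b′ with go m ⌈ a /2⌉ ⌊ b /2⌋ a′≤b′ b′<
    where
    b′< : ⌊ b /2⌋ < ⌈ a /2⌉ + 2 ^ m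
    b′< with ⌊ b /2⌋ <? ⌈ a /2⌉ + 2 ^ m
    ... | yes lt = lt
    ... | no ≮ = contradiction b< (≤⇒≯ (begin
      a + 2 ^ suc m ≤⟨ +-monoˡ-≤ (2 ^ suc m) (≤-double-ceil-half a) ⟩
      ⌈ a /2⌉ + ⌈ a /2⌉ + 2 * 2 ^ m ≡⟨ regroup ⌈ a /2⌉ (2 ^ m) ⟩
      (⌈ a /2⌉ + 2 ^ m) + (⌈ a /2⌉ + 2 ^ m) ≤⟨ +-mono-≤ (≮⇒≥ ≮) (≮⇒≥ ≮) ⟩
      ⌊ b /2⌋ + ⌊ b /2⌋ ≤⟨ double-floor-half-≤ b ⟩
      b ∎))
      where
      open ≤-Reasoning
      regroup : ∀ x y → x + x + 2 * y ≡ (x + y) + (x + y)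
      regroup = solve-∀
  ... | ρ , a′≤ρ , ρ≤b′ , near = ρ + ρ
    , ≤-trans (≤-double-ceil-half a) (+-mono-≤ a′≤ρ a′≤ρ)
    , ≤-trans (+-mono-≤ ρ≤b′ ρ≤b′) (double-floor-half-≤ b)
    , λ q a≤q q≤ → there (there (∈-map⁺ (λ ρ → ρ + ρ)
        (near ⌈ q /2⌉ (⌈n/2⌉-mono a≤q) (⌈n/2⌉-mono q≤))))

-- One colour more than conflicts: p in the own row, and the 2(m + 1) dyadic neighbours in each of p
-- rows below. The factors 1 count the at most one vertex found at a given rank.
colourCount : ℕ → ℕ → ℕ
colourCount p m = suc (p * 1 + p * (2 * suc m * 1))

-- Rows are the sets of constant l.  The rank of a vertex is its index in its row, from left to
-- right, and gap j y is the number of vertices of row j to the left of y.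
module LayeredOrder {n : ℕ} (R : Fin n → Fin n → Set) (R-sym : ∀ {u v} → R u v → R v u)
  (pos l : Fin n → ℕ) (pos-injective : ∀ {u v} → pos u ≡ pos v → u ≡ v)
  (lipschitz : ∀ {u v} → R u v → l u ≤ suc (l v))
  (covered-lower : ∀ {u v w} → R u v → pos u < pos w → pos w < pos v → l u < l w ⊎ l v < l w)
  (p m : ℕ) (p≤2^m : p ≤ 2 ^ m) where

  at? : ∀ i t → Dec (∃[ x ] pos x ≡ t × l x ≡ i)
  at? i t = Fin.any? (λ x → pos x ≟ t ×-dec l x ≟ i)

  rk : ℕ → ℕ → ℕ
  rk i zero = 0
  rk i (suc t) with at? i t
  ... | yes _ = suc (rk i t)
  ... | no _  = rk i t

  rank : Fin n → ℕ
  rank x = rk (l x) (pos x)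

  gap : ℕ → Fin n → ℕ
  gap j y = rk j (pos y)

  rk-step : ∀ i t → rk i t ≤ rk i (suc t)
  rk-step i t with at? i t
  ... | yes _ = n≤1+n _
  ... | no _  = ≤-refl

  rk-mono : ∀ i {t t′} → t ≤ t′ → rk i t ≤ rk i t′
  rk-mono i {t} {zero} z≤n = ≤-refl
  rk-mono i {t} {suc t′} t≤ with m≤n⇒m<n∨m≡n t≤
  ... | inj₁ (s≤s lt) = ≤-trans (rk-mono i lt) (rk-step i t′)
  ... | inj₂ refl = ≤-refl

  rk-at : ∀ x → rk (l x) (suc (pos x)) ≡ suc (rank x)
  rk-at x with at? (l x) (pos x)
  ... | yes _ = refl
  ... | no none = ⊥-elim (none (x , refl , refl))

  rk-const : ∀ i {t t′} → t ≤ t′ → (∀ x → l x ≡ i → t ≤ pos x → pos x < t′ → ⊥) → rk i t ≡ rk i t′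
  rk-const i {t} {zero} z≤n _ = refl
  rk-const i {t} {suc t′} t≤ none with m≤n⇒m<n∨m≡n t≤
  ... | inj₂ refl = refl
  ... | inj₁ (s≤s lt) with rk-const i lt (λ x lx t≤x x< → none x lx t≤x (m<n⇒m<1+n x<)) | at? i t′
  ... | eq | no _ = eq
  ... | eq | yes (x , refl , lx) = ⊥-elim (none x lx lt ≤-refl)

  rk-surj : ∀ i t {ρ} → ρ < rk i t → ∃[ x ] l x ≡ i × pos x < t × rank x ≡ ρ
  rk-surj i (suc t) {ρ} lt with at? i t
  ... | no _ = let x , lx , x< , eq = rk-surj i t lt in x , lx , m<n⇒m<1+n x< , eq
  ... | yes (x , px , lx) with m≤n⇒m<n∨m≡n (s≤s⁻¹ lt)
  ... | inj₁ lt′ = let x , lx , x< , eq = rk-surj i t lt′ in x , lx , m<n⇒m<1+n x< , eq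
  ... | inj₂ refl = x , lx , s≤s (≤-reflexive px) , cong₂ rk lx px

  rank-< : ∀ {x y} → l x ≡ l y → pos x < pos y → rank x < rank y
  rank-< {x} {y} lxy lt = ≤-trans (≤-reflexive (sym (rk-at x)))
    (≤-trans (rk-mono (l x) lt) (≤-reflexive (cong (λ i → rk i (pos y)) lxy)))

  rank-injective : ∀ {x y} → l x ≡ l y → rank x ≡ rank y → x ≡ y
  rank-injective {x} {y} lxy eq with <-cmp (pos x) (pos y)
  ... | tri< lt _ _ = ⊥-elim (<-irrefl eq (rank-< lxy lt))
  ... | tri≈ _ peq _ = pos-injective peq
  ... | tri> _ _ gt = ⊥-elim (<-irrefl (sym eq) (rank-< (sym lxy) gt))

  rank-<⁻ : ∀ {x y} → l x ≡ l y → rank x < rank y → pos x < pos y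
  rank-<⁻ {x} {y} lxy lt with <-cmp (pos x) (pos y)
  ... | tri< lt′ _ _ = lt′
  ... | tri≈ _ peq _ = ⊥-elim (<-irrefl (cong rank (pos-injective peq)) lt)
  ... | tri> _ _ gt = ⊥-elim (<-asym lt (rank-< (sym lxy) gt))

  vertexAt : ℕ → ℕ → List (Fin n)
  vertexAt i ρ with Fin.any? (λ x → l x ≟ i ×-dec rank x ≟ ρ)
  ... | yes (x , _) = x ∷ []
  ... | no _        = []

  length-vertexAt : ∀ i ρ → length (vertexAt i ρ) ≤ 1
  length-vertexAt i ρ with Fin.any? (λ x → l x ≟ i ×-dec rank x ≟ ρ)
  ... | yes _ = ≤-refl
  ... | no _  = z≤n

  ∈-vertexAt : ∀ x → x ∈ₗ vertexAt (l x) (rank x)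
  ∈-vertexAt x with Fin.any? (λ y → l y ≟ l x ×-dec rank y ≟ rank x)
  ... | yes (y , ly , ry) = here (sym (rank-injective ly ry))
  ... | no none = ⊥-elim (none (x , refl , refl))

  distances : List ℕ
  distances = map suc (upTo p)

  length-distances : length distances ≡ p
  length-distances = trans (length-map suc (upTo p)) (length-upTo p)

  ∈-distances : ∀ {a b} → a < b → b ≤ a + p → b ∸ a ∈ₗ distances
  ∈-distances {a} {b} a<b b≤ = subst (_∈ₗ distances) eq
    (∈-map⁺ suc (∈-upTo⁺ (+-cancelˡ-< a _ _ (≤-trans (≤-reflexive (trans (sym (+-suc a (b ∸ suc a))) lem)) b≤))))
    where
    eq : suc (b ∸ suc a) ≡ b ∸ a
    eq = sym (+-∸-assoc 1 a<b)
    lem : a + suc (b ∸ suc a) ≡ b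
    lem = trans (cong (a +_) eq) (m+[n∸m]≡n (<⇒≤ a<b))

  conflictsInRow conflictsAbove conflicts : Fin n → List (Fin n)
  conflictsInRow y = concatMap (λ d → vertexAt (l y) (rank y ∸ d)) distances
  conflictsAbove y =
    concatMap (λ d → concatMap (vertexAt (l y ∸ d)) (dyadicNeighbours m (gap (l y ∸ d) y))) distances
  conflicts y = conflictsInRow y ++ conflictsAbove y

  length-conflicts : ∀ y → length (conflicts y) ≤ p * 1 + p * (2 * suc m * 1)
  length-conflicts y = ≤-trans (≤-reflexive (length-++ (conflictsInRow y))) (+-mono-≤
    (≤-trans (length-concatMap-≤ 1 _ distances (λ d → length-vertexAt (l y) (rank y ∸ d)))
      (≤-reflexive (cong (_* 1) length-distances)))
    (≤-trans (length-concatMap-≤ (2 * suc m * 1) _ distances λ d →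
        ≤-trans (length-concatMap-≤ 1 _ (dyadicNeighbours m (gap (l y ∸ d) y)) (length-vertexAt (l y ∸ d)))
          (≤-reflexive (cong (_* 1) (length-dyadicNeighbours m (gap (l y ∸ d) y)))))
      (≤-reflexive (cong (_* (2 * suc m * 1)) length-distances))))

  ∈-conflictsInRow : ∀ {x y} → l x ≡ l y → rank x < rank y → rank y ≤ rank x + p → x ∈ₗ conflicts y
  ∈-conflictsInRow {x} {y} lxy lt le = ∈-++⁺ˡ (∈-concatMap (∈-distances lt le)
    (subst₂ (λ i ρ → x ∈ₗ vertexAt i ρ) lxy (sym (m∸[m∸n]≡n (<⇒≤ lt))) (∈-vertexAt x)))

  ∈-conflictsAbove : ∀ {x y} → l x < l y → l y ≤ l x + p →
    rank x ∈ₗ dyadicNeighbours m (gap (l x) y) → x ∈ₗ conflicts y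
  ∈-conflictsAbove {x} {y} lt le r∈ = ∈-++⁺ʳ (conflictsInRow y) (∈-concatMap (∈-distances lt le)
    (subst (λ i → x ∈ₗ concatMap (vertexAt i) (dyadicNeighbours m (gap i y))) (sym (m∸[m∸n]≡n (<⇒≤ lt)))
      (∈-concatMap r∈ (∈-vertexAt x))))

  private
    W = proj₁ (strict-upper-bound pos)
    pos<W = proj₂ (strict-upper-bound pos)
    μ : Fin n → ℕ
    -- Row by row upwards and from left to right in each row, as W exceeds all positions.
    μ x = l x * W + pos x
    greedy = greedy-colouring (p * 1 + p * (2 * suc m * 1)) conflicts μ length-conflicts

  φ : Fin n → Fin (colourCount p m)
  φ = proj₁ greedy

  φ-row : ∀ {x y} → l x ≡ l y → rank x < rank y → rank y ≤ rank x + p → φ x ≢ φ y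
  φ-row {x} {y} lxy lt le = proj₂ greedy (∈-conflictsInRow lxy lt le)
    (<-≤-trans (+-monoʳ-< (l x * W) (rank-<⁻ lxy lt)) (≤-reflexive (cong (λ i → i * W + pos y) lxy)))

  φ-above : ∀ {x y} → l x < l y → l y ≤ l x + p → rank x ∈ₗ dyadicNeighbours m (gap (l x) y) → φ x ≢ φ y
  φ-above {x} {y} lt le r∈ = proj₂ greedy (∈-conflictsAbove lt le r∈)
    (<-≤-trans (+-monoʳ-< (l x * W) (pos<W x))
      (≤-trans (≤-reflexive (+-comm (l x * W) W)) (≤-trans (*-monoˡ-≤ W lt) (m≤m+n (l y * W) (pos y)))))

  walk-crosses-right : ∀ {P a b w} → Walk R P a b → pos a < pos w → pos w < pos b →
    P w ⊎ (∃[ c ] ∃[ d ] P c × P d × (l c < l w ⊎ l d < l w))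
  walk-crosses-right (stop _) a<w w<b = ⊥-elim (<-asym a<w w<b)
  walk-crosses-right {w = w} (snoc {c} {b} walk r Pb) a<w w<b with <-cmp (pos c) (pos w)
  ... | tri< c<w _ _ = inj₂ (c , b , walk-last walk , Pb , covered-lower r c<w w<b)
  ... | tri≈ _ eq _ = inj₁ (subst _ (pos-injective eq) (walk-last walk))
  ... | tri> _ _ w<c = walk-crosses-right walk a<w w<c

  -- The form in which planarity is used: a walk past w visits w or has an edge over w, and such an
  -- edge has an end below w. A walk that stays in rows from j upwards thus cannot jump over a
  -- vertex of row j.
  walk-crosses : ∀ {P a b w} j → (∀ {v} → P v → j ≤ l v) → Walk R P a b →
    (pos a < pos w × pos w < pos b) ⊎ (pos b < pos w × pos w < pos a) → P w ⊎ j < l w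
  walk-crosses {P} {a} {b} {w} j low walk between =
    Sum.map₂ (λ { (c , d , Pc , Pd , lt) → [ ≤-<-trans (low Pc) , ≤-<-trans (low Pd) ]′ lt }) (crossing between)
    where
    crossing : (pos a < pos w × pos w < pos b) ⊎ (pos b < pos w × pos w < pos a) →
      P w ⊎ (∃[ c ] ∃[ d ] P c × P d × (l c < l w ⊎ l d < l w))
    crossing (inj₁ (a<w , w<b)) = walk-crosses-right walk a<w w<b
    crossing (inj₂ (b<w , w<a)) = walk-crosses-right (walk-rev R-sym walk) b<w w<a

  -- An edge descends by at most one row, so the first vertex of the walk that is no longer above
  -- row j lies in row j.
  first-hit : ∀ {P : Fin n → Set} j {y u} → j < l y → Walk R P y u → l u ≤ j →
    ∃[ c ] ∃[ x ] Walk R (λ v → P v × j < l v) y c × R c x × P x × l x ≡ j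
  first-hit {P} j {y} j<ly walk lu≤j = [ (λ w → contradiction lu≤j (<⇒≱ (proj₂ (walk-last w)))) , id ]′ (go walk)
    where
    go : ∀ {v} → Walk R P y v → Walk R (λ v → P v × j < l v) y v ⊎
      (∃[ c ] ∃[ x ] Walk R (λ v → P v × j < l v) y c × R c x × P x × l x ≡ j)
    go (stop Py) = inj₁ (stop (Py , j<ly))
    go (snoc {c} {v} w r Pv) with go w
    ... | inj₂ hit = inj₂ hit
    ... | inj₁ w′ with j <? l v
    ... | yes j<lv = inj₁ (snoc w′ r (Pv , j<lv))
    ... | no j≮lv = inj₂ (c , v , w′ , r , Pv ,
      ≤-antisym (≮⇒≥ j≮lv) (s≤s⁻¹ (≤-trans (proj₂ (walk-last w′)) (lipschitz r))))

  gap-≡ : ∀ j {a b} → l a ≢ j → pos a < pos b →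
    (∀ w → l w ≡ j → pos a < pos w → pos w < pos b → ⊥) → gap j a ≡ gap j b
  gap-≡ j {a} {b} la a<b none = rk-const j (<⇒≤ a<b) λ x lx a≤x x<b → case m≤n⇒m<n∨m≡n a≤x of λ where
    (inj₁ a<x) → none x lx a<x x<b
    (inj₂ eq) → la (trans (cong l (pos-injective eq)) lx)

  -- x is the first vertex of row j on a walk from y to u, so it is one of the two vertices of
  -- row j next to y.
  nearest : ∀ {P : Fin n → Set} {y u} j → j ≤ l y → Walk R P y u → l u ≤ j →
    ∃[ x ] P x × l x ≡ j × (gap j y ≡ rank x ⊎ gap j y ≡ suc (rank x)) × (∀ i → i < j → gap i x ≡ gap i y)
  nearest {P} {y} {u} j j≤ly walk lu≤j with m≤n⇒m<n∨m≡n j≤ly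
  ... | inj₂ refl = y , walk-last (walk-rev R-sym walk) , refl , inj₁ refl , λ _ _ → refl
  ... | inj₁ j<ly with first-hit j j<ly walk lu≤j
  ... | c , x , walk′ , r , Px , lx = x , Px , lx , proj₁ result , proj₂ result
    where
    walk″ : Walk R (λ v → j < l v ⊎ v ≡ x) y x
    walk″ = snoc (walk-map id (λ _ _ r → r) (inj₁ ∘ proj₂) walk′) r (inj₂ refl)
    low : ∀ {v} → j < l v ⊎ v ≡ x → j ≤ l v
    low (inj₁ lt) = <⇒≤ lt
    low (inj₂ refl) = ≤-reflexive (sym lx)
    -- Everything strictly between y and x is above row j. Hence x borders the gap of y in row j,
    -- and x and y have the same gap in every lower row.
    between-lower : ∀ {w} → (pos y < pos w × pos w < pos x) ⊎ (pos x < pos w × pos w < pos y) → j < l w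
    between-lower {w} btw with walk-crosses j low walk″ btw
    ... | inj₂ lt = lt
    ... | inj₁ (inj₁ lt) = lt
    ... | inj₁ (inj₂ refl) = ⊥-elim ([ (λ { (_ , lt) → <-irrefl refl lt }) , (λ { (lt , _) → <-irrefl refl lt }) ]′ btw)
    y≢ : ∀ {i} → i ≤ j → l y ≢ i
    y≢ i≤j eq = <-irrefl (sym eq) (≤-<-trans i≤j j<ly)
    x≢ : ∀ {i} → i < j → l x ≢ i
    x≢ i<j eq = <-irrefl (trans (sym eq) lx) i<j
    result : (gap j y ≡ rank x ⊎ gap j y ≡ suc (rank x)) × (∀ i → i < j → gap i x ≡ gap i y)
    result with <-cmp (pos y) (pos x)
    ... | tri< y<x _ _ =
      inj₁ (trans (gap-≡ j (y≢ ≤-refl) y<x (λ w lw a b → <-irrefl (sym lw) (between-lower (inj₁ (a , b)))))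
        (cong (λ i → rk i (pos x)) (sym lx))) ,
      λ i i<j → sym (gap-≡ i (y≢ (<⇒≤ i<j)) y<x
        (λ w lw a b → <-irrefl (sym lw) (<-trans i<j (between-lower (inj₁ (a , b))))))
    ... | tri≈ _ eq _ = ⊥-elim (y≢ ≤-refl (trans (cong l (pos-injective eq)) lx))
    ... | tri> _ _ x<y =
      inj₂ (trans (sym (rk-const j x<y
          (λ w lw a b → <-irrefl (sym lw) (between-lower (inj₂ (a , b))))))
        (trans (cong (λ i → rk i (suc (pos x))) (sym lx)) (rk-at x))) ,
      λ i i<j → gap-≡ i (x≢ i<j) x<y
        (λ w lw a b → <-irrefl (sym lw) (<-trans i<j (between-lower (inj₂ (a , b)))))

  module _ (S : Subset n) (nonempty : ∃[ v ] v ∈ S)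
    (connected : ∀ u v → u ∈ S → v ∈ S → Reach R S u v) where

    private
      top = argmin (_∈? S) l nonempty
      u₀ = proj₁ top
      u₀∈ = proj₁ (proj₂ top)
      i = l u₀
      i≤ : ∀ v → v ∈ S → i ≤ l v
      i≤ = proj₂ (proj₂ top)

      -- The part of S in the row of smallest `l`, that is, in the lowest level it meets.
      TopRow : Fin n → Set
      TopRow v = v ∈ S × l v ≡ i
      TopRow? : Decidable TopRow
      TopRow? v = v ∈? S ×-dec l v ≟ i

      walk : ∀ {u v} → u ∈ S → v ∈ S → Walk R (_∈ S) u v
      walk u∈ v∈ = reach⇒walk (connected _ _ u∈ v∈)

      contiguous : ∀ {x₀ x₁ ρ} → TopRow x₀ → TopRow x₁ → rank x₀ ≤ ρ → ρ ≤ rank x₁ → ∃[ w ] TopRow w × rank w ≡ ρ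
      contiguous {x₀} {x₁} {ρ} (x₀∈ , l₀) (x₁∈ , l₁) ρ≥ ρ≤
        with m≤n⇒m<n∨m≡n ρ≥ | m≤n⇒m<n∨m≡n ρ≤
      ... | inj₂ eq | _ = x₀ , (x₀∈ , l₀) , eq
      ... | _ | inj₂ eq = x₁ , (x₁∈ , l₁) , sym eq
      ... | inj₁ lt | inj₁ gt with rk-surj i (pos x₁) {ρ} (<-≤-trans gt (≤-reflexive (cong (λ j → rk j (pos x₁)) l₁)))
      ... | w , lw , w<x₁ , rw = w , (w∈ , lw) , rw
        where
        w∈ : w ∈ S
        w∈ with walk-crosses i (i≤ _) (walk x₀∈ x₁∈)
          (inj₁ (rank-<⁻ (trans l₀ (sym lw)) (<-≤-trans lt (≤-reflexive (sym rw))) , w<x₁))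
        ... | inj₁ w∈ = w∈
        ... | inj₂ lt = ⊥-elim (<-irrefl (sym lw) lt)

      -- In each of the rows i to i + p take the vertex of S nearest to a deep vertex y. Two of
      -- these have the same gap in the lower of their rows, and the vertex taken there borders this
      -- gap; already the finest dyadic scale makes their colours differ.
      many-rows : ∀ {y} → y ∈ S → i + p ≤ l y → MoreThanColours p φ S
      many-rows {y} y∈ deep = (λ t → proj₁ (z t)) , (λ t → proj₁ (proj₂ (z t))) , injective-by-< differ
        where
        z : (t : Fin (suc p)) → ∃[ x ] x ∈ S × l x ≡ i + toℕ t ×
          (gap (i + toℕ t) y ≡ rank x ⊎ gap (i + toℕ t) y ≡ suc (rank x)) ×
          (∀ i′ → i′ < i + toℕ t → gap i′ x ≡ gap i′ y)
        z t = nearest (i + toℕ t) (≤-trans (+-monoʳ-≤ i (s≤s⁻¹ (Fin.toℕ<n t))) deep) (walk y∈ u₀∈) (m≤m+n i (toℕ t))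
        differ : ∀ t t′ → toℕ t < toℕ t′ → φ (proj₁ (z t)) ≢ φ (proj₁ (z t′))
        differ t t′ lt with z t | z t′
        ... | x , _ , lx , near , _ | x′ , _ , lx′ , _ , gap≡ =
          φ-above (subst₂ _<_ (sym lx) (sym lx′) (+-monoʳ-< i lt))
            (≤-trans (≤-reflexive lx′) (≤-trans (+-monoʳ-≤ i (≤-trans (s≤s⁻¹ (Fin.toℕ<n t′)) (m≤n+m p (toℕ t))))
              (≤-reflexive (trans (sym (+-assoc i (toℕ t) p)) (cong (_+ p) (sym lx))))))
            (subst (λ q → rank x ∈ₗ dyadicNeighbours m q)
              (sym (trans (cong (λ j → gap j x′) lx) (gap≡ (i + toℕ t) (+-monoʳ-< i lt))))
              (side near))
          where
          side : gap (i + toℕ t) y ≡ rank x ⊎ gap (i + toℕ t) y ≡ suc (rank x) →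
            rank x ∈ₗ dyadicNeighbours m (gap (i + toℕ t) y)
          side (inj₁ eq) = subst (_∈ₗ dyadicNeighbours m (gap (i + toℕ t) y)) eq (self∈dyadicNeighbours m (gap (i + toℕ t) y))
          side (inj₂ eq) = subst (_∈ₗ dyadicNeighbours m (gap (i + toℕ t) y)) (cong (_∸ 1) eq) (∸1∈dyadicNeighbours m (gap (i + toℕ t) y))

      long-row : ∀ {x₀ x₁} → TopRow x₀ → TopRow x₁ → rank x₀ + p ≤ rank x₁ → MoreThanColours p φ S
      long-row {x₀} {x₁} T₀ T₁ long = (λ t → proj₁ (z t)) , (λ t → proj₁ (proj₁ (proj₂ (z t)))) , injective-by-< differ
        where
        z : (t : Fin (suc p)) → ∃[ x ] TopRow x × rank x ≡ rank x₀ + toℕ t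
        z t = contiguous T₀ T₁ (m≤m+n (rank x₀) (toℕ t)) (≤-trans (+-monoʳ-≤ (rank x₀) (s≤s⁻¹ (Fin.toℕ<n t))) long)
        differ : ∀ t t′ → toℕ t < toℕ t′ → φ (proj₁ (z t)) ≢ φ (proj₁ (z t′))
        differ t t′ lt with z t | z t′
        ... | x , (_ , lx) , rx | x′ , (_ , lx′) , rx′ =
          φ-row (trans lx (sym lx′)) (subst₂ _<_ (sym rx) (sym rx′) (+-monoʳ-< (rank x₀) lt))
            (≤-trans (≤-reflexive rx′) (≤-trans (+-monoʳ-≤ (rank x₀) (≤-trans (s≤s⁻¹ (Fin.toℕ<n t′)) (m≤n+m p (toℕ t))))
              (≤-reflexive (trans (sym (+-assoc (rank x₀) (toℕ t) p)) (cong (_+ p) (sym rx))))))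

      -- Other vertices of the row are within distance p of the centre w, so their colours differ
      -- from that of w. A vertex y of S above the row has, by `nearest`, a vertex of the row in S
      -- beside its gap; the gap therefore touches the interval, and w is one of its dyadic
      -- neighbours.
      unique-centre : ∀ {x₀ x₁} → TopRow x₀ → TopRow x₁ → (∀ x → TopRow x → rank x₀ ≤ rank x × rank x ≤ rank x₁) →
        rank x₁ < rank x₀ + p → (∀ y → y ∈ S → l y < i + p) → HasUniqueColour φ S
      unique-centre {x₀} {x₁} T₀ T₁ within short shallow
        with dyadic-centre m (rank x₀) (rank x₁) (proj₂ (within x₀ T₀)) (<-≤-trans short (+-monoʳ-≤ (rank x₀) p≤2^m))
      ... | ρ , ρ≥ , ρ≤ , centre with contiguous T₀ T₁ ρ≥ ρ≤
      ... | w , (w∈ , lw) , refl = w , w∈ , unique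
        where
        close : ∀ x y → TopRow x → TopRow y → rank y ≤ rank x + p
        close x y Tx Ty = ≤-trans (proj₂ (within y Ty)) (≤-trans (<⇒≤ short) (+-monoˡ-≤ p (proj₁ (within x Tx))))
        unique : ∀ y → y ∈ S → φ y ≡ φ w → y ≡ w
        unique y y∈ eq with m≤n⇒m<n∨m≡n (i≤ y y∈)
        unique y y∈ eq | inj₂ ly with <-cmp (rank y) (rank w)
        ... | tri< lt _ _ = ⊥-elim (φ-row (trans (sym ly) (sym lw)) lt (close y w (y∈ , sym ly) (w∈ , lw)) eq)
        ... | tri≈ _ r≡ _ = rank-injective (trans (sym ly) (sym lw)) r≡
        ... | tri> _ _ gt = ⊥-elim (φ-row (trans lw ly) gt (close w y (w∈ , lw) (y∈ , sym ly)) (sym eq))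
        unique y y∈ eq | inj₁ i<ly with nearest i (<⇒≤ i<ly) (walk y∈ u₀∈) ≤-refl
        ... | x , x∈ , lx , near , _ = ⊥-elim (φ-above {w} {y} (≤-<-trans (≤-reflexive lw) i<ly)
              (≤-trans (<⇒≤ (shallow y y∈)) (≤-reflexive (cong (_+ p) (sym lw))))
              (subst (λ j → rank w ∈ₗ dyadicNeighbours m (gap j y)) (sym lw)
                (centre (gap i y) (lower near) (upper near)))
              (sym eq))
          where
          lower : gap i y ≡ rank x ⊎ gap i y ≡ suc (rank x) → rank x₀ ≤ gap i y
          lower (inj₁ e) = ≤-trans (proj₁ (within x (x∈ , lx))) (≤-reflexive (sym e))
          lower (inj₂ e) = ≤-trans (m≤n⇒m≤1+n (proj₁ (within x (x∈ , lx)))) (≤-reflexive (sym e))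
          upper : gap i y ≡ rank x ⊎ gap i y ≡ suc (rank x) → gap i y ≤ suc (rank x₁)
          upper (inj₁ e) = ≤-trans (≤-reflexive e) (m≤n⇒m≤1+n (proj₂ (within x (x∈ , lx))))
          upper (inj₂ e) = ≤-trans (≤-reflexive e) (s≤s (proj₂ (within x (x∈ , lx))))

    centred-on : MoreThanColours p φ S ⊎ HasUniqueColour φ S
    centred-on with Fin.any? (λ y → y ∈? S ×-dec i + p ≤? l y)
    ... | yes (y , y∈ , deep) = inj₁ (many-rows y∈ deep)
    ... | no none with argmin TopRow? rank (u₀ , u₀∈ , refl)
    ... | x₀ , T₀ , min with Fin.any? (λ x → TopRow? x ×-dec rank x₀ + p ≤? rank x)
    ... | yes (x₁ , T₁ , long) = inj₁ (long-row T₀ T₁ long)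
    -- This maximises the rank; truncation does no harm because all ranks in question are below
    -- `rank x₀ + p`.
    ... | no short with argmin TopRow? (λ x → (rank x₀ + p) ∸ rank x) (u₀ , u₀∈ , refl)
    ... | x₁ , T₁ , max = inj₂ (unique-centre T₀ T₁
      (λ x Tx → min x Tx , ∸-cancelʳ-≤ (<⇒≤ (≰⇒> (λ le → short (x , Tx , le)))) (max x Tx))
      (≰⇒> (λ le → short (x₁ , T₁ , le)))
      (λ y y∈ → ≰⇒> (λ le → none (y , y∈ , le))))

  layered-order-centred : Σ (Fin n → Fin (colourCount p m)) (PC p R)
  layered-order-centred = φ , λ S (nonempty , connected) → centred-on S nonempty connected

-- Levels of outerplanar graphs

n≤2^suc-log : ∀ n → n ≤ 2 ^ suc ⌊log₂ n ⌋
n≤2^suc-log n with n ≤? 2 ^ suc ⌊log₂ n ⌋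
... | yes le = le
... | no ≰ = contradiction
  (≤-trans (≤-reflexive (sym (⌊log₂[2^n]⌋≡n (suc ⌊log₂ n ⌋)))) (⌊log₂⌋-mono-≤ (<⇒≤ (≰⇒> ≰)))) 1+n≰n

1≤log : ∀ {p} → 2 ≤ p → 1 ≤ ⌊log₂ p ⌋
1≤log 2≤p = ⌊log₂⌋-mono-≤ 2≤p

colourCount≤ : ∀ p L → 1 ≤ p → 1 ≤ L → colourCount p (suc L) ≤ 8 * p * L
colourCount≤ p L 1≤p 1≤L = begin
  suc (p * 1 + p * (2 * suc (suc L) * 1)) ≡⟨ expand p L ⟩
  1 + 5 * p + 2 * (p * L)  ≤⟨ +-monoˡ-≤ (2 * (p * L)) (+-monoˡ-≤ (5 * p) 1≤p) ⟩
  6 * p + 2 * (p * L)      ≡⟨ cong (λ q → 6 * q + 2 * (p * L)) (sym (*-identityʳ p)) ⟩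
  6 * (p * 1) + 2 * (p * L)  ≤⟨ +-monoˡ-≤ (2 * (p * L)) (*-monoʳ-≤ 6 (*-monoʳ-≤ p 1≤L)) ⟩
  6 * (p * L) + 2 * (p * L)  ≡⟨ collect p L ⟩
  8 * p * L ∎
  where
  open ≤-Reasoning
  expand : ∀ p L → suc (p * 1 + p * (2 * suc (suc L) * 1)) ≡ 1 + 5 * p + 2 * (p * L)
  expand = solve-∀
  collect : ∀ p L → 6 * (p * L) + 2 * (p * L) ≡ 8 * p * L
  collect = solve-∀

module IntervalLevels (A : ℕ → ℕ → Set) (A? : ∀ a b → Dec (A a b))
  (noncrossing : ∀ {a b c d} → A a b → A c d → a < c → c < b → b < d → ⊥) where

  Good : (ℕ → ℕ) → ℕ → ℕ → Set
  Good f a b = f a ≤ suc (f b) × f b ≤ suc (f a) × (∀ w → a < w → w < b → f a < f w ⊎ f b < f w)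

  Good-cong : ∀ {f g a b} → a ≤ b → (∀ w → a ≤ w → w ≤ b → f w ≡ g w) → Good g a b → Good f a b
  Good-cong {f} {g} {a} {b} a≤b f≡g (lo , hi , inner) rewrite f≡g a ≤-refl a≤b | f≡g b a≤b ≤-refl =
    lo , hi , λ w a<w w<b → subst (λ x → g a < x ⊎ g b < x) (sym (f≡g w (<⇒≤ a<w) (<⇒≤ w<b))) (inner w a<w w<b)

  -- The levels of both ends are prescribed, so that levellings of adjacent intervals can be glued.
  -- The interval is treated as if its ends were joined by an edge.
  Levels : (i j li lj : ℕ) → Set
  Levels i j li lj = Σ (ℕ → ℕ) λ f → f i ≡ li × f j ≡ lj ×
    (∀ w → i < w → w < j → li < f w ⊎ lj < f w) ×
    (∀ a b → A a b → i ≤ a → a < b → b ≤ j → Good f a b)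

  -- The third corner k of a triangle over i and j: the farthest neighbour of i short of j, or the
  -- next position. Within the interval only an edge from i to j can pass over k: an edge starting
  -- at i is excluded by the choice of k, and one starting later would cross the edge from i to k.
  Apex : ℕ → ℕ → ℕ → Set
  Apex i j k = i < k × k < j × (A i k ⊎ k ≡ suc i) × (∀ b → A i b → k < b → b < j → ⊥)

  apex : ∀ i j k → i < k → k < j → (∀ b → A i b → k < b → b < j → ⊥) → ∃ (Apex i j)
  apex i j k@(suc k′) i<k k<j last with A? i k
  ... | yes Aik = k , i<k , k<j , inj₁ Aik , last
  ... | no ¬Aik with m≤n⇒m<n∨m≡n (s≤s⁻¹ i<k)
  ... | inj₂ refl = k , i<k , k<j , inj₂ refl , last
  ... | inj₁ i<k′ = apex i j k′ i<k′ (<-trans ≤-refl k<j) λ b Aib k′<b b<j → case m≤n⇒m<n∨m≡n k′<b of λ where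
    (inj₁ k<b) → last b Aib k<b b<j
    (inj₂ refl) → ¬Aik Aib

  levels : ∀ fuel i j → i < j → j ≤ i + fuel → ∀ li lj → li ≤ suc lj → lj ≤ suc li → Levels i j li lj
  levels zero i j i<j j≤ _ _ _ _ = contradiction (≤-trans j≤ (≤-reflexive (+-identityʳ i))) (<⇒≱ i<j)
  levels (suc fuel) i j i<j j≤ li lj li≤ lj≤ with m≤n⇒m<n∨m≡n i<j
  ... | inj₂ refl = f , f-i , f-j , (λ w i<w w<j → contradiction i<w (≤⇒≯ (s≤s⁻¹ w<j))) , edge
    where
    f : ℕ → ℕ
    f w with w ≤? i
    ... | yes _ = li
    ... | no _  = lj
    f-i : f i ≡ li
    f-i with i ≤? i
    ... | yes _ = refl
    ... | no ≰  = contradiction ≤-refl ≰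
    f-j : f (suc i) ≡ lj
    f-j with suc i ≤? i
    ... | yes le = contradiction le 1+n≰n
    ... | no _   = refl
    edge : ∀ a b → A a b → i ≤ a → a < b → b ≤ suc i → Good f a b
    edge a b _ i≤a a<b b≤ with ≤-antisym b≤ (≤-trans (s≤s i≤a) a<b)
    ... | refl with ≤-antisym i≤a (s≤s⁻¹ a<b)
    ... | refl rewrite f-i | f-j = li≤ , lj≤ , λ w a<w w<b → contradiction a<w (≤⇒≯ (s≤s⁻¹ w<b))
  ... | inj₁ 1+i<j with apex i j (j ∸ 1) (∸-monoˡ-≤ 1 1+i<j) (∸1< i<j) (λ b _ j-1<b b<j → contradiction b<j (≤⇒≯ (∸1<⇒≤ j-1<b)))
    where
    ∸1< : ∀ {i j} → i < j → j ∸ 1 < j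
    ∸1< {j = suc j} _ = ≤-refl
    ∸1<⇒≤ : ∀ {j b} → j ∸ 1 < b → j ≤ b
    ∸1<⇒≤ {zero} _ = z≤n
    ∸1<⇒≤ {suc j} lt = lt
  ... | k , i<k , k<j , choice , last
    with levels fuel i k i<k (s≤s⁻¹ (≤-trans k<j (≤-trans j≤ (≤-reflexive (+-suc i fuel))))) li lk (≤-trans li≤min (n≤1+n _)) (s≤s (m⊓n≤m li lj))
       | levels fuel k j k<j (≤-trans j≤ (≤-trans (≤-reflexive (+-suc i fuel)) (+-monoˡ-≤ fuel i<k))) lk lj (s≤s (m⊓n≤n li lj)) (≤-trans lj≤min (n≤1+n _))
    where
    open import Data.Nat using (_⊓_)
    -- One above the lower end, hence within one of both ends, whose levels differ by at most one.
    lk = suc (li ⊓ lj)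
    li≤min : li ≤ suc (li ⊓ lj)
    li≤min = ⊓-glb (n≤1+n li) li≤
    lj≤min : lj ≤ suc (li ⊓ lj)
    lj≤min = ⊓-glb lj≤ (n≤1+n lj)
  ... | fL , fL-i , fL-k , innerL , edgeL | fR , fR-k , fR-j , innerR , edgeR =
    f , trans (f≡fL (<⇒≤ i<k)) fL-i , trans (f≡fR (<⇒≤ k<j)) fR-j , inner , edge
    where
    open import Data.Nat using (_⊓_)
    f : ℕ → ℕ
    f w with w ≤? k
    ... | yes _ = fL w
    ... | no _  = fR w
    f≡fL : ∀ {w} → w ≤ k → f w ≡ fL w
    f≡fL {w} w≤k with w ≤? k
    ... | yes _ = refl
    ... | no ≰  = contradiction w≤k ≰
    f≡fR : ∀ {w} → k ≤ w → f w ≡ fR w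
    f≡fR {w} k≤w with w ≤? k
    ... | no _ = refl
    ... | yes w≤k rewrite ≤-antisym w≤k k≤w = trans fL-k (sym fR-k)
    over : ∀ {x} → suc (li ⊓ lj) ≤ x → li < x ⊎ lj < x
    over {x} lt with ⊓-sel li lj
    ... | inj₁ e = inj₁ (subst (_< x) e lt)
    ... | inj₂ e = inj₂ (subst (_< x) e lt)
    inner : ∀ w → i < w → w < j → li < f w ⊎ lj < f w
    inner w i<w w<j with <-cmp w k
    ... | tri≈ _ refl _ = over (≤-reflexive (sym (trans (f≡fL ≤-refl) fL-k)))
    ... | tri< w<k _ _ = subst (λ x → li < x ⊎ lj < x) (sym (f≡fL (<⇒≤ w<k)))
      ([ inj₁ , (λ lt → over (<⇒≤ lt)) ]′ (innerL w i<w w<k))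
    ... | tri> _ _ k<w = subst (λ x → li < x ⊎ lj < x) (sym (f≡fR (<⇒≤ k<w)))
      ([ (λ lt → over (<⇒≤ lt)) , inj₂ ]′ (innerR w k<w w<j))
    edge : ∀ a b → A a b → i ≤ a → a < b → b ≤ j → Good f a b
    edge a b Aab i≤a a<b b≤j with ≤-<-connex b k | ≤-<-connex k a
    ... | inj₁ b≤k | _ = Good-cong (<⇒≤ a<b) (λ w _ w≤b → f≡fL (≤-trans w≤b b≤k)) (edgeL a b Aab i≤a a<b b≤k)
    ... | inj₂ _ | inj₁ k≤a = Good-cong (<⇒≤ a<b) (λ w a≤w _ → f≡fR (≤-trans k≤a a≤w)) (edgeR a b Aab k≤a a<b b≤j)
    ... | inj₂ k<b | inj₂ a<k with m≤n⇒m<n∨m≡n i≤a | m≤n⇒m<n∨m≡n b≤j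
    ... | inj₁ i<a | _ = ⊥-elim ([ (λ Aik → noncrossing Aik Aab i<a a<k k<b) ,
                                   (λ { refl → <⇒≱ a<k i<a }) ]′ choice)
    ... | inj₂ refl | inj₁ b<j = ⊥-elim (last b Aab k<b b<j)
    ... | inj₂ refl | inj₂ refl =
      subst₂ (λ x y → x ≤ suc y × y ≤ suc x × (∀ w → i < w → w < j → x < f w ⊎ y < f w))
        (sym (trans (f≡fL (<⇒≤ i<k)) fL-i)) (sym (trans (f≡fR (<⇒≤ k<j)) fR-j))
        (li≤ , lj≤ , inner)

outerplanar-centred : ∀ {n} (G : Graph n) → Outerplanar G → ∀ p m → p ≤ 2 ^ m → χ≤ p G (colourCount p m)
outerplanar-centred {zero} G _ p m _ = (λ ()) , λ { S ((() , _) , _) }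
outerplanar-centred {suc n} G (σ , σ-inj , planar) p m p≤ =
  LayeredOrder.layered-order-centred (Edge G) edge-sym pos l pos-inj lipschitz covered p m p≤
  where
  edge-sym : ∀ {u v} → Edge G u v → Edge G v u
  edge-sym {u} {v} e = trans (symm G v u) e
  pos : Fin (suc n) → ℕ
  pos = toℕ ∘ σ
  pos-inj : ∀ {u v} → pos u ≡ pos v → u ≡ v
  pos-inj = σ-inj ∘ Fin.toℕ-injective
  A : ℕ → ℕ → Set
  A a b = ∃[ u ] ∃[ v ] Edge G u v × pos u ≡ a × pos v ≡ b
  A? : ∀ a b → Dec (A a b)
  A? a b = Fin.any? λ u → Fin.any? λ v → (adj G u v Bool.≟ true) ×-dec pos u ≟ a ×-dec pos v ≟ b
  noncrossing : ∀ {a b c d} → A a b → A c d → a < c → c < b → b < d → ⊥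
  noncrossing (u , v , e , refl , refl) (u′ , v′ , e′ , refl , refl) = planar u v u′ v′ e e′
  open IntervalLevels A A? noncrossing
  L : Levels 0 (suc n) 0 0
  -- Position `suc n` holds no vertex; it only closes the interval of the positions 0 to n.
  L = levels (suc n) 0 (suc n) z<s ≤-refl 0 0 z≤n z≤n
  f = proj₁ L
  l = f ∘ pos
  good : ∀ u v → Edge G u v → pos u < pos v → Good f (pos u) (pos v)
  good u v e lt = proj₂ (proj₂ (proj₂ (proj₂ L))) (pos u) (pos v) (u , v , e , refl , refl) z≤n lt (<⇒≤ (Fin.toℕ<n (σ v)))
  lipschitz : ∀ {u v} → Edge G u v → l u ≤ suc (l v)
  lipschitz {u} {v} e with <-cmp (pos u) (pos v)
  ... | tri< lt _ _ = proj₁ (good u v e lt)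
  ... | tri≈ _ eq _ = ≤-trans (≤-reflexive (cong f eq)) (n≤1+n _)
  ... | tri> _ _ gt = proj₁ (proj₂ (good v u (edge-sym e) gt))
  covered : ∀ {u v w} → Edge G u v → pos u < pos w → pos w < pos v → l u < l w ⊎ l v < l w
  covered {u} {v} {w} e u<w w<v = proj₂ (proj₂ (good u v e (<-trans u<w w<v))) (pos w) u<w w<v

outerplanar-χ≤ : ∀ p → 2 ≤ p → ∀ n (G : Graph n) → Outerplanar G → χ≤ p G (48 * p * ⌊log₂ p ⌋)
outerplanar-χ≤ p 2≤p n G out = PC-mono
  -- Factor 8 suffices here; 48 is what the planar bound requires of the common constant.
  (≤-trans (colourCount≤ p ⌊log₂ p ⌋ (<⇒≤ 2≤p) (1≤log 2≤p)) (*-monoˡ-≤ ⌊log₂ p ⌋ (*-monoˡ-≤ p (m≤m+n 8 40))))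
  (outerplanar-centred G out p (suc ⌊log₂ p ⌋) (n≤2^suc-log p))

-- Layerings of chordal graphs

%-injective-window : ∀ {a b M} → a ≤ b → b < a + suc M → a % suc M ≡ b % suc M → a ≡ b
%-injective-window {a} {b} {M} a≤b b< eq with <-cmp (a / suc M) (b / suc M)
... | tri≈ _ q≡ _ = trans (m≡m%n+[m/n]*n a (suc M)) (trans (cong₂ (λ r q → r + q * suc M) eq q≡) (sym (m≡m%n+[m/n]*n b (suc M))))
... | tri< lt _ _ = contradiction b< (≤⇒≯ (begin
    a + suc M                                  ≡⟨ cong (_+ suc M) (m≡m%n+[m/n]*n a (suc M)) ⟩
    a % suc M + a / suc M * suc M + suc M      ≡⟨ +-assoc (a % suc M) _ _ ⟩
    a % suc M + (a / suc M * suc M + suc M)    ≡⟨ cong₂ _+_ eq (+-comm (a / suc M * suc M) (suc M)) ⟩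
    b % suc M + suc (a / suc M) * suc M        ≤⟨ +-monoʳ-≤ (b % suc M) (*-monoˡ-≤ (suc M) lt) ⟩
    b % suc M + b / suc M * suc M              ≡⟨ sym (m≡m%n+[m/n]*n b (suc M)) ⟩
    b ∎))
  where open ≤-Reasoning
... | tri> _ _ gt = contradiction a≤b (<⇒≱ (begin-strict
    b                                          ≡⟨ m≡m%n+[m/n]*n b (suc M) ⟩
    b % suc M + b / suc M * suc M              <⟨ +-monoʳ-< (b % suc M) (*-monoˡ-< (suc M) gt) ⟩
    b % suc M + a / suc M * suc M              ≡⟨ cong (_+ a / suc M * suc M) (sym eq) ⟩
    a % suc M + a / suc M * suc M              ≡⟨ sym (m≡m%n+[m/n]*n a (suc M)) ⟩
    a ∎))
  where open ≤-Reasoning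

-- The vertices are numbered by a perfect elimination order along which the layers increase.
module Layering {n : ℕ} (R : Fin n → Fin n → Set) (R-sym : ∀ {u v} → R u v → R v u) (R-irrefl : ∀ {u} → ¬ R u u)
  (layer : Fin n → ℕ)
  (earlier-clique : ∀ {u v w} → R u w → R v w → toℕ u < toℕ w → toℕ v < toℕ w → u ≢ v → R u v)
  (monotone : ∀ {u w} → R u w → toℕ u < toℕ w → layer u ≤ layer w)
  (stretch : ∀ {u w} → R u w → toℕ u < toℕ w → layer w ≤ 3 + layer u)
  (p : ℕ) where

  SameLayer : Fin n → Fin n → Set
  SameLayer u v = R u v × layer u ≡ layer v

  lipschitz : ∀ {u v} → R u v → layer v ≤ 3 + layer u
  lipschitz {u} {v} r with <-cmp (toℕ u) (toℕ v)
  ... | tri< lt _ _ = stretch r lt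
  ... | tri≈ _ eq _ = ≤-trans (≤-reflexive (cong layer (sym (Fin.toℕ-injective eq)))) (m≤n+m _ 3)
  ... | tri> _ _ gt = ≤-trans (monotone (R-sym r) gt) (m≤n+m _ 3)

  -- A passage from y through x to z is replaced by the edge from y to z, or by nothing when y and z
  -- coincide.
  bypass : ∀ {P Q : Fin n → Set} x → (∀ {v} → P v → v ≢ x → Q v) →
    (∀ {y z} → P x → Q y → Q z → R y x → R z x → y ≢ z → R y z) →
    ∀ {u v} → u ≢ x → v ≢ x → Walk R P u v → Walk R Q u v
  bypass {P} {Q} x P⇒Q clique {u} u≢x v≢x walk = [ proj₂ , (λ { (eq , _) → ⊥-elim (v≢x eq) }) ]′ (go walk)
    where
    go : ∀ {v} → Walk R P u v → (v ≢ x × Walk R Q u v) ⊎ (v ≡ x × P x × ∃[ c ] Walk R Q u c × R c x)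
    go (stop Pu) = inj₁ (u≢x , stop (P⇒Q Pu u≢x))
    go (snoc {c} {v} w r Pv) with go w | v Fin.≟ x
    ... | inj₁ (_ , w′) | no v≢ = inj₁ (v≢ , snoc w′ r (P⇒Q Pv v≢))
    ... | inj₁ (_ , w′) | yes refl = inj₂ (refl , Pv , c , w′ , r)
    ... | inj₂ (refl , _) | yes refl = ⊥-elim (R-irrefl r)
    ... | inj₂ (refl , Px , d , w′ , r′) | no v≢ with d Fin.≟ v
    ... | yes refl = inj₁ (v≢ , w′)
    ... | no d≢v = inj₁ (v≢ , snoc w′ (clique Px (walk-last w′) (P⇒Q Pv v≢) r′ (R-sym r) d≢v) (P⇒Q Pv v≢))

  module _ {S : Fin n → Set} (i : ℕ) (i≤ : ∀ {v} → S v → i ≤ layer v) where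

    Upto : ℕ → Fin n → Set
    Upto t v = S v × (layer v ≡ i ⊎ toℕ v < t)

    -- The vertices outside layer i are bypassed from the last in the elimination order to the
    -- first. When the turn of x comes, all its remaining neighbours precede it and so form a
    -- clique: a later neighbour would lie in layer i, and monotonicity would then put x into layer
    -- i as well.
    eliminate : ∀ t {u v} → layer u ≡ i → layer v ≡ i → Walk R (Upto t) u v → Walk R (Upto 0) u v
    eliminate zero lu lv walk = walk
    eliminate (suc t) lu lv walk with Fin.any? (λ x → toℕ x ≟ t ×-dec ¬? (layer x ≟ i))
    ... | no none = eliminate t lu lv (walk-map id (λ _ _ r → r) keep walk)
      where
      keep : ∀ {v} → Upto (suc t) v → Upto t v
      keep (Sv , inj₁ lv) = Sv , inj₁ lv
      keep {v} (Sv , inj₂ v≤t) with layer v ≟ i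
      ... | yes lv = Sv , inj₁ lv
      ... | no lv≢ = Sv , inj₂ (≤∧≢⇒< (s≤s⁻¹ v≤t) (λ eq → none (v , eq , lv≢)))
    ... | yes (x , refl , lx) = eliminate (toℕ x) lu lv (bypass x keep clique (other lu) (other lv) walk)
      where
      other : ∀ {v} → layer v ≡ i → v ≢ x
      other lv refl = lx lv
      keep : ∀ {v} → Upto (suc (toℕ x)) v → v ≢ x → Upto (toℕ x) v
      keep (Sv , inj₁ lv) _ = Sv , inj₁ lv
      keep (Sv , inj₂ v≤x) v≢x = Sv , inj₂ (≤∧≢⇒< (s≤s⁻¹ v≤x) (v≢x ∘ Fin.toℕ-injective))
      earlier : ∀ {y} → Upto (suc (toℕ x)) x → Upto (toℕ x) y → R y x → toℕ y < toℕ x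
      earlier _ (_ , inj₂ lt) _ = lt
      earlier {y} (Sx , _) (Sy , inj₁ ly) r with <-cmp (toℕ y) (toℕ x)
      ... | tri< lt _ _ = lt
      ... | tri≈ _ eq _ = ⊥-elim (lx (trans (cong layer (sym (Fin.toℕ-injective eq))) ly))
      ... | tri> _ _ gt = ⊥-elim (lx (≤-antisym (≤-trans (monotone (R-sym r) gt) (≤-reflexive ly)) (i≤ Sx)))
      clique : ∀ {y z} → Upto (suc (toℕ x)) x → Upto (toℕ x) y → Upto (toℕ x) z → R y x → R z x → y ≢ z → R y z
      clique Ux Uy Uz ryx rzx = earlier-clique ryx rzx (earlier Ux Uy ryx) (earlier Ux Uz rzx)

    lowest-layer-connected : ∀ {u v} → layer u ≡ i → layer v ≡ i → Walk R S u v →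
      Walk SameLayer (λ w → S w × layer w ≡ i) u v
    lowest-layer-connected lu lv walk = walk-map id same flat (eliminate n lu lv
      (walk-map id (λ _ _ r → r) (λ {v} Sv → Sv , inj₂ (Fin.toℕ<n v)) walk))
      where
      flat : ∀ {v} → Upto 0 v → S v × layer v ≡ i
      flat (Sv , inj₁ lv) = Sv , lv
      same : ∀ {a b} → Upto 0 a → Upto 0 b → R a b → SameLayer a b
      same Ua Ub r = r , trans (proj₂ (flat Ua)) (sym (proj₂ (flat Ub)))

  walk-hits : ∀ {P : Fin n → Set} {u v} T → layer u ≤ T → T ≤ layer v → Walk R P u v →
    ∃[ x ] P x × T ≤ layer x × layer x < T + 3
  walk-hits {P} {u} T lu T≤ walk = [ (λ lt → contradiction T≤ (<⇒≱ lt)) , id ]′ (go walk)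
    where
    go : ∀ {v} → Walk R P u v → layer v < T ⊎ (∃[ x ] P x × T ≤ layer x × layer x < T + 3)
    go (stop Pu) with m≤n⇒m<n∨m≡n lu
    ... | inj₁ lt = inj₁ lt
    ... | inj₂ eq = inj₂ (u , Pu , ≤-reflexive (sym eq) , <-≤-trans (s≤s lu) (≤-trans (≤-reflexive (+-comm 1 T)) (+-monoʳ-≤ T (s≤s z≤n))))
    go (snoc {c} {v} w r Pv) with go w
    ... | inj₂ hit = inj₂ hit
    ... | inj₁ lc with ≤-<-connex T (layer v)
    ... | inj₂ lt = inj₁ lt
    ... | inj₁ ge = inj₂ (v , Pv , ge , (begin-strict
      layer v       ≤⟨ lipschitz r ⟩
      3 + layer c   <⟨ +-monoʳ-< 3 lc ⟩
      3 + T         ≡⟨ +-comm 3 T ⟩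
      T + 3 ∎))
      where open ≤-Reasoning

  -- A walk cannot jump over three consecutive layers. Hence p + 1 disjoint windows of three layers
  -- yield p + 1 vertices in distinct layers, and residues modulo M tell these layers apart.
  M : ℕ
  M = 3 * suc p

  residue : ℕ → Fin M
  residue a = fromℕ< (m%n<n a M)

  residue-injective : ∀ {a b i} → i ≤ a → i ≤ b → a < i + M → b < i + M → residue a ≡ residue b → a ≡ b
  residue-injective {a} {b} {i} ia ib a< b< eq with ≤-total a b
  ... | inj₁ a≤b = %-injective-window a≤b (<-≤-trans b< (+-monoˡ-≤ M ia)) eq′
    where
    eq′ : a % M ≡ b % M
    eq′ = trans (sym (Fin.toℕ-fromℕ< _)) (trans (cong toℕ eq) (Fin.toℕ-fromℕ< _))
  ... | inj₂ b≤a = sym (%-injective-window b≤a (<-≤-trans a< (+-monoˡ-≤ M ib)) eq′)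
    where
    eq′ : b % M ≡ a % M
    eq′ = trans (sym (Fin.toℕ-fromℕ< _)) (trans (cong toℕ (sym eq)) (Fin.toℕ-fromℕ< _))

  -- A set reaching 3p layers above its lowest one shows more than p residues. Otherwise it fits
  -- into M consecutive layers, where equal residues mean equal layers; its part in the lowest layer
  -- is connected, and what `ψ` achieves there carries over to the whole set.
  layered-centred : ∀ {k} → Σ (Fin n → Fin k) (PC p SameLayer) → Σ (Fin n → Fin (M * k)) (PC p R)
  layered-centred {k} (ψ , ψ-centred) = φ , φ-centred
    where
    φ : Fin n → Fin (M * k)
    φ v = combine (residue (layer v)) (ψ v)
    φ-centred : PC p R φ
    φ-centred S (nonempty , connected) with argmin (_∈? S) layer nonempty
    ... | u , u∈ , min with Fin.any? (λ y → y ∈? S ×-dec layer u + 3 * p ≤? layer y)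
    ... | yes (y , y∈ , deep) = inj₁ ((λ t → proj₁ (z t)) , (λ t → proj₁ (proj₂ (z t))) , injective-by-< differ)
      where
      T : Fin (suc p) → ℕ
      T t = layer u + 3 * toℕ t
      z : (t : Fin (suc p)) → ∃[ x ] x ∈ S × T t ≤ layer x × layer x < T t + 3
      z t = walk-hits (T t) (m≤m+n (layer u) _)
        (≤-trans (+-monoʳ-≤ (layer u) (*-monoʳ-≤ 3 (s≤s⁻¹ (Fin.toℕ<n t)))) deep)
        (reach⇒walk (connected u y u∈ y∈))
      next : ∀ {t t′} → toℕ t < toℕ t′ → T t + 3 ≤ T t′
      next {t} {t′} lt = ≤-trans (≤-reflexive (trans (+-assoc (layer u) (3 * toℕ t) 3)
        (cong (layer u +_) (trans (+-comm (3 * toℕ t) 3) (sym (*-suc 3 (toℕ t)))))))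
        (+-monoʳ-≤ (layer u) (*-monoʳ-≤ 3 lt))
      top : ∀ t → layer (proj₁ (z t)) < layer u + M
      top t = <-≤-trans (proj₂ (proj₂ (proj₂ (z t))))
        (≤-trans (≤-reflexive (trans (+-assoc (layer u) (3 * toℕ t) 3)
          (cong (layer u +_) (trans (+-comm (3 * toℕ t) 3) (sym (*-suc 3 (toℕ t)))))))
          (+-monoʳ-≤ (layer u) (*-monoʳ-≤ 3 (Fin.toℕ<n t))))
      bottom : ∀ t → layer u ≤ layer (proj₁ (z t))
      bottom t = ≤-trans (m≤m+n (layer u) _) (proj₁ (proj₂ (proj₂ (z t))))
      differ : ∀ t t′ → toℕ t < toℕ t′ → φ (proj₁ (z t)) ≢ φ (proj₁ (z t′))
      differ t t′ lt eq = <-irrefl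
        (residue-injective (bottom t) (bottom t′) (top t) (top t′) (proj₁ (Fin.combine-injective (residue (layer (proj₁ (z t)))) (ψ (proj₁ (z t))) (residue (layer (proj₁ (z t′)))) (ψ (proj₁ (z t′))) eq)))
        (<-≤-trans (proj₂ (proj₂ (proj₂ (z t)))) (≤-trans (next lt) (proj₁ (proj₂ (proj₂ (z t′))))))
    ... | no shallow = Sum.map more unique (ψ-centred lowest ((u , ∈-subset⁺ Lowest? (u∈ , refl)) , conn))
      where
      i = layer u
      Lowest? : Decidable (λ v → v ∈ S × layer v ≡ i)
      Lowest? v = v ∈? S ×-dec layer v ≟ i
      lowest = subset Lowest?
      conn : ∀ v w → v ∈ lowest → w ∈ lowest → Reach SameLayer lowest v w
      conn v w v∈ w∈ with ∈-subset⁻ Lowest? v∈ | ∈-subset⁻ Lowest? w∈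
      ... | v∈S , lv | w∈S , lw = walk⇒reach (walk-map id (λ _ _ r → r) (∈-subset⁺ Lowest?)
        (lowest-layer-connected i (min _) lv lw (reach⇒walk (connected v w v∈S w∈S))))
      more : MoreThanColours p ψ lowest → MoreThanColours p φ S
      more (f , f∈ , inj) = f , (λ t → proj₁ (∈-subset⁻ Lowest? (f∈ t))) ,
        λ {x} {y} eq → inj (proj₂ (Fin.combine-injective (residue (layer (f x))) _ (residue (layer (f y))) _ eq))
      window : ∀ {v} → v ∈ S → layer v < i + M
      window {v} v∈ = <-≤-trans (≰⇒> (λ le → shallow (v , v∈ , le))) (+-monoʳ-≤ i (*-monoʳ-≤ 3 (n≤1+n p)))
      unique : HasUniqueColour ψ lowest → HasUniqueColour φ S
      unique (v , v∈ , uniq) with ∈-subset⁻ Lowest? v∈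
      ... | v∈S , lv = v , v∈S , λ w w∈ eq →
        let r≡ , ψ≡ = Fin.combine-injective (residue (layer w)) (ψ w) (residue (layer v)) (ψ v) eq
        in uniq w (∈-subset⁺ Lowest? (w∈ , trans (residue-injective (min w w∈) (min v v∈S) (window w∈) (window v∈S) r≡) lv)) ψ≡

-- Layouts of stacked triangulations

-- `Stacked` lists the corners in an order that says nothing about their roles as apex, left and
-- right.
data Perm3 {A : Set} : A × A × A → A → A → A → Set where
  abc : ∀ {a b c} → Perm3 (a , b , c) a b c
  acb : ∀ {a b c} → Perm3 (a , b , c) a c b
  bac : ∀ {a b c} → Perm3 (a , b , c) b a c
  bca : ∀ {a b c} → Perm3 (a , b , c) b c a
  cab : ∀ {a b c} → Perm3 (a , b , c) c a b
  cba : ∀ {a b c} → Perm3 (a , b , c) c b a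

-- A face awaiting a vertex: the vertex will get layer depth, level height, and position slot;
-- left and right are its neighbours of the same layer, if they have layer depth at all.
record FaceData (n : ℕ) : Set where
  constructor faceData
  field
    apex left right   : Fin n
    depth slot height : ℕ

open FaceData

Adj : ∀ {n} → List (Fin n × Fin n) → Fin n → Fin n → Set
Adj E u v = (u , v) ∈ₗ E ⊎ (v , u) ∈ₗ E

Between : ℕ → ℕ → ℕ → Set
Between a w b = (a < w × w < b) ⊎ (b < w × w < a)

-- Reserved places count like vertices. The covering conditions then already hold for a vertex
-- before it is inserted.
data Item {n} (pos level : Fin n → ℕ) (D : List (FaceData n)) : ℕ → ℕ → Set where
  vertex : ∀ v → Item pos level D (pos v) (level v)
  free   : ∀ {d} → d ∈ₗ D → Item pos level D (slot d) (height d)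

module _ {n : ℕ} (E : List (Fin n × Fin n)) (layer level pos : Fin n → ℕ) (D : List (FaceData n)) where

  LeftSide RightSide : FaceData n → Set
  LeftSide d = layer (left d) ≡ depth d → pos (left d) < slot d ×
    level (left d) ≤ height d × height d ≤ suc (level (left d)) ×
    (∀ {π η} → Item pos level D π η → pos (left d) < π → π < slot d → level (left d) < η)
  RightSide d = layer (right d) ≡ depth d → slot d < pos (right d) ×
    level (right d) ≤ height d × height d ≤ suc (level (right d)) ×
    (∀ {π η} → Item pos level D π η → slot d < π → π < pos (right d) → level (right d) < η)

  -- The corners are at most 3, 2 and 1 layers below `depth d`. The face without the apex moves one
  -- layer up: its new vertex is then at distance 1, the nearer side at distance 2, and the farther
  -- side becomes the apex at distance 3. This is why edges stretch over at most three layers.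
  record FaceOK (d : FaceData n) : Set where
    field
      apex-left   : Adj E (apex d) (left d)
      apex-right  : Adj E (apex d) (right d)
      left-right  : Adj E (left d) (right d)
      apex-depth  : layer (apex d) < depth d
      left-depth  : layer (left d) ≤ depth d
      right-depth : layer (right d) ≤ depth d
      apex-near   : depth d ≤ 3 + layer (apex d)
      sides-near  : (depth d ≤ 2 + layer (left d) × depth d ≤ 1 + layer (right d)) ⊎
                    (depth d ≤ 1 + layer (left d) × depth d ≤ 2 + layer (right d))
      vacant      : ∀ v → pos v ≢ slot d
      left-side   : LeftSide d
      right-side  : RightSide d

-- Although `edge-cover` concerns edges inside one layer, it speaks of items of all layers: a single
-- `pos` and a single `level` serve every layer at once.
record Layout (n : ℕ) (E : List (Fin n × Fin n)) (F : List (Tri n)) : Set where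
  field
    layer level pos : Fin n → ℕ
    D              : List (FaceData n)
    represents     : Pointwise (λ t d → Perm3 t (apex d) (left d) (right d)) F D
    facesOK        : All (FaceOK E layer level pos D) D
    distinct-slots : AllPairs (λ d d′ → slot d ≢ slot d′) D
    pos-injective  : ∀ {u v} → pos u ≡ pos v → u ≡ v
    edge-<         : ∀ {u v} → (u , v) ∈ₗ E → toℕ u < toℕ v
    edge-monotone  : ∀ {u v} → (u , v) ∈ₗ E → layer u ≤ layer v
    edge-stretch   : ∀ {u v} → (u , v) ∈ₗ E → layer v ≤ 3 + layer u
    edge-clique    : ∀ {u v w} → (u , w) ∈ₗ E → (v , w) ∈ₗ E → u ≢ v → Adj E u v
    edge-level     : ∀ {u v} → (u , v) ∈ₗ E → layer u ≡ layer v →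
                     level u ≤ suc (level v) × level v ≤ suc (level u)
    edge-cover     : ∀ {u v} → (u , v) ∈ₗ E → layer u ≡ layer v → ∀ {π η} → Item pos level D π η →
                     Between (pos u) π (pos v) → level u < η ⊎ level v < η

ext : ∀ {n} {A : Set} → (Fin n → A) → A → Fin (suc n) → A
ext {zero}  f y zero    = y
ext {suc n} f y zero    = f zero
ext {suc n} f y (suc i) = ext (f ∘ suc) y i

ext-inject₁ : ∀ {n} {A : Set} (f : Fin n → A) y i → ext f y (inject₁ i) ≡ f i
ext-inject₁ f y zero    = refl
ext-inject₁ f y (suc i) = ext-inject₁ (f ∘ suc) y i

ext-fromℕ : ∀ {n} {A : Set} (f : Fin n → A) y → ext f y (fromℕ n) ≡ y
ext-fromℕ {zero}  f y = refl
ext-fromℕ {suc n} f y = ext-fromℕ (f ∘ suc) y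

extract : ∀ {A B : Set} {R : A → B → Set} {F D} → Pointwise R F D → (i : Fin (length F)) →
  ∃[ D₁ ] ∃[ d ] ∃[ D₂ ] D ≡ D₁ ++ d ∷ D₂ × R (lookup F i) d × Pointwise R (removeAt F i) (D₁ ++ D₂)
extract (_∷_ {y = d} {ys = D} r rs) zero = [] , d , D , refl , r , rs
extract (_∷_ {y = d′} r rs) (suc i) with extract rs i
... | D₁ , d , D₂ , refl , r′ , rs′ = d′ ∷ D₁ , d , D₂ , refl , r′ , r ∷ rs′

∈-middle : ∀ {A : Set} {x y : A} xs {ys} → x ∈ₗ xs ++ ys → x ∈ₗ xs ++ y ∷ ys
∈-middle []       x∈         = there x∈
∈-middle (_ ∷ xs) (here px)  = here px
∈-middle (_ ∷ xs) (there x∈) = there (∈-middle xs x∈)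

AllPairs-middle : ∀ {A : Set} {R : A → A → Set} → (∀ {x y} → R x y → R y x) → ∀ xs {y ys} →
  AllPairs R (xs ++ y ∷ ys) → All (R y) (xs ++ ys) × AllPairs R (xs ++ ys)
AllPairs-middle R-sym [] (Ry ∷ rest) = Ry , rest
AllPairs-middle R-sym (x ∷ xs) (Rx ∷ rest) with AllPairs-middle R-sym xs rest
... | Ry , rest′ = R-sym (All.lookup Rx (∈-++⁺ʳ xs (here refl))) ∷ Ry ,
  All.tabulate (λ z∈ → All.lookup Rx (∈-middle xs z∈)) ∷ rest′

4*-≤ : ∀ {a g ρ} → 4 * a ≤ 4 * g + ρ → ρ < 4 → a ≤ g
4*-≤ {a} {g} {ρ} le ρ<4 = s≤s⁻¹ (*-cancelˡ-< 4 a (suc g) (begin-strict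
  4 * a      ≤⟨ le ⟩
  4 * g + ρ  <⟨ +-monoʳ-< (4 * g) ρ<4 ⟩
  4 * g + 4  ≡⟨ +-comm (4 * g) 4 ⟩
  4 + 4 * g  ≡⟨ sym (*-suc 4 g) ⟩
  4 * suc g ∎))
  where open ≤-Reasoning

4*+< : ∀ {a g ρ} → 4 * g + ρ < 4 * a → g < a
4*+< {a} {g} {ρ} lt = *-cancelˡ-< 4 g a (≤-<-trans (m≤m+n (4 * g) ρ) lt)

<4* : ∀ {a g} ρ → ρ < 4 → g < a → 4 * g + ρ < 4 * a
<4* {a} {g} ρ ρ<4 g<a = begin-strict
  4 * g + ρ  <⟨ +-monoʳ-< (4 * g) ρ<4 ⟩
  4 * g + 4  ≡⟨ +-comm (4 * g) 4 ⟩
  4 + 4 * g  ≡⟨ sym (*-suc 4 g) ⟩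
  4 * suc g  ≤⟨ *-monoʳ-≤ 4 g<a ⟩
  4 * a ∎
  where open ≤-Reasoning

4*< : ∀ {a g} ρ → a < g → 4 * a < 4 * g + ρ
4*< {a} {g} ρ a<g = <-≤-trans (*-monoʳ-< 4 a<g) (m≤m+n (4 * g) ρ)

4*-cancel : ∀ {a g ρ} → ρ < 4 → 4 * a ≡ 4 * g + ρ → a ≡ g
4*-cancel {a} {g} {ρ} ρ<4 eq = ≤-antisym (4*-≤ (≤-reflexive eq) ρ<4)
  (*-cancelˡ-≤ 4 (≤-trans (m≤m+n (4 * g) ρ) (≤-reflexive (sym eq))))

module Insert {n : ℕ} {E : List (Fin n × Fin n)} {F : List (Tri n)} (L : Layout n E F) (i : Fin (length F)) where

  open Layout L

  private
    X = extract represents i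
    D₁ = proj₁ X
    d = proj₁ (proj₂ X)
    D₂ = proj₁ (proj₂ (proj₂ X))
    D≡ : D ≡ D₁ ++ d ∷ D₂
    D≡ = proj₁ (proj₂ (proj₂ (proj₂ X)))
    rep : Perm3 (lookup F i) (apex d) (left d) (right d)
    rep = proj₁ (proj₂ (proj₂ (proj₂ (proj₂ X))))
    reps : Pointwise (λ t d → Perm3 t (apex d) (left d) (right d)) (removeAt F i) (D₁ ++ D₂)
    reps = proj₂ (proj₂ (proj₂ (proj₂ (proj₂ X))))
    a b c : Fin n
    a = proj₁ (lookup F i)
    b = proj₁ (proj₂ (lookup F i))
    c = proj₂ (proj₂ (lookup F i))
    g = slot d
    h = height d
    x : Fin (suc n)
    x = fromℕ n

    d∈ : d ∈ₗ D
    d∈ = subst (d ∈ₗ_) (sym D≡) (∈-++⁺ʳ D₁ (here refl))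
    rest∈ : ∀ {d′} → d′ ∈ₗ D₁ ++ D₂ → d′ ∈ₗ D
    rest∈ {d′} m = subst (d′ ∈ₗ_) (sym D≡) (∈-middle D₁ m)
    split : All (λ d′ → slot d ≢ slot d′) (D₁ ++ D₂) × AllPairs (λ d d′ → slot d ≢ slot d′) (D₁ ++ D₂)
    split = AllPairs-middle ≢-sym D₁ (subst (AllPairs _) D≡ distinct-slots)
    ok : ∀ {d′} → d′ ∈ₗ D → FaceOK E layer level pos D d′
    ok m = All.lookup facesOK m
    open FaceOK (ok d∈)

    Role : Fin n → Set
    Role s = s ≡ apex d ⊎ s ≡ left d ⊎ s ≡ right d

    roles : ∀ {t : Tri n} {p l r} → Perm3 t p l r →
      let (a , b , c) = t ; Q = λ s → s ≡ p ⊎ s ≡ l ⊎ s ≡ r in Q a × Q b × Q c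
    roles abc = inj₁ refl , inj₂ (inj₁ refl) , inj₂ (inj₂ refl)
    roles acb = inj₁ refl , inj₂ (inj₂ refl) , inj₂ (inj₁ refl)
    roles bac = inj₂ (inj₁ refl) , inj₁ refl , inj₂ (inj₂ refl)
    roles bca = inj₂ (inj₂ refl) , inj₁ refl , inj₂ (inj₁ refl)
    roles cab = inj₂ (inj₁ refl) , inj₂ (inj₂ refl) , inj₁ refl
    roles cba = inj₂ (inj₂ refl) , inj₂ (inj₁ refl) , inj₁ refl
    role-a : Role a
    role-a = proj₁ (roles rep)
    role-b : Role b
    role-b = proj₁ (proj₂ (roles rep))
    role-c : Role c
    role-c = proj₂ (proj₂ (roles rep))

    E′ : List (Fin (suc n) × Fin (suc n))
    E′ = liftE E ++ (inject₁ a , x) ∷ (inject₁ b , x) ∷ (inject₁ c , x) ∷ []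

    layer′ level′ pos′ : Fin (suc n) → ℕ
    layer′ = ext layer (depth d)
    level′ = ext level h
    -- Slot g is divided into four places: 4g for the left face, 4g + 1 for the new vertex, 4g + 2
    -- for the face without the apex, and 4g + 3 for the right face.
    pos′ = ext (λ v → 4 * pos v) (4 * g + 1)

    -- If s is in the layer of x, the edge between them passes over this slot, which must rise above
    -- the level of s. One more than that level stays within one of `h`, the level of x.
    sideHeight : Fin n → ℕ
    sideHeight s with layer s ≟ depth d
    ... | yes _ = suc (level s)
    ... | no _  = h

    sideHeight-in : ∀ {s} → layer s ≡ depth d → sideHeight s ≡ suc (level s)
    sideHeight-in {s} eq with layer s ≟ depth d
    ... | yes _ = refl
    ... | no ≢ = contradiction eq ≢

    sideHeight-bounds : ∀ s → (layer s ≡ depth d → level s ≤ h × h ≤ suc (level s)) →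
      h ≤ sideHeight s × sideHeight s ≤ suc h
    sideHeight-bounds s close with layer s ≟ depth d
    ... | yes eq = proj₂ (close eq) , s≤s (proj₁ (close eq))
    ... | no _ = ≤-refl , n≤1+n h

    left-bounds : h ≤ sideHeight (left d) × sideHeight (left d) ≤ suc h
    left-bounds = sideHeight-bounds (left d) λ eq → let _ , lo , hi , _ = left-side eq in lo , hi
    right-bounds : h ≤ sideHeight (right d) × sideHeight (right d) ≤ suc h
    right-bounds = sideHeight-bounds (right d) λ eq → let _ , lo , hi , _ = right-side eq in lo , hi

    lift : FaceData n → FaceData (suc n)
    lift d = faceData (inject₁ (apex d)) (inject₁ (left d)) (inject₁ (right d)) (depth d) (4 * slot d) (height d)

    leftFace rightFace nestedFace : FaceData (suc n)
    leftFace = faceData (inject₁ (apex d)) (inject₁ (left d)) x (depth d) (4 * g + 0) (sideHeight (left d))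
    rightFace = faceData (inject₁ (apex d)) x (inject₁ (right d)) (depth d) (4 * g + 3) (sideHeight (right d))
    nestedFace = [ (λ _ → nest (left d) (right d)) , (λ _ → nest (right d) (left d)) ]′ sides-near
      where
      nest : Fin n → Fin n → FaceData (suc n)
      -- The height is above `h`, since an edge from x to the right side passes over place 4g + 2.
      -- No side is in the new layer, so both side conditions are vacuous.
      nest s t = faceData (inject₁ s) (inject₁ t) x (suc (depth d)) (4 * g + 2) (suc h)

    nestedFace-elim : (P : FaceData (suc n) → Set) →
      (depth d ≤ 2 + layer (left d) → depth d ≤ 1 + layer (right d) →
        P (faceData (inject₁ (left d)) (inject₁ (right d)) x (suc (depth d)) (4 * g + 2) (suc h))) →
      (depth d ≤ 1 + layer (left d) → depth d ≤ 2 + layer (right d) →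
        P (faceData (inject₁ (right d)) (inject₁ (left d)) x (suc (depth d)) (4 * g + 2) (suc h))) →
      P nestedFace
    nestedFace-elim P p q with sides-near
    ... | inj₁ (l , r) = p l r
    ... | inj₂ (l , r) = q l r

    nested-slot : slot nestedFace ≡ 4 * g + 2
    nested-slot = nestedFace-elim (λ f → slot f ≡ 4 * g + 2) (λ _ _ → refl) (λ _ _ → refl)
    nested-height : height nestedFace ≡ suc h
    nested-height = nestedFace-elim (λ f → height f ≡ suc h) (λ _ _ → refl) (λ _ _ → refl)

    New : FaceData (suc n) → Set
    New f = f ≡ leftFace ⊎ f ≡ rightFace ⊎ f ≡ nestedFace

    Rep : Tri (suc n) → FaceData (suc n) → Set
    Rep t f = Perm3 t (apex f) (left f) (right f)

    rep-nested : ∀ s t → (s ≡ left d × t ≡ right d) ⊎ (s ≡ right d × t ≡ left d) →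
      Rep (inject₁ s , inject₁ t , x) nestedFace
    rep-nested s t st = nestedFace-elim (Rep (inject₁ s , inject₁ t , x))
      (λ _ _ → case st of λ { (inj₁ (refl , refl)) → abc ; (inj₂ (refl , refl)) → bac })
      (λ _ _ → case st of λ { (inj₁ (refl , refl)) → bac ; (inj₂ (refl , refl)) → abc })

    l≢r : slot leftFace ≢ slot rightFace
    l≢r eq = contradiction (+-cancelˡ-≡ (4 * g) 0 3 eq) λ ()
    l≢n : slot leftFace ≢ slot nestedFace
    l≢n eq = contradiction (+-cancelˡ-≡ (4 * g) 0 2 (trans eq nested-slot)) λ ()
    r≢n : slot rightFace ≢ slot nestedFace
    r≢n eq = contradiction (+-cancelˡ-≡ (4 * g) 3 2 (trans eq nested-slot)) λ ()

    arrange : ∀ {t : Tri n} → Perm3 t (apex d) (left d) (right d) → let (a , b , c) = t in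
      ∃[ f₁ ] ∃[ f₂ ] ∃[ f₃ ] Rep (inject₁ a , inject₁ b , x) f₁ × Rep (inject₁ b , inject₁ c , x) f₂ ×
      Rep (inject₁ a , inject₁ c , x) f₃ × New f₁ × New f₂ × New f₃ ×
      slot f₁ ≢ slot f₂ × slot f₁ ≢ slot f₃ × slot f₂ ≢ slot f₃
    arrange abc = leftFace , nestedFace , rightFace , abc , rep-nested _ _ (inj₁ (refl , refl)) , acb ,
      inj₁ refl , inj₂ (inj₂ refl) , inj₂ (inj₁ refl) , l≢n , l≢r , ≢-sym r≢n
    arrange acb = rightFace , nestedFace , leftFace , acb , rep-nested _ _ (inj₂ (refl , refl)) , abc ,
      inj₂ (inj₁ refl) , inj₂ (inj₂ refl) , inj₁ refl , r≢n , ≢-sym l≢r , ≢-sym l≢n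
    arrange bac = leftFace , rightFace , nestedFace , bac , acb , rep-nested _ _ (inj₁ (refl , refl)) ,
      inj₁ refl , inj₂ (inj₁ refl) , inj₂ (inj₂ refl) , l≢r , l≢n , r≢n
    arrange bca = rightFace , leftFace , nestedFace , bca , abc , rep-nested _ _ (inj₂ (refl , refl)) ,
      inj₂ (inj₁ refl) , inj₁ refl , inj₂ (inj₂ refl) , ≢-sym l≢r , r≢n , l≢n
    arrange cab = nestedFace , rightFace , leftFace , rep-nested _ _ (inj₁ (refl , refl)) , bca , bac ,
      inj₂ (inj₂ refl) , inj₂ (inj₁ refl) , inj₁ refl , ≢-sym r≢n , ≢-sym l≢n , ≢-sym l≢r
    arrange cba = nestedFace , leftFace , rightFace , rep-nested _ _ (inj₂ (refl , refl)) , bac , bca ,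
      inj₂ (inj₂ refl) , inj₁ refl , inj₂ (inj₁ refl) , ≢-sym l≢n , ≢-sym r≢n , l≢r

    arranged = arrange rep
    f₁ = proj₁ arranged
    f₂ = proj₁ (proj₂ arranged)
    f₃ = proj₁ (proj₂ (proj₂ arranged))

    D′ : List (FaceData (suc n))
    D′ = map lift (D₁ ++ D₂) ++ f₁ ∷ f₂ ∷ f₃ ∷ []

    news : All New (f₁ ∷ f₂ ∷ f₃ ∷ [])
    news = let _ , _ , _ , _ , _ , _ , N₁ , N₂ , N₃ , _ = arranged in N₁ ∷ N₂ ∷ N₃ ∷ []

    new-slot : ∀ {f} → New f → ∃[ ρ ] ρ < 4 × slot f ≡ 4 * g + ρ × ρ ≢ 1
    new-slot (inj₁ refl) = 0 , s≤s z≤n , refl , λ ()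
    new-slot (inj₂ (inj₁ refl)) = 3 , ≤-refl , refl , λ ()
    new-slot (inj₂ (inj₂ refl)) = 2 , s≤s (s≤s (s≤s z≤n)) , nested-slot , λ ()

    represents′ : Pointwise Rep (liftF (removeAt F i) ++
      (inject₁ a , inject₁ b , x) ∷ (inject₁ b , inject₁ c , x) ∷ (inject₁ a , inject₁ c , x) ∷ []) D′
    represents′ = Pointwise.++⁺ (Pointwise.map⁺ _ _ (Pointwise.map (λ {t} {f} → lift-rep {t} {f}) reps))
      (let _ , _ , _ , R₁ , R₂ , R₃ , _ = arranged in R₁ ∷ R₂ ∷ R₃ ∷ [])
      where
      lift-rep : ∀ {t f} → Perm3 t (apex f) (left f) (right f) → let (a , b , c) = t in
        Perm3 (inject₁ a , inject₁ b , inject₁ c) (inject₁ (apex f)) (inject₁ (left f)) (inject₁ (right f))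
      lift-rep abc = abc
      lift-rep acb = acb
      lift-rep bac = bac
      lift-rep bca = bca
      lift-rep cab = cab
      lift-rep cba = cba

    lifted∈ : ∀ {f} → f ∈ₗ map lift (D₁ ++ D₂) → ∃[ d′ ] d′ ∈ₗ D × slot d′ ≢ g × f ≡ lift d′
    lifted∈ m = let d′ , m′ , eq = ∈-map⁻ lift m in d′ , rest∈ m′ , ≢-sym (All.lookup (proj₁ split) m′) , eq

    distinct-slots′ : AllPairs (λ d d′ → slot d ≢ slot d′) D′
    distinct-slots′ = AllPairs.++⁺
      (AllPairs.map⁺ (AllPairs.map (λ ≢ eq → ≢ (*-cancelˡ-≡ _ _ 4 eq)) (proj₂ split)))
      (let _ , _ , _ , _ , _ , _ , _ , _ , _ , ≢₁₂ , ≢₁₃ , ≢₂₃ = arranged in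
        (≢₁₂ ∷ ≢₁₃ ∷ []) ∷ (≢₂₃ ∷ []) ∷ [] ∷ [])
      (All.tabulate λ {f} f∈ → All.tabulate λ {f′} f′∈ → old≢new {f} {f′} (lifted∈ f∈) (new-slot (All.lookup news f′∈)))
      where
      old≢new : ∀ {f f′} → ∃[ d′ ] d′ ∈ₗ D × slot d′ ≢ g × f ≡ lift d′ → ∃[ ρ ] ρ < 4 × slot f′ ≡ 4 * g + ρ × ρ ≢ 1 →
        slot f ≢ slot f′
      old≢new (d′ , _ , ≢g , refl) (ρ , ρ<4 , eq , _) eq′ = ≢g (4*-cancel ρ<4 (trans eq′ eq))

    data NewItem : ℕ → ℕ → Set where
      at0 : NewItem (4 * g + 0) (sideHeight (left d))
      at1 : NewItem (4 * g + 1) h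
      at2 : NewItem (4 * g + 2) (suc h)
      at3 : NewItem (4 * g + 3) (sideHeight (right d))

    NewItem-pos : ∀ {π η} → NewItem π η → ∃[ ρ ] π ≡ 4 * g + ρ × ρ < 4 × h ≤ η
    NewItem-pos at0 = 0 , refl , z<s , proj₁ left-bounds
    NewItem-pos at1 = 1 , refl , s≤s z<s , ≤-refl
    NewItem-pos at2 = 2 , refl , s≤s (s≤s z<s) , n≤1+n h
    NewItem-pos at3 = 3 , refl , ≤-refl , proj₁ right-bounds

    OldItem : ℕ → ℕ → Set
    OldItem π η = ∃[ π₀ ] π ≡ 4 * π₀ × Item pos level D π₀ η × π₀ ≢ g

    classify : ∀ {π η} → Item pos′ level′ D′ π η → OldItem π η ⊎ NewItem π η
    classify (vertex v) with view v
    ... | ‵fromℕ = inj₂ (subst₂ NewItem (sym (ext-fromℕ (λ v → 4 * pos v) (4 * g + 1))) (sym (ext-fromℕ level h)) at1)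
    ... | ‵inject₁ u = inj₁ (pos u , ext-inject₁ _ _ u ,
      subst (Item pos level D (pos u)) (sym (ext-inject₁ level h u)) (vertex u) , vacant u)
    classify (free {f} f∈) with ∈-++⁻ (map lift (D₁ ++ D₂)) f∈
    ... | inj₁ m with lifted∈ m
    ... | d′ , d′∈ , ≢g , refl = inj₁ (slot d′ , refl , free d′∈ , ≢g)
    classify (free {f} f∈) | inj₂ m with All.lookup news m
    ... | inj₁ refl = inj₂ at0
    ... | inj₂ (inj₁ refl) = inj₂ at3
    ... | inj₂ (inj₂ refl) = inj₂ (subst₂ NewItem (sym nested-slot) (sym nested-height) at2)

    -- Any property of the items between two vertices which holds for the old slot passes to the
    -- items that replace it.
    transfer : ∀ {p q π η} {P : ℕ → Set} → p ≢ g → (∀ {x y} → x ≤ y → P x → P y) →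
      (∀ {π₀ η} → Item pos level D π₀ η → p < π₀ → π₀ < q → P η) →
      Item pos′ level′ D′ π η → 4 * p < π → π < 4 * q → P η
    transfer {p} {q} p≢g up old it lo hi with classify it
    ... | inj₁ (π₀ , refl , it₀ , _) = old it₀ (*-cancelˡ-< 4 p π₀ lo) (*-cancelˡ-< 4 π₀ q hi)
    ... | inj₂ new with NewItem-pos new
    ... | ρ , refl , ρ<4 , h≤η = up h≤η (old (free d∈) (≤∧≢⇒< (4*-≤ (<⇒≤ lo) ρ<4) p≢g) (4*+< hi))

    data Edge′ : Fin (suc n) → Fin (suc n) → Set where
      old : ∀ {u v} → (u , v) ∈ₗ E → Edge′ (inject₁ u) (inject₁ v)
      new : ∀ {s} → Role s → Edge′ (inject₁ s) x

    edge′ : ∀ {u v} → (u , v) ∈ₗ E′ → Edge′ u v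
    edge′ m with ∈-++⁻ (liftE E) m
    ... | inj₂ (here refl) = new role-a
    ... | inj₂ (there (here refl)) = new role-b
    ... | inj₂ (there (there (here refl))) = new role-c
    ... | inj₁ m′ with ∈-map⁻ _ m′
    ... | (u , v) , uv∈ , refl = old uv∈

    old-adj : ∀ {u v} → Adj E u v → Adj E′ (inject₁ u) (inject₁ v)
    old-adj = Sum.map (λ m → ∈-++⁺ˡ (∈-map⁺ _ m)) (λ m → ∈-++⁺ˡ (∈-map⁺ _ m))

    role-edge : ∀ {s} → Role s → Adj E′ (inject₁ s) x
    role-edge {s} r = inj₁ (∈-++⁺ʳ (liftE E) (pick rep r))
      where
      pick : ∀ {t : Tri n} {s p l r} → Perm3 t p l r → s ≡ p ⊎ s ≡ l ⊎ s ≡ r → let (a , b , c) = t in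
        (inject₁ s , x) ∈ₗ (inject₁ a , x) ∷ (inject₁ b , x) ∷ (inject₁ c , x) ∷ []
      pick abc (inj₁ refl) = here refl
      pick abc (inj₂ (inj₁ refl)) = there (here refl)
      pick abc (inj₂ (inj₂ refl)) = there (there (here refl))
      pick acb (inj₁ refl) = here refl
      pick acb (inj₂ (inj₁ refl)) = there (there (here refl))
      pick acb (inj₂ (inj₂ refl)) = there (here refl)
      pick bac (inj₁ refl) = there (here refl)
      pick bac (inj₂ (inj₁ refl)) = here refl
      pick bac (inj₂ (inj₂ refl)) = there (there (here refl))
      pick bca (inj₁ refl) = there (here refl)
      pick bca (inj₂ (inj₁ refl)) = there (there (here refl))
      pick bca (inj₂ (inj₂ refl)) = here refl
      pick cab (inj₁ refl) = there (there (here refl))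
      pick cab (inj₂ (inj₁ refl)) = here refl
      pick cab (inj₂ (inj₂ refl)) = there (here refl)
      pick cba (inj₁ refl) = there (there (here refl))
      pick cba (inj₂ (inj₁ refl)) = there (here refl)
      pick cba (inj₂ (inj₂ refl)) = here refl

    role-clique : ∀ {s t} → Role s → Role t → s ≢ t → Adj E s t
    role-clique (inj₁ refl) (inj₁ refl) ≢ = ⊥-elim (≢ refl)
    role-clique (inj₁ refl) (inj₂ (inj₁ refl)) _ = apex-left
    role-clique (inj₁ refl) (inj₂ (inj₂ refl)) _ = apex-right
    role-clique (inj₂ (inj₁ refl)) (inj₁ refl) _ = Sum.swap apex-left
    role-clique (inj₂ (inj₁ refl)) (inj₂ (inj₁ refl)) ≢ = ⊥-elim (≢ refl)
    role-clique (inj₂ (inj₁ refl)) (inj₂ (inj₂ refl)) _ = left-right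
    role-clique (inj₂ (inj₂ refl)) (inj₁ refl) _ = Sum.swap apex-right
    role-clique (inj₂ (inj₂ refl)) (inj₂ (inj₁ refl)) _ = Sum.swap left-right
    role-clique (inj₂ (inj₂ refl)) (inj₂ (inj₂ refl)) ≢ = ⊥-elim (≢ refl)

    x-is : ∀ {A : Set} (f : Fin n → A) y → ext f y x ≡ y
    x-is = ext-fromℕ
    old-is : ∀ {A : Set} (f : Fin n → A) y s → ext f y (inject₁ s) ≡ f s
    old-is = ext-inject₁

    role-layer : ∀ {s} → Role s → layer s ≤ depth d × depth d ≤ 3 + layer s
    role-layer (inj₁ refl) = <⇒≤ apex-depth , apex-near
    role-layer (inj₂ (inj₁ refl)) = left-depth , ([ (λ (l , _) → m≤n⇒m≤1+n l) , (λ (l , _) → m≤n⇒m≤1+n (m≤n⇒m≤1+n l)) ]′ sides-near)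
    role-layer (inj₂ (inj₂ refl)) = right-depth , ([ (λ (_ , r) → m≤n⇒m≤1+n (m≤n⇒m≤1+n r)) , (λ (_ , r) → m≤n⇒m≤1+n r) ]′ sides-near)

    role-level : ∀ {s} → Role s → layer s ≡ depth d → level s ≤ h × h ≤ suc (level s)
    role-level (inj₁ refl) eq = ⊥-elim (<-irrefl eq apex-depth)
    role-level (inj₂ (inj₁ refl)) eq = let _ , lo , hi , _ = left-side eq in lo , hi
    role-level (inj₂ (inj₂ refl)) eq = let _ , lo , hi , _ = right-side eq in lo , hi

    -- Old items are cleared by the side condition of the filled face. Among the new ones, the side
    -- faces rise above the side by `sideHeight`, and the nested face rises above x.
    role-cover : ∀ {s} → Role s → layer s ≡ depth d → ∀ {π η} → Item pos′ level′ D′ π η →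
      Between (4 * pos s) π (4 * g + 1) → level s < η ⊎ h < η
    role-cover (inj₁ refl) eq it btw = ⊥-elim (<-irrefl eq apex-depth)
    role-cover (inj₂ (inj₁ refl)) eq it btw with left-side eq | classify it | btw
    ... | l<g , _ | _ | inj₂ (lo , hi) = ⊥-elim (<-asym (<-trans lo hi) (4*< 1 l<g))
    ... | l<g , _ , _ , clear | inj₁ (π₀ , refl , it₀ , ≢g) | inj₁ (lo , hi) =
      inj₁ (clear it₀ (*-cancelˡ-< 4 _ π₀ lo) (≤∧≢⇒< (4*-≤ (<⇒≤ hi) (s≤s z<s)) ≢g))
    ... | l<g , _ | inj₂ at0 | inj₁ _ = inj₁ (≤-reflexive (sym (sideHeight-in eq)))
    ... | l<g , _ | inj₂ at1 | inj₁ (lo , hi) = ⊥-elim (<-irrefl refl hi)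
    ... | l<g , _ | inj₂ at2 | inj₁ (lo , hi) = contradiction (+-cancelˡ-< (4 * g) 2 1 hi) (λ { (s≤s ()) })
    ... | l<g , _ | inj₂ at3 | inj₁ (lo , hi) = contradiction (+-cancelˡ-< (4 * g) 3 1 hi) (λ { (s≤s ()) })
    role-cover (inj₂ (inj₂ refl)) eq it btw with right-side eq | classify it | btw
    ... | g<r , _ | _ | inj₁ (lo , hi) = ⊥-elim (<-asym (<-trans lo hi) (<4* 1 (s≤s z<s) g<r))
    ... | g<r , _ , _ , clear | inj₁ (π₀ , refl , it₀ , ≢g) | inj₂ (lo , hi) =
      inj₁ (clear it₀ (4*+< lo) (*-cancelˡ-< 4 π₀ _ hi))
    ... | g<r , _ | inj₂ at0 | inj₂ (lo , hi) = contradiction (+-cancelˡ-< (4 * g) 1 0 lo) (λ ())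
    ... | g<r , _ | inj₂ at1 | inj₂ (lo , hi) = ⊥-elim (<-irrefl refl lo)
    ... | g<r , _ | inj₂ at2 | inj₂ (lo , hi) = inj₂ ≤-refl
    ... | g<r , _ | inj₂ at3 | inj₂ (lo , hi) = inj₁ (≤-reflexive (sym (sideHeight-in eq)))

    vacant-new : ∀ {ρ} → ρ < 4 → ρ ≢ 1 → ∀ v → pos′ v ≢ 4 * g + ρ
    vacant-new {ρ} ρ<4 ρ≢1 v eq with view v
    ... | ‵fromℕ = ρ≢1 (sym (+-cancelˡ-≡ (4 * g) 1 ρ (trans (sym (x-is _ _)) eq)))
    ... | ‵inject₁ u = vacant u (4*-cancel ρ<4 (trans (sym (old-is _ _ u)) eq))

    vacant-old : ∀ {d′} → d′ ∈ₗ D → slot d′ ≢ g → ∀ v → pos′ v ≢ 4 * slot d′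
    vacant-old {d′} d′∈ ≢g v eq with view v
    ... | ‵fromℕ = ≢g (4*-cancel (s≤s z<s) (trans (sym eq) (x-is (λ v → 4 * pos v) (4 * g + 1))))
    ... | ‵inject₁ u = FaceOK.vacant (ok d′∈) u (*-cancelˡ-≡ _ _ 4 (trans (sym (old-is _ _ u)) eq))

    OK′ : FaceData (suc n) → Set
    OK′ = FaceOK E′ layer′ level′ pos′ D′

    lift-ok : ∀ {d′} → d′ ∈ₗ D → slot d′ ≢ g → OK′ (lift d′)
    lift-ok {d′} d′∈ ≢g = record
      { apex-left = old-adj O.apex-left
      ; apex-right = old-adj O.apex-right
      ; left-right = old-adj O.left-right
      ; apex-depth = subst (_< _) (sym (old-is _ _ _)) O.apex-depth
      ; left-depth = subst (_≤ _) (sym (old-is _ _ _)) O.left-depth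
      ; right-depth = subst (_≤ _) (sym (old-is _ _ _)) O.right-depth
      ; apex-near = subst (λ y → _ ≤ 3 + y) (sym (old-is _ _ _)) O.apex-near
      ; sides-near = subst₂ (λ y z → (depth d′ ≤ 2 + y × depth d′ ≤ 1 + z) ⊎ (depth d′ ≤ 1 + y × depth d′ ≤ 2 + z))
          (sym (old-is _ _ _)) (sym (old-is _ _ _)) O.sides-near
      ; vacant = vacant-old d′∈ ≢g
      ; left-side = leftˢ
      ; right-side = rightˢ
      }
      where
      module O = FaceOK (ok d′∈)
      leftˢ : LeftSide E′ layer′ level′ pos′ D′ (lift d′)
      leftˢ eq rewrite old-is layer (depth d) (left d′) | old-is level h (left d′)
        | old-is (λ v → 4 * pos v) (4 * g + 1) (left d′) with O.left-side eq
      ... | lt , lo , hi , clear = *-monoʳ-< 4 lt , lo , hi ,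
        transfer {P = λ η → level (left d′) < η} (vacant (left d′)) (λ le lt → ≤-trans lt le) clear
      rightˢ : RightSide E′ layer′ level′ pos′ D′ (lift d′)
      rightˢ eq rewrite old-is layer (depth d) (right d′) | old-is level h (right d′)
        | old-is (λ v → 4 * pos v) (4 * g + 1) (right d′) with O.right-side eq
      ... | lt , lo , hi , clear = *-monoʳ-< 4 lt , lo , hi ,
        transfer {P = λ η → level (right d′) < η} ≢g (λ le lt → ≤-trans lt le) clear

    left-ok : OK′ leftFace
    left-ok = record
      { apex-left = old-adj apex-left
      ; apex-right = role-edge (inj₁ refl)
      ; left-right = role-edge (inj₂ (inj₁ refl))
      ; apex-depth = subst (_< _) (sym (old-is _ _ _)) apex-depth
      ; left-depth = subst (_≤ _) (sym (old-is _ _ _)) left-depth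
      ; right-depth = ≤-reflexive (x-is _ _)
      ; apex-near = subst (λ y → _ ≤ 3 + y) (sym (old-is _ _ _)) apex-near
      ; sides-near = inj₁ (subst (λ y → _ ≤ 2 + y) (sym (old-is _ _ _)) ([ proj₁ , (λ (l , _) → m≤n⇒m≤1+n l) ]′ sides-near)
                         , subst (λ y → depth d ≤ 1 + y) (sym (x-is layer (depth d))) (n≤1+n _))
      ; vacant = vacant-new z<s (λ ())
      ; left-side = leftˢ
      ; right-side = rightˢ
      }
      where
      leftˢ : LeftSide E′ layer′ level′ pos′ D′ leftFace
      leftˢ eq rewrite old-is layer (depth d) (left d) | old-is level h (left d)
        | old-is (λ v → 4 * pos v) (4 * g + 1) (left d) | +-identityʳ (4 * g) with left-side eq
      ... | lt , lo , hi , clear = *-monoʳ-< 4 lt ,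
        subst (level (left d) ≤_) (sym (sideHeight-in eq)) (n≤1+n _) , ≤-reflexive (sideHeight-in eq) ,
        transfer {P = λ η → level (left d) < η} (vacant (left d)) (λ le lt → ≤-trans lt le) clear
      rightˢ : RightSide E′ layer′ level′ pos′ D′ leftFace
      rightˢ _ rewrite x-is level h | x-is (λ v → 4 * pos v) (4 * g + 1) =
        +-monoʳ-< (4 * g) z<s , proj₁ left-bounds , proj₂ left-bounds ,
        λ _ lo hi → contradiction hi (≤⇒≯ (≤-trans (≤-reflexive (+-suc (4 * g) 0)) lo))

    right-ok : OK′ rightFace
    right-ok = record
      { apex-left = role-edge (inj₁ refl)
      ; apex-right = old-adj apex-right
      ; left-right = Sum.swap (role-edge (inj₂ (inj₂ refl)))
      ; apex-depth = subst (_< _) (sym (old-is _ _ _)) apex-depth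
      ; left-depth = ≤-reflexive (x-is _ _)
      ; right-depth = subst (_≤ _) (sym (old-is _ _ _)) right-depth
      ; apex-near = subst (λ y → _ ≤ 3 + y) (sym (old-is _ _ _)) apex-near
      ; sides-near = inj₂ (subst (λ y → depth d ≤ 1 + y) (sym (x-is layer (depth d))) (n≤1+n _)
                         , subst (λ y → _ ≤ 2 + y) (sym (old-is _ _ _)) ([ (λ (_ , r) → m≤n⇒m≤1+n r) , proj₂ ]′ sides-near))
      ; vacant = vacant-new ≤-refl (λ ())
      ; left-side = leftˢ
      ; right-side = rightˢ
      }
      where
      leftˢ : LeftSide E′ layer′ level′ pos′ D′ rightFace
      leftˢ _ rewrite x-is level h | x-is (λ v → 4 * pos v) (4 * g + 1) =
        +-monoʳ-< (4 * g) (s≤s z<s) , proj₁ right-bounds , proj₂ right-bounds , clear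
        where
        clear : ∀ {π η} → Item pos′ level′ D′ π η → 4 * g + 1 < π → π < 4 * g + 3 → h < η
        clear it lo hi with classify it
        ... | inj₁ (π₀ , refl , _ , _) = contradiction (4*-≤ {π₀} {g} {3} (<⇒≤ hi) ≤-refl) (<⇒≱ (4*+< {π₀} {g} {1} lo))
        ... | inj₂ at0 = contradiction (+-cancelˡ-< (4 * g) 1 0 lo) (λ ())
        ... | inj₂ at1 = ⊥-elim (<-irrefl refl lo)
        ... | inj₂ at2 = ≤-refl
        ... | inj₂ at3 = ⊥-elim (<-irrefl refl hi)
      rightˢ : RightSide E′ layer′ level′ pos′ D′ rightFace
      rightˢ eq rewrite old-is layer (depth d) (right d) | old-is level h (right d)
        | old-is (λ v → 4 * pos v) (4 * g + 1) (right d) with right-side eq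
      ... | lt , lo , hi , clear = <4* 3 ≤-refl lt ,
        subst (level (right d) ≤_) (sym (sideHeight-in eq)) (n≤1+n _) , ≤-reflexive (sideHeight-in eq) ,
        λ it lo hi → clear′ (classify it) lo hi
        where
        clear′ : ∀ {π η} → OldItem π η ⊎ NewItem π η → 4 * g + 3 < π → π < 4 * pos (right d) → level (right d) < η
        clear′ (inj₁ (π₀ , refl , it₀ , _)) lo hi = clear it₀ (4*+< lo) (*-cancelˡ-< 4 π₀ _ hi)
        clear′ (inj₂ at0) lo hi = contradiction (+-cancelˡ-< (4 * g) 3 0 lo) (λ ())
        clear′ (inj₂ at1) lo hi = contradiction (+-cancelˡ-< (4 * g) 3 1 lo) (λ { (s≤s ()) })
        clear′ (inj₂ at2) lo hi = contradiction (+-cancelˡ-< (4 * g) 3 2 lo) (λ { (s≤s (s≤s ())) })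
        clear′ (inj₂ at3) lo hi = ⊥-elim (<-irrefl refl lo)

    nest-ok : ∀ {s t} → Role s → Role t → Adj E s t → depth d ≤ 2 + layer s → depth d ≤ 1 + layer t →
      OK′ (faceData (inject₁ s) (inject₁ t) x (suc (depth d)) (4 * g + 2) (suc h))
    nest-ok {s} {t} rs rt st s≤ t≤ = record
      { apex-left = old-adj st
      ; apex-right = role-edge rs
      ; left-right = role-edge rt
      ; apex-depth = s≤s (subst (_≤ _) (sym (old-is _ _ _)) (proj₁ (role-layer rs)))
      ; left-depth = m≤n⇒m≤1+n (subst (_≤ _) (sym (old-is _ _ _)) (proj₁ (role-layer rt)))
      ; right-depth = m≤n⇒m≤1+n (≤-reflexive (x-is _ _))
      ; apex-near = s≤s (subst (λ y → _ ≤ 2 + y) (sym (old-is _ _ _)) s≤)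
      ; sides-near = inj₁ (s≤s (subst (λ y → _ ≤ 1 + y) (sym (old-is _ _ _)) t≤) , s≤s (≤-reflexive (sym (x-is _ _))))
      ; vacant = vacant-new (s≤s (s≤s z<s)) (λ ())
      ; left-side = λ eq → contradiction (≤-trans (≤-reflexive (sym eq)) (subst (_≤ _) (sym (old-is _ _ _)) (proj₁ (role-layer rt)))) 1+n≰n
      ; right-side = λ eq → contradiction (≤-trans (≤-reflexive (sym eq)) (≤-reflexive (x-is _ _))) 1+n≰n
      }

    new-ok : ∀ {f} → New f → OK′ f
    new-ok (inj₁ refl) = left-ok
    new-ok (inj₂ (inj₁ refl)) = right-ok
    new-ok (inj₂ (inj₂ refl)) = nestedFace-elim OK′
      (λ l r → nest-ok (inj₂ (inj₁ refl)) (inj₂ (inj₂ refl)) left-right l r)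
      (λ l r → nest-ok (inj₂ (inj₂ refl)) (inj₂ (inj₁ refl)) (Sum.swap left-right) r l)

    facesOK′ : All OK′ D′
    facesOK′ = All.++⁺
      (All.tabulate λ f∈ → let d′ , d′∈ , ≢g , eq = lifted∈ f∈ in subst OK′ (sym eq) (lift-ok d′∈ ≢g))
      (All.map new-ok news)

    pos-injective′ : ∀ {u v} → pos′ u ≡ pos′ v → u ≡ v
    pos-injective′ {u} {v} eq with view u | view v
    ... | ‵fromℕ | ‵fromℕ = refl
    ... | ‵inject₁ u | ‵inject₁ v = cong inject₁ (pos-injective (*-cancelˡ-≡ _ _ 4
      (trans (sym (old-is _ _ u)) (trans eq (old-is _ _ v)))))
    ... | ‵inject₁ u | ‵fromℕ = ⊥-elim (vacant u (4*-cancel (s≤s z<s) (trans (sym (old-is _ _ u)) (trans eq (x-is _ _)))))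
    ... | ‵fromℕ | ‵inject₁ u = ⊥-elim (vacant u (4*-cancel (s≤s z<s) (trans (sym (old-is _ _ u)) (trans (sym eq) (x-is _ _)))))

    cliqueᵉ : ∀ {u v w} → Edge′ u w → Edge′ v w → u ≢ v → Adj E′ u v
    cliqueᵉ e e′ = go e e′ refl
      where
      go : ∀ {u v w w′} → Edge′ u w → Edge′ v w′ → w ≡ w′ → u ≢ v → Adj E′ u v
      go (old uw) (old vw) eq ≢ with Fin.inject₁-injective eq
      ... | refl = old-adj (edge-clique uw vw (≢ ∘ cong inject₁))
      go (old _) (new _) eq _ = ⊥-elim (Fin.fromℕ≢inject₁ (sym eq))
      go (new _) (old _) eq _ = ⊥-elim (Fin.fromℕ≢inject₁ eq)
      go (new rs) (new rt) _ ≢ = old-adj (role-clique rs rt (≢ ∘ cong inject₁))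

    edge-<′ : ∀ {u v} → Edge′ u v → toℕ u < toℕ v
    edge-<′ (old {u} {v} uv) rewrite Fin.toℕ-inject₁ u | Fin.toℕ-inject₁ v = edge-< uv
    edge-<′ (new {s} _) rewrite Fin.toℕ-inject₁ s | Fin.toℕ-fromℕ n = Fin.toℕ<n s

    edge-layer′ : ∀ {u v} → Edge′ u v → layer′ u ≤ layer′ v × layer′ v ≤ 3 + layer′ u
    edge-layer′ (old {u} {v} uv) rewrite old-is layer (depth d) u | old-is layer (depth d) v =
      edge-monotone uv , edge-stretch uv
    edge-layer′ (new {s} rs) rewrite old-is layer (depth d) s | x-is layer (depth d) = role-layer rs

    edge-level′ : ∀ {u v} → Edge′ u v → layer′ u ≡ layer′ v → level′ u ≤ suc (level′ v) × level′ v ≤ suc (level′ u)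
    edge-level′ (old {u} {v} uv) eq rewrite old-is layer (depth d) u | old-is layer (depth d) v
      | old-is level h u | old-is level h v = edge-level uv eq
    edge-level′ (new {s} rs) eq rewrite old-is layer (depth d) s | x-is layer (depth d)
      | old-is level h s | x-is level h = m≤n⇒m≤1+n (proj₁ (role-level rs eq)) , proj₂ (role-level rs eq)

    edge-cover′ : ∀ {u v} → Edge′ u v → layer′ u ≡ layer′ v → ∀ {π η} → Item pos′ level′ D′ π η →
      Between (pos′ u) π (pos′ v) → level′ u < η ⊎ level′ v < η
    edge-cover′ (old {u} {v} uv) eq it btw rewrite old-is layer (depth d) u | old-is layer (depth d) v
      | old-is level h u | old-is level h v | old-is (λ v → 4 * pos v) (4 * g + 1) u | old-is (λ v → 4 * pos v) (4 * g + 1) v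
      with btw
    ... | inj₁ (lo , hi) = transfer {P = λ η → level u < η ⊎ level v < η} (vacant u)
      (λ le → Sum.map (λ lt → ≤-trans lt le) (λ lt → ≤-trans lt le))
      (λ it lo hi → edge-cover uv eq it (inj₁ (lo , hi))) it lo hi
    ... | inj₂ (lo , hi) = transfer {P = λ η → level u < η ⊎ level v < η} (vacant v)
      (λ le → Sum.map (λ lt → ≤-trans lt le) (λ lt → ≤-trans lt le))
      (λ it lo hi → edge-cover uv eq it (inj₂ (lo , hi))) it lo hi
    edge-cover′ (new {s} rs) eq it btw rewrite old-is layer (depth d) s | x-is layer (depth d)
      | old-is level h s | x-is level h | old-is (λ v → 4 * pos v) (4 * g + 1) s | x-is (λ v → 4 * pos v) (4 * g + 1) =
      role-cover rs eq it btw

  inserted : Layout (suc n) E′ (liftF (removeAt F i) ++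
    (inject₁ a , inject₁ b , x) ∷ (inject₁ b , inject₁ c , x) ∷ (inject₁ a , inject₁ c , x) ∷ [])
  inserted = record
    { layer = layer′ ; level = level′ ; pos = pos′ ; D = D′
    ; represents = represents′
    ; facesOK = facesOK′
    ; distinct-slots = distinct-slots′
    ; pos-injective = pos-injective′
    ; edge-< = edge-<′ ∘ edge′
    ; edge-monotone = proj₁ ∘ edge-layer′ ∘ edge′
    ; edge-stretch = proj₂ ∘ edge-layer′ ∘ edge′
    ; edge-clique = λ uw vw → cliqueᵉ (edge′ uw) (edge′ vw)
    ; edge-level = edge-level′ ∘ edge′
    ; edge-cover = edge-cover′ ∘ edge′
    }

-- All corners are in layer 0 and both faces wait for layer 1, so the roles of the corners are
-- arbitrary. Levels 0, 1, 1 are needed because the edge from 0 to 2 passes over position 1.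
triangle : Layout 3 ((v0 , v1) ∷ (v1 , v2) ∷ (v0 , v2) ∷ []) ((v0 , v1 , v2) ∷ (v0 , v1 , v2) ∷ [])
triangle = record
  { layer = λ _ → 0 ; level = level ; pos = toℕ ; D = D
  ; represents = abc ∷ abc ∷ []
  ; facesOK = face-ok 0 ∷ face-ok 1 ∷ []
  ; distinct-slots = ((λ ()) ∷ []) ∷ [] ∷ []
  ; pos-injective = Fin.toℕ-injective
  ; edge-< = λ { (here refl) → s≤s z≤n ; (there (here refl)) → s≤s (s≤s z≤n) ; (there (there (here refl))) → s≤s z≤n }
  ; edge-monotone = λ _ → z≤n
  ; edge-stretch = λ _ → z≤n
  ; edge-clique = λ
      { (here refl) (here refl) ≢ → ⊥-elim (≢ refl)
      ; (there (here refl)) (there (here refl)) ≢ → ⊥-elim (≢ refl)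
      ; (there (there (here refl))) (there (there (here refl))) ≢ → ⊥-elim (≢ refl)
      ; (there (here refl)) (there (there (here refl))) _ → inj₂ (here refl)
      ; (there (there (here refl))) (there (here refl)) _ → inj₁ (here refl)
      ; (here refl) (there (there (here ()))) ; (here refl) (there (there (there ()))) }
  ; edge-level = λ
      { (here refl) _ → z≤n , s≤s z≤n
      ; (there (here refl)) _ → s≤s z≤n , s≤s z≤n
      ; (there (there (here refl))) _ → z≤n , s≤s z≤n }
  ; edge-cover = λ
      { (here refl) _ _ btw → ⊥-elim (between01 btw)
      ; (there (here refl)) _ _ btw → ⊥-elim (between12 btw)
      ; (there (there (here refl))) _ it btw → inj₁ (middle it (between02 btw)) }
  }
  where
  level : Fin 3 → ℕ
  level 0F = 0
  level 1F = 1
  level 2F = 1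
  D : List (FaceData 3)
  D = faceData v0 v1 v2 1 3 0 ∷ faceData v0 v1 v2 1 4 0 ∷ []
  face-ok : ∀ t → FaceOK ((v0 , v1) ∷ (v1 , v2) ∷ (v0 , v2) ∷ []) (λ _ → 0) level toℕ D (faceData v0 v1 v2 1 (3 + t) 0)
  face-ok t = record
    { apex-left = inj₁ (here refl)
    ; apex-right = inj₁ (there (there (here refl)))
    ; left-right = inj₁ (there (here refl))
    ; apex-depth = z<s ; left-depth = z≤n ; right-depth = z≤n
    ; apex-near = s≤s z≤n ; sides-near = inj₁ (s≤s z≤n , s≤s z≤n)
    ; vacant = λ v eq → contradiction (≤-trans (m≤m+n 3 t) (≤-reflexive (sym eq))) (<⇒≱ (Fin.toℕ<n v))
    ; left-side = λ () ; right-side = λ ()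
    }
  between01 : ∀ {π} → Between 0 π 1 → ⊥
  between01 (inj₁ (s≤s z≤n , s≤s ()))
  between12 : ∀ {π} → Between 1 π 2 → ⊥
  between12 (inj₁ (s≤s (s≤s z≤n) , s≤s (s≤s ())))
  between12 (inj₂ (s≤s _ , s≤s ()))
  between02 : ∀ {π} → Between 0 π 2 → π ≡ 1
  between02 (inj₁ (s≤s z≤n , s≤s (s≤s z≤n))) = refl
  middle : ∀ {π η} → Item toℕ level D π η → π ≡ 1 → 0 < η
  middle (vertex 1F) _ = s≤s z≤n
  middle (vertex 2F) _ = s≤s z≤n
  middle (free (here refl)) ()
  middle (free (there (here refl))) ()

layout : ∀ {n E F} → Stacked n E F → Layout n E F
layout base      = triangle
layout (add s i) = Insert.inserted (layout s) i

-- Colourings of stacked triangulations and their subgraphs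

PC-pullback : ∀ {n m k p} {R : Fin m → Fin m → Set} {R′ : Fin n → Fin n → Set} (f : Fin n → Fin m) →
  Injective _≡_ _≡_ f → (∀ {u v} → R′ u v → R (f u) (f v)) →
  Σ (Fin m → Fin k) (PC p R) → Σ (Fin n → Fin k) (PC p R′)
PC-pullback {n} {m} {k} {p} {R} {R′} f f-inj hom (φ , pc) = φ ∘ f , pc′
  where
  pc′ : PC p R′ (φ ∘ f)
  pc′ S ((v₀ , v₀∈) , conn) = Sum.map more unique (pc image ((f v₀ , ∈-subset⁺ Im? (v₀ , v₀∈ , refl)) , conn′))
    where
    Im? : Decidable (λ v → ∃[ u ] u ∈ S × f u ≡ v)
    Im? v = Fin.any? (λ u → u ∈? S ×-dec f u Fin.≟ v)
    image : Subset m
    image = subset Im?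
    conn′ : ∀ u v → u ∈ image → v ∈ image → Reach R image u v
    conn′ u v u∈ v∈ with ∈-subset⁻ Im? u∈ | ∈-subset⁻ Im? v∈
    ... | u′ , u′∈ , refl | v′ , v′∈ , refl = walk⇒reach (walk-map f (λ _ _ → hom)
      (λ {w} w∈ → ∈-subset⁺ Im? (w , w∈ , refl)) (reach⇒walk (conn u′ v′ u′∈ v′∈)))
    more : MoreThanColours p φ image → MoreThanColours p (φ ∘ f) S
    more (z , z∈ , inj) = (λ t → proj₁ (pre t)) , (λ t → proj₁ (proj₂ (pre t))) ,
      λ {s} {t} eq → inj (trans (cong φ (sym (proj₂ (proj₂ (pre s))))) (trans eq (cong φ (proj₂ (proj₂ (pre t))))))
      where
      pre : ∀ t → ∃[ u ] u ∈ S × f u ≡ z t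
      pre t = ∈-subset⁻ Im? (z∈ t)
    unique : HasUniqueColour φ image → HasUniqueColour (φ ∘ f) S
    unique (v , v∈ , uniq) with ∈-subset⁻ Im? v∈
    ... | u , u∈ , refl = u , u∈ , λ w w∈ eq → f-inj (uniq (f w) (∈-subset⁺ Im? (w , w∈ , refl)) eq)

-- All layers are coloured together, as one layered order for adjacency within a layer; the residues
-- of the layers then take care of the edges between layers.
stacked-centred : ∀ {n E F} → Stacked n E F → ∀ p m → p ≤ 2 ^ m →
  Σ (Fin n → Fin (3 * suc p * colourCount p m)) (PC p (Adj E))
stacked-centred {n} {E} st p m p≤ = By-layer.layered-centred
  (LayeredOrder.layered-order-centred By-layer.SameLayer (λ (r , eq) → Sum.swap r , sym eq) pos level pos-injective
    lipschitz covered p m p≤)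
  where
  open Layout (layout st)
  later : ∀ {u v} → Adj E u v → toℕ u < toℕ v → (u , v) ∈ₗ E
  later (inj₁ uv) _ = uv
  later (inj₂ vu) lt = ⊥-elim (<-asym lt (edge-< vu))
  module By-layer = Layering (Adj E) Sum.swap ([ <-irrefl refl ∘ edge-< , <-irrefl refl ∘ edge-< ]′) layer
    (λ uw vw u<w v<w → edge-clique (later uw u<w) (later vw v<w))
    (λ uw u<w → edge-monotone (later uw u<w))
    (λ uw u<w → edge-stretch (later uw u<w)) p
  lipschitz : ∀ {u v} → By-layer.SameLayer u v → level u ≤ suc (level v)
  lipschitz (inj₁ uv , eq) = proj₁ (edge-level uv eq)
  lipschitz (inj₂ vu , eq) = proj₂ (edge-level vu (sym eq))
  covered : ∀ {u v w} → By-layer.SameLayer u v → pos u < pos w → pos w < pos v → level u < level w ⊎ level v < level w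
  covered {w = w} (inj₁ uv , eq) lo hi = edge-cover uv eq (vertex w) (inj₁ (lo , hi))
  covered {w = w} (inj₂ vu , eq) lo hi = Sum.swap (edge-cover vu (sym eq) (vertex w) (inj₂ (lo , hi)))

planarTw≤3-χ≤ : ∀ p → 2 ≤ p → ∀ n (G : Graph n) → PlanarTw≤3 G → χ≤ p G (48 * (p * p) * ⌊log₂ p ⌋)
planarTw≤3-χ≤ p 2≤p n G (m , E , F , st , f , f-inj , edges) = PC-mono bound
  (PC-pullback f f-inj (λ {u} {v} → edges u v) (stacked-centred st p (suc ⌊log₂ p ⌋) (n≤2^suc-log p)))
  where
  open ≤-Reasoning
  -- The constant 48 is 3 for the stretch, 2 for `suc p ≤ p + p`, and 8 from `colourCount≤`.
  collect : ∀ p L → 3 * (p + p) * (8 * p * L) ≡ 48 * (p * p) * L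
  collect = solve-∀
  1≤p : 1 ≤ p
  1≤p = <⇒≤ 2≤p
  bound : 3 * suc p * colourCount p (suc ⌊log₂ p ⌋) ≤ 48 * (p * p) * ⌊log₂ p ⌋
  bound = begin
    3 * suc p * colourCount p (suc ⌊log₂ p ⌋)
      ≤⟨ *-mono-≤ (*-monoʳ-≤ 3 (+-monoˡ-≤ p 1≤p)) (colourCount≤ p ⌊log₂ p ⌋ 1≤p (1≤log 2≤p)) ⟩
    3 * (p + p) * (8 * p * ⌊log₂ p ⌋)
      ≡⟨ collect p ⌊log₂ p ⌋ ⟩
    48 * (p * p) * ⌊log₂ p ⌋ ∎

-- Hansel's lemma and the strength of paths

Conn : ∀ {V : Set} → (V → V → Set) → List V → Set
Conn R I = ∀ {u v} → u ∈ₗ I → v ∈ₗ I → Walk R (_∈ₗ I) u v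

-- A p-centered colouring satisfies this with M constantly true.  Smaller sets M f record which
-- colours remain usable once a structure attached at f repeats all the others.
Star : ∀ {V : Set} → (V → V → Set) → ∀ {k} → ℕ → (V → Fin k) → (V → Fin k → Bool) → Set
Star R p φ M = ∀ I cs → Conn R I → (∀ {v} → v ∈ₗ I → φ v ∈ₗ cs) → length cs ≤ p →
  ∀ {f f′} → f ∈ₗ I → f′ ∈ₗ I →
  ∃[ v ] v ∈ₗ I × (∀ w → w ∈ₗ I → φ w ≡ φ v → w ≡ v) × M f (φ v) ≡ true × M f′ (φ v) ≡ true

-- Some vertex has L usable colours that occur in the colouring. `p` limits the colours of the sets
-- considered; `k < B` ensures that one vertex chosen from each of B copies yields two of equal
-- colour.
Strength : (V : Set) → (V → V → Set) → ℕ → ℕ → ℕ → Set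
Strength V R B p L = ∀ {k} → k < B → (φ : V → Fin k) (M : V → Fin k → Bool) → Star R p φ M →
  ∃[ f ] ∃[ cs ] Unique cs × L ≤ length cs × (∀ {c} → c ∈ₗ cs → M f c ≡ true × ∃[ v ] φ v ≡ c)

module Hansel {A : Set} where

  open import Data.Maybe using (Maybe; just; nothing)

  -- A complete bipartite graph, with sides `just true` and `just false`; `nothing` marks the
  -- elements outside it. `degree` counts the graphs that contain an element.
  Test : Set
  Test = A → Maybe Bool

  bump : Maybe Bool → ℕ → ℕ
  bump nothing  n = n
  bump (just _) n = suc n

  degree : List Test → A → ℕ
  degree []       f = 0
  degree (t ∷ ts) f = bump (t f) (degree ts f)

  Separated : List Test → A → A → Set
  Separated ts f f′ = Any (λ t → ∃[ b ] t f ≡ just b × t f′ ≡ just (not b)) ts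

  reweight : Bool → Maybe Bool → ℕ → ℕ
  reweight b     nothing      w = w
  reweight true  (just true)  w = 2 * w
  reweight true  (just false) w = 0
  reweight false (just true)  w = 0
  reweight false (just false) w = 2 * w

  reweight-total : ∀ s w → reweight true s w + reweight false s w ≡ 2 * w
  reweight-total nothing      w = cong (w +_) (sym (+-identityʳ w))
  reweight-total (just true)  w = +-identityʳ _
  reweight-total (just false) w = refl

  reweight-0 : ∀ b s → reweight b s 0 ≡ 0
  reweight-0 b nothing = refl
  reweight-0 true (just true) = refl
  reweight-0 true (just false) = refl
  reweight-0 false (just true) = refl
  reweight-0 false (just false) = refl

  reweight-separated : ∀ b c w w′ → reweight b (just c) w ≡ 0 ⊎ reweight b (just (not c)) w′ ≡ 0
  reweight-separated true  true  _ _ = inj₂ refl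
  reweight-separated true  false _ _ = inj₁ refl
  reweight-separated false true  _ _ = inj₁ refl
  reweight-separated false false _ _ = inj₂ refl

  reweight-bump : ∀ b s w n → reweight b s w * 2 ^ n ≤ w * 2 ^ bump s n
  reweight-bump b nothing w n = ≤-refl
  reweight-bump true  (just true)  w n = ≤-reflexive (doubling w (2 ^ n))
    where
    doubling : ∀ w x → 2 * w * x ≡ w * (2 * x)
    doubling = solve-∀
  reweight-bump true  (just false) w n = z≤n
  reweight-bump false (just true)  w n = z≤n
  reweight-bump false (just false) w n = reweight-bump true (just true) w n

  sum-reweight : ∀ (t : Test) (w : A → ℕ) F →
    sum (map (λ f → reweight true (t f) (w f)) F) + sum (map (λ f → reweight false (t f) (w f)) F) ≡ 2 * sum (map w F)
  sum-reweight t w [] = refl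
  sum-reweight t w (f ∷ F) = trans (regroup (reweight true (t f) (w f)) _ (reweight false (t f) (w f)) _)
    (trans (cong₂ _+_ (reweight-total (t f) (w f)) (sum-reweight t w F)) (sym (*-distribˡ-+ 2 (w f) _)))
    where
    regroup : ∀ a b c d → (a + b) + (c + d) ≡ (a + c) + (b + d)
    regroup = solve-∀

  sum-zero : ∀ (w : A → ℕ) {F} → All (λ f → w f ≡ 0) F → sum (map w F) ≡ 0
  sum-zero w []        = refl
  sum-zero w (eq ∷ zs) = cong₂ _+_ eq (sum-zero w zs)

  -- Each test keeps the heavier of its two sides and doubles the weights there, so the total
  -- weight never decreases; in the end a single element carries all of it.
  hansel : ∀ ts (w : A → ℕ) x F → AllPairs (λ f f′ → w f ≡ 0 ⊎ w f′ ≡ 0 ⊎ Separated ts f f′) (x ∷ F) →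
    ∃[ f ] f ∈ₗ x ∷ F × sum (map w (x ∷ F)) ≤ w f * 2 ^ degree ts f
  hansel [] w x [] _ = x , here refl , ≤-reflexive (trans (+-identityʳ (w x)) (sym (*-identityʳ (w x))))
  -- Without tests nothing is separated, so at most one weight is positive.
  hansel [] w x (y ∷ F) (px ∷ ps) with w x ≟ 0
  ... | yes w≡0 with hansel [] w y F ps
  ... | f , f∈ , le = f , there f∈ , ≤-trans (≤-reflexive (cong (_+ sum (map w (y ∷ F))) w≡0)) le
  hansel [] w x (y ∷ F) (px ∷ ps) | no w≢0 = x , here refl , ≤-reflexive
    (trans (cong (w x +_) (sum-zero w (All.map rest px))) (trans (+-identityʳ (w x)) (sym (*-identityʳ (w x)))))
    where
    rest : ∀ {f} → w x ≡ 0 ⊎ w f ≡ 0 ⊎ Separated [] x f → w f ≡ 0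
    rest (inj₁ eq) = contradiction eq w≢0
    rest (inj₂ (inj₁ eq)) = eq
    rest (inj₂ (inj₂ ()))
  hansel (t ∷ ts) w x F pairs =
    [ keep true , keep false ]′ (heavier (sum (map (λ f → reweight true (t f) (w f)) (x ∷ F))) _ _ (sum-reweight t w (x ∷ F)))
    where
    heavier : ∀ a b s → a + b ≡ 2 * s → s ≤ a ⊎ s ≤ b
    heavier a b s eq with ≤-<-connex s a | ≤-<-connex s b
    ... | inj₁ le | _ = inj₁ le
    ... | _ | inj₁ le = inj₂ le
    ... | inj₂ a<s | inj₂ b<s = ⊥-elim (<-irrefl (trans eq (cong (s +_) (+-identityʳ s))) (+-mono-< a<s b<s))
    keep : ∀ b → sum (map w (x ∷ F)) ≤ sum (map (λ f → reweight b (t f) (w f)) (x ∷ F)) →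
      ∃[ f ] f ∈ₗ x ∷ F × sum (map w (x ∷ F)) ≤ w f * 2 ^ degree (t ∷ ts) f
    keep b heavy with hansel ts (λ f → reweight b (t f) (w f)) x F (AllPairs.map survive pairs)
      where
      survive : ∀ {f f′} → w f ≡ 0 ⊎ w f′ ≡ 0 ⊎ Separated (t ∷ ts) f f′ →
        reweight b (t f) (w f) ≡ 0 ⊎ reweight b (t f′) (w f′) ≡ 0 ⊎ Separated ts f f′
      survive {f} (inj₁ eq) = inj₁ (trans (cong (reweight b (t f)) eq) (reweight-0 b (t f)))
      survive {f′ = f′} (inj₂ (inj₁ eq)) = inj₂ (inj₁ (trans (cong (reweight b (t f′)) eq) (reweight-0 b (t f′))))
      survive {f} {f′} (inj₂ (inj₂ (here (c , eq , eq′)))) rewrite eq | eq′ =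
        [ inj₁ , inj₂ ∘ inj₁ ]′ (reweight-separated b c (w f) (w f′))
      survive (inj₂ (inj₂ (there sep))) = inj₂ (inj₂ sep)
    ... | f , f∈ , le = f , f∈ , ≤-trans heavy (≤-trans le (reweight-bump b (t f) (w f) (degree ts f)))

PathR : ∀ {q} → Fin q → Fin q → Set
PathR i j = toℕ j ≡ suc (toℕ i) ⊎ toℕ i ≡ suc (toℕ j)

PathR-sym : ∀ {q} {i j : Fin q} → PathR i j → PathR j i
PathR-sym = Sum.swap

module _ {q : ℕ} (lo hi : Fin q) where

  Segment? : Decidable (λ (v : Fin q) → toℕ lo ≤ toℕ v × toℕ v ≤ toℕ hi)
  Segment? v = toℕ lo ≤? toℕ v ×-dec toℕ v ≤? toℕ hi

  segment : List (Fin q)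
  segment = filter Segment? (allFin q)

  ∈-segment⁺ : ∀ {v} → toℕ lo ≤ toℕ v → toℕ v ≤ toℕ hi → v ∈ₗ segment
  ∈-segment⁺ {v} l h = ∈-filter⁺ Segment? (∈-allFin v) (l , h)

  ∈-segment⁻ : ∀ {v} → v ∈ₗ segment → toℕ lo ≤ toℕ v × toℕ v ≤ toℕ hi
  ∈-segment⁻ v∈ = proj₂ (∈-filter⁻ Segment? {xs = allFin q} v∈)

  segment-walk : ∀ d (v : Fin q) → toℕ v ≡ toℕ lo + d → toℕ v ≤ toℕ hi → Walk PathR (_∈ₗ segment) lo v
  segment-walk zero v eq v≤ with Fin.toℕ-injective (trans eq (+-identityʳ (toℕ lo)))
  ... | refl = stop (∈-segment⁺ ≤-refl v≤)
  segment-walk (suc d) v eq v≤ = snoc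
    (segment-walk d u u≡ (≤-trans (≤-reflexive u≡) (≤-trans (n≤1+n _) (≤-trans (≤-reflexive (sym eq′)) v≤))))
    (inj₁ (trans eq′ (cong suc (sym u≡)))) (∈-segment⁺ (≤-trans (m≤m+n (toℕ lo) (suc d)) (≤-reflexive (sym eq))) v≤)
    where
    eq′ : toℕ v ≡ suc (toℕ lo + d)
    eq′ = trans eq (+-suc (toℕ lo) d)
    u : Fin q
    u = fromℕ< (<-trans (≤-reflexive (sym eq′)) (Fin.toℕ<n v))
    u≡ : toℕ u ≡ toℕ lo + d
    u≡ = Fin.toℕ-fromℕ< _

  segment-connected : Conn PathR segment
  segment-connected u∈ v∈ = walk-trans (walk-rev PathR-sym (from-lo u∈)) (from-lo v∈)
    where
    from-lo : ∀ {v} → v ∈ₗ segment → Walk PathR (_∈ₗ segment) lo v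
    from-lo {v} v∈ = let l , h = ∈-segment⁻ v∈ in segment-walk (toℕ v ∸ toℕ lo) v (sym (m+[n∸m]≡n l)) h

2^-cancel-≤ : ∀ {a b} → 2 ^ a ≤ 2 ^ b → a ≤ b
2^-cancel-≤ le = ≮⇒≥ (λ lt → <⇒≱ (^-monoʳ-< 2 (s≤s (s≤s z≤n)) lt) le)

sum-ones : ∀ {A : Set} (xs : List A) → sum (map (λ _ → 1) xs) ≡ length xs
sum-ones []       = refl
sum-ones (x ∷ xs) = cong suc (sum-ones xs)

-- The segment from f to f′ has a vertex w whose colour c is unique there and usable at both ends,
-- so the number of occurrences of c changes parity across it. Counting before f and before f′
-- detects w unless w is f′; then counting up to and including them does. A vertex thus lies in two
-- tests per usable colour, and 2^(2L) vertices force 2L tests at one of them.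
path-strength : ∀ B L p → 2 ^ (2 * L) ≤ p → Strength (Fin (2 ^ (2 * L))) PathR B p L
path-strength B L p q≤p {k} _ φ M star = f , colours f , Unique.filter⁺ (λ c → Usable? c f) (Unique.allFin⁺ k) , enough ,
  λ c∈ → proj₂ (∈-filter⁻ (λ c → Usable? c f) {xs = allFin k} c∈)
  where
  open import Data.Maybe using (Maybe; just; nothing)
  open Hansel {Fin (2 ^ (2 * L))}
  q = 2 ^ (2 * L)
  Usable : Fin k → Fin q → Set
  Usable c f = M f c ≡ true × ∃[ v ] φ v ≡ c
  abstract
    Usable? : ∀ c f → Dec (Usable c f)
    Usable? c f = M f c Bool.≟ true ×-dec Fin.any? (λ v → φ v Fin.≟ c)
  colours : Fin q → List (Fin k)
  colours f = filter (λ c → Usable? c f) (allFin k)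

  occurs? : ∀ c n → Dec (∃[ v ] toℕ v ≡ n × φ v ≡ c)
  occurs? c n = Fin.any? (λ v → toℕ v ≟ n ×-dec φ v Fin.≟ c)
  -- The parity of the number of occurrences of c at positions below n.
  parity : Fin k → ℕ → Bool
  parity c zero    = false
  parity c (suc n) = if does (occurs? c n) then not (parity c n) else parity c n

  parity-const : ∀ c {a b} → a ≤ b → (∀ v → a ≤ toℕ v → toℕ v < b → φ v ≢ c) → parity c a ≡ parity c b
  parity-const c {b = zero} z≤n _ = refl
  parity-const c {a} {suc b} a≤ none with m≤n⇒m<n∨m≡n a≤
  ... | inj₂ refl = refl
  ... | inj₁ (s≤s a≤b) with occurs? c b | parity-const c a≤b (λ v l h → none v l (m<n⇒m<1+n h))
  ... | yes (v , refl , eq) | _ = ⊥-elim (none v a≤b ≤-refl eq)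
  ... | no _ | ih = ih

  parity-flip : ∀ w → parity (φ w) (suc (toℕ w)) ≡ not (parity (φ w) (toℕ w))
  parity-flip w with occurs? (φ w) (toℕ w)
  ... | yes _ = refl
  ... | no none = ⊥-elim (none (w , refl , refl))

  guarded : ∀ {P : Set} → Dec P → Bool → Maybe Bool
  guarded (yes _) b = just b
  guarded (no _)  b = nothing
  guarded-yes : ∀ {P : Set} (P? : Dec P) {b} → P → guarded P? b ≡ just b
  guarded-yes (yes _) _ = refl
  guarded-yes (no ¬P) P = ⊥-elim (¬P P)
  before upto : Fin k → Test
  before c f = guarded (Usable? c f) (parity c (toℕ f))
  upto c f = guarded (Usable? c f) (parity c (suc (toℕ f)))
  tests : List (Fin k) → List Test
  tests []       = []
  tests (c ∷ cs) = before c ∷ upto c ∷ tests cs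
  before∈ : ∀ {c cs} → c ∈ₗ cs → before c ∈ₗ tests cs
  before∈ (here refl) = here refl
  before∈ (there m)   = there (there (before∈ m))
  upto∈ : ∀ {c cs} → c ∈ₗ cs → upto c ∈ₗ tests cs
  upto∈ (here refl) = there (here refl)
  upto∈ (there m)   = there (there (upto∈ m))

  degree-tests : ∀ f cs → degree (tests cs) f ≡ 2 * length (filter (λ c → Usable? c f) cs)
  degree-tests f [] = refl
  degree-tests f (c ∷ cs) with Usable? c f
  ... | yes _ = trans (cong (2 +_) (degree-tests f cs)) (sym (*-suc 2 _))
  ... | no _  = degree-tests f cs

  separated-by : ∀ {f f′ c} (t : Test) {b b′} → t ∈ₗ tests (allFin k) →
    t f ≡ just b → t f′ ≡ just b′ → b′ ≡ not b → Separated (tests (allFin k)) f f′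
  separated-by t t∈ eq eq′ refl = Any.map (λ { refl → _ , eq , eq′ }) t∈

  separate : ∀ f f′ → toℕ f < toℕ f′ → Separated (tests (allFin k)) f f′
  separate f f′ f<f′ with star (segment f f′) (map φ (segment f f′)) (segment-connected f f′) (∈-map⁺ φ)
    (≤-trans (≤-reflexive (length-map φ (segment f f′))) (≤-trans (length-filter (Segment? f f′) (allFin q))
      (≤-trans (≤-reflexive (length-tabulate id)) q≤p)))
    (∈-segment⁺ f f′ ≤-refl (<⇒≤ f<f′)) (∈-segment⁺ f f′ (<⇒≤ f<f′) ≤-refl)
  ... | w , w∈ , unique , Mf , Mf′ with ∈-segment⁻ f f′ w∈
  ... | f≤w , w≤f′ = by (m≤n⇒m<n∨m≡n w≤f′)
    where
    c = φ w
    only : ∀ v → toℕ f ≤ toℕ v → toℕ v ≤ toℕ f′ → toℕ v ≢ toℕ w → φ v ≢ c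
    only v l h ≢ eq = ≢ (cong toℕ (unique v (∈-segment⁺ f f′ l h) eq))
    before-w : ∀ {n} → toℕ f ≤ n → n ≤ toℕ w → parity c n ≡ parity c (toℕ w)
    before-w f≤n n≤w = parity-const c n≤w (λ v l h → only v (≤-trans f≤n l) (≤-trans (<⇒≤ h) w≤f′) (<⇒≢ h))
    after-w : ∀ {n} → toℕ w < n → n ≤ suc (toℕ f′) → parity c (suc (toℕ w)) ≡ parity c n
    after-w w<n n≤ = parity-const c w<n (λ v l h → only v (≤-trans f≤w (<⇒≤ l)) (s≤s⁻¹ (≤-trans h n≤)) (≢-sym (<⇒≢ l)))
    flip : ∀ {a b} → parity c a ≡ parity c (toℕ w) → parity c (suc (toℕ w)) ≡ parity c b → parity c b ≡ not (parity c a)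
    flip l r = trans (sym r) (trans (parity-flip w) (cong not (sym l)))
    by : toℕ w < toℕ f′ ⊎ toℕ w ≡ toℕ f′ → Separated (tests (allFin k)) f f′
    by (inj₁ w<f′) = separated-by {c = c} (before c) (before∈ (∈-allFin c))
      (guarded-yes (Usable? c f) (Mf , w , refl)) (guarded-yes (Usable? c f′) (Mf′ , w , refl))
      (flip {toℕ f} {toℕ f′} (before-w ≤-refl f≤w) (after-w w<f′ (n≤1+n _)))
    by (inj₂ w≡f′) = separated-by {c = c} (upto c) (upto∈ (∈-allFin c))
      (guarded-yes (Usable? c f) (Mf , w , refl)) (guarded-yes (Usable? c f′) (Mf′ , w , refl))
      (flip {suc (toℕ f)} {suc (toℕ f′)} (before-w (n≤1+n _) (≤-trans f<f′ (≤-reflexive (sym w≡f′)))) (after-w (s≤s w≤f′) ≤-refl))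

  not-swap : ∀ {b b′} → b′ ≡ not b → b ≡ not b′
  not-swap {b} refl = sym (Bool.not-involutive b)

  separated-sym : ∀ {ts f f′} → Separated ts f f′ → Separated ts f′ f
  separated-sym = Any.map λ { (b , eq , eq′) → not b , eq′ , trans eq (cong just (not-swap {b} refl)) }

  Pairs : List (Fin q) → Set
  Pairs = AllPairs (λ f f′ → 1 ≡ 0 ⊎ 1 ≡ 0 ⊎ Separated (tests (allFin k)) f f′)

  pairs : Pairs (allFin q)
  pairs = AllPairs.map separate′ (Unique.allFin⁺ q)
    where
    separate′ : ∀ {f f′} → f ≢ f′ → 1 ≡ 0 ⊎ 1 ≡ 0 ⊎ Separated (tests (allFin k)) f f′
    separate′ {f} {f′} ≢ with <-cmp (toℕ f) (toℕ f′)
    ... | tri< lt _ _ = inj₂ (inj₂ (separate f f′ lt))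
    ... | tri≈ _ eq _ = ⊥-elim (≢ (Fin.toℕ-injective eq))
    ... | tri> _ _ gt = inj₂ (inj₂ (separated-sym (separate f′ f gt)))

  heaviest : ∀ F → Pairs F → 0 < length F → ∃[ f ] length F ≤ 2 ^ degree (tests (allFin k)) f
  heaviest (x ∷ F) ps _ with hansel (tests (allFin k)) (λ _ → 1) x F ps
  ... | f , _ , le = f , ≤-trans (≤-reflexive (sym (sum-ones (x ∷ F)))) (≤-trans le (≤-reflexive (*-identityˡ _)))

  length-allFin : length (allFin q) ≡ q
  length-allFin = length-tabulate id
  best = heaviest (allFin q) pairs (subst (0 <_) (sym length-allFin) (m^n>0 2 (2 * L)))
  f = proj₁ best
  enough : L ≤ length (colours f)
  enough = *-cancelˡ-≤ 2 (2^-cancel-≤ {2 * L} (≤-trans (≤-reflexive (sym length-allFin))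
    (≤-trans (proj₂ best) (≤-reflexive (cong (2 ^_) (degree-tests f (allFin k)))))))

-- The strength of fans

-- A hub joined to B copies of V, each of whose vertices is the hub of a fan of smaller depth.
data Fan (V : Set) (B : ℕ) : ℕ → Set where
  hub : ∀ {r} → Fan V B r
  sub : ∀ {r} → Fin B → V → Fan V B r → Fan V B (suc r)

-- A vertex of the B copies of R that form the row is identified with the hub of its fan: it is sub b z hub.
data FanR {V : Set} (R : V → V → Set) {B : ℕ} : ∀ {r} → Fan V B r → Fan V B r → Set where
  spoke  : ∀ {r b z} → FanR R {r = suc r} hub (sub b z hub)
  spoke⁻ : ∀ {r b z} → FanR R {r = suc r} (sub b z hub) hub
  row    : ∀ {r b z z′} → R z z′ → FanR R {r = suc r} (sub b z hub) (sub b z′ hub)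
  inner  : ∀ {r b z y y′} → FanR R {r = r} y y′ → FanR R {r = suc r} (sub b z y) (sub b z y′)

module _ {V : Set} {R : V → V → Set} {B : ℕ} where

  FanR-sym : (∀ {u v} → R u v → R v u) → ∀ {r} {u v : Fan V B r} → FanR R u v → FanR R v u
  FanR-sym R-sym spoke     = spoke⁻
  FanR-sym R-sym spoke⁻    = spoke
  FanR-sym R-sym (row e)   = row (R-sym e)
  FanR-sym R-sym (inner e) = inner (FanR-sym R-sym e)

sub-injective : ∀ {V : Set} {B r b z y y′} → sub {V} {B} {r} b z y ≡ sub b z y′ → y ≡ y′
sub-injective refl = refl

module _ {V : Set} {R : V → V → Set} where

  Conn-++ : ∀ {I J x} → Conn R I → Conn R J → x ∈ₗ I → x ∈ₗ J → Conn R (I ++ J)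
  Conn-++ {I} {J} {x} conn-I conn-J x∈I x∈J u∈ v∈ = walk-trans (to-x (∈-++⁻ I u∈)) (from-x (∈-++⁻ I v∈))
    where
    in-I : ∀ {u v} → Walk R (_∈ₗ I) u v → Walk R (_∈ₗ I ++ J) u v
    in-I = walk-map id (λ _ _ r → r) ∈-++⁺ˡ
    in-J : ∀ {u v} → Walk R (_∈ₗ J) u v → Walk R (_∈ₗ I ++ J) u v
    in-J = walk-map id (λ _ _ r → r) (∈-++⁺ʳ I)
    to-x : ∀ {u} → u ∈ₗ I ⊎ u ∈ₗ J → Walk R (_∈ₗ I ++ J) u x
    to-x = [ (λ m → in-I (conn-I m x∈I)) , (λ m → in-J (conn-J m x∈J)) ]′
    from-x : ∀ {v} → v ∈ₗ I ⊎ v ∈ₗ J → Walk R (_∈ₗ I ++ J) x v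
    from-x = [ (λ m → in-I (conn-I x∈I m)) , (λ m → in-J (conn-J x∈J m)) ]′

  Conn-star : (∀ {u v} → R u v → R v u) → ∀ {x I} → (∀ {v} → v ∈ₗ I → R x v) → Conn R (x ∷ I)
  Conn-star R-sym {x} {I} spokes u∈ v∈ = walk-trans (walk-rev R-sym (from-x u∈)) (from-x v∈)
    where
    from-x : ∀ {v} → v ∈ₗ x ∷ I → Walk R (_∈ₗ x ∷ I) x v
    from-x (here refl) = stop (here refl)
    from-x (there v∈)  = snoc (stop (here refl)) (spokes v∈) (there v∈)

  Conn-map : ∀ {V′ : Set} {R′ : V′ → V′ → Set} (f : V → V′) → (∀ {u v} → R u v → R′ (f u) (f v)) →
    ∀ {I} → Conn R I → Conn R′ (map f I)
  Conn-map f hom {I} conn u∈ v∈ with ∈-map⁻ f u∈ | ∈-map⁻ f v∈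
  ... | u , u∈I , refl | v , v∈I , refl = walk-map f (λ _ _ → hom) (∈-map⁺ f) (conn u∈I v∈I)

Star-pullback : ∀ {V V′ : Set} {R : V → V → Set} {R′ : V′ → V′ → Set} {k p p′} {φ : V′ → Fin k} {M : V′ → Fin k → Bool}
  (f : V → V′) → Injective _≡_ _≡_ f → (∀ {u v} → R u v → R′ (f u) (f v)) → p ≤ p′ →
  Star R′ p′ φ M → Star R p (φ ∘ f) (M ∘ f)
Star-pullback {φ = φ} f inj hom p≤ star I cs conn covers len g∈ g′∈
  with star (map f I) cs (Conn-map f hom conn)
    (λ v∈ → let u , u∈ , eq = ∈-map⁻ f v∈ in subst (_∈ₗ cs) (cong φ (sym eq)) (covers u∈))
    (≤-trans len p≤) (∈-map⁺ f g∈) (∈-map⁺ f g′∈)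
... | v , v∈ , unique , Mg , Mg′ with ∈-map⁻ f v∈
... | u , u∈ , refl = u , u∈ , (λ w w∈ eq → inj (unique (f w) (∈-map⁺ f w∈) eq)) , Mg , Mg′

select-vertices : ∀ {V : Set} {k} (φ : V → Fin k) {P : V → Set} cs → (∀ {c} → c ∈ₗ cs → ∃[ v ] P v × φ v ≡ c) →
  ∃[ E ] (∀ {v} → v ∈ₗ E → P v × φ v ∈ₗ cs) × (∀ {c} → c ∈ₗ cs → ∃[ v ] v ∈ₗ E × φ v ≡ c)
select-vertices φ [] _ = [] , (λ ()) , λ ()
select-vertices φ (c ∷ cs) choose with choose (here refl) | select-vertices φ cs (choose ∘ there)
... | v , Pv , refl | E , E-ok , E-all = v ∷ E ,
  (λ { (here refl) → Pv , here refl ; (there m) → let Pw , φw = E-ok m in Pw , there φw }) ,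
  (λ { (here refl) → v , here refl , refl ; (there m) → let w , w∈ , eq = E-all m in w , there w∈ , eq })

module FanStrength {V : Set} (R : V → V → Set) (R-sym : ∀ {u v} → R u v → R v u) (B p L : ℕ)
  (strength : Strength V R B p L) {k : ℕ} (k<B : k < B) where

  open import Data.List.Membership.DecPropositional (Fin._≟_ {k}) using () renaming (_∈?_ to _∈ₗ?_)

  abstract

    excluding : (Fin k → Bool) → List (Fin k) → Fin k → Bool
    excluding m ds c = does (m c Bool.≟ true ×-dec ¬? (c ∈ₗ? ds))

    excluding⁻ : ∀ {m : Fin k → Bool} {ds : List (Fin k)} {c} → excluding m ds c ≡ true → m c ≡ true × c ∉ₗ ds
    excluding⁻ {m} {ds} {c} eq with m c Bool.≟ true | c ∈ₗ? ds
    ... | yes mc | no c∉ = mc , c∉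
    excluding⁻ () | yes _ | yes _
    excluding⁻ () | no _  | _

    excluding⁺ : ∀ {m : Fin k → Bool} {ds : List (Fin k)} {c} → m c ≡ true → c ∉ₗ ds → excluding m ds c ≡ true
    excluding⁺ {m} {ds} {c} mc c∉ = dec-true (m c Bool.≟ true ×-dec ¬? (c ∈ₗ? ds)) (mc , c∉)

  record Repetition {r : ℕ} (φ : Fan V B r → Fin k) (tip : Fan V B r) (cs ds : List (Fin k)) : Set where
    field
      H         : List (Fan V B r)
      connected : Conn (FanR R) H
      hub∈      : hub ∈ₗ H
      tip∈      : tip ∈ₗ H
      colours   : ∀ {v} → v ∈ₗ H → φ v ≡ φ hub ⊎ φ v ∈ₗ cs ⊎ φ v ∈ₗ ds
      again     : ∀ {c} → c ∈ₗ ds → ∃[ v ] v ∈ₗ H × v ≢ hub × φ v ≡ c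
      twice     : ∀ {c} → c ∈ₗ cs → ∃[ v ] ∃[ w ] v ∈ₗ H × w ∈ₗ H × v ≢ w × φ v ≡ c × φ w ≡ c

  -- Any set of colours from ds can be repeated away from the hub by a connected set through hub
  -- and tip whose other colours, those of cs, are few and never unique.
  record Spine (r : ℕ) (φ : Fan V B r → Fin k) (M : Fan V B r → Fin k → Bool) : Set where
    field
      tip       : Fan V B r
      cs ds     : List (Fin k)
      length-cs : length cs ≤ r
      unique-ds : Unique ds
      length-ds : r * L ≤ length ds
      usable    : ∀ {c} → c ∈ₗ ds → M tip c ≡ true
      repeat    : ∀ ds′ → (∀ {c} → c ∈ₗ ds′ → c ∈ₗ ds) → Repetition φ tip cs ds′

  module Step {r : ℕ} (φ : Fan V B (suc r) → Fin k) (M : Fan V B (suc r) → Fin k → Bool)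
    (star : Star (FanR R) (p + (suc r + suc r)) φ M)
    (child : ∀ b z → Spine r (φ ∘ sub b z) (M ∘ sub b z)) where

    module S b z = Spine (child b z)

    -- Colours already repeated by the smaller fan are dropped, so that those found in the row are
    -- new.
    newMask : Fin B → V → Fin k → Bool
    newMask b z = excluding (M (sub b z (S.tip b z))) (S.ds b z)

    rowColour : Fin B → V → Fin k
    rowColour b z = φ (sub b z hub)

    -- To I attach, at f and at f′, sets that repeat those colours of I which the two fans can
    -- repeat. This adds only the colours of the two lists `cs`, each occurring twice. A repeated
    -- colour occurs in the row and also away from it, so a vertex of unique colour lies in the row
    -- and its colour is in neither list `ds`.
    row-star : ∀ b → Star R p (rowColour b) (newMask b)
    row-star b I cs₀ conn covers len {f} {f′} f∈ f′∈ = conclude (star H (cs₀ ++ S.cs b f ++ S.cs b f′)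
        (Conn-++ (Conn-++ (Conn-map (λ z → sub b z hub) row conn) (Conn-map (sub b f) inner (A.connected f))
          (∈-map⁺ _ f∈) (∈-map⁺ (sub b f) (A.hub∈ f)))
          (Conn-map (sub b f′) inner (A.connected f′)) (∈-++⁺ˡ (∈-map⁺ _ f′∈)) (∈-map⁺ (sub b f′) (A.hub∈ f′)))
        covered total
        (∈-++⁺ˡ (∈-++⁺ʳ HI (∈-map⁺ (sub b f) (A.tip∈ f)))) (∈-++⁺ʳ (HI ++ Hof f) (∈-map⁺ (sub b f′) (A.tip∈ f′))))
      where
      repeated : V → List (Fin k)
      repeated z = filter (_∈ₗ? map (rowColour b) I) (S.ds b z)
      attached : ∀ z → Repetition (φ ∘ sub b z) (S.tip b z) (S.cs b z) (repeated z)
      attached z = S.repeat b z (repeated z) (λ c∈ → proj₁ (∈-filter⁻ (_∈ₗ? map (rowColour b) I) {xs = S.ds b z} c∈))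
      module A z = Repetition (attached z)
      HI = map (λ z → sub b z hub) I
      Hof : V → List (Fan V B (suc r))
      Hof z = map (sub b z) (A.H z)
      H = (HI ++ Hof f) ++ Hof f′

      row-covered : ∀ {z} → z ∈ₗ I → rowColour b z ∈ₗ cs₀ ++ S.cs b f ++ S.cs b f′
      row-covered z∈ = ∈-++⁺ˡ (covers z∈)
      repeated-row : ∀ z {c} → c ∈ₗ repeated z → ∃[ z′ ] z′ ∈ₗ I × c ≡ rowColour b z′
      repeated-row z c∈ = ∈-map⁻ (rowColour b) (proj₂ (∈-filter⁻ (_∈ₗ? map (rowColour b) I) {xs = S.ds b z} c∈))
      child-covered : ∀ z → z ∈ₗ I → (∀ {c} → c ∈ₗ S.cs b z → c ∈ₗ cs₀ ++ S.cs b f ++ S.cs b f′) →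
        ∀ {v} → v ∈ₗ Hof z → φ v ∈ₗ cs₀ ++ S.cs b f ++ S.cs b f′
      child-covered z z∈ cs⊆ v∈ with ∈-map⁻ (sub b z) v∈
      ... | y , y∈ , refl with A.colours z y∈
      ... | inj₁ eq = subst (_∈ₗ _) (sym eq) (row-covered z∈)
      ... | inj₂ (inj₁ m) = cs⊆ m
      ... | inj₂ (inj₂ m) = let z′ , z′∈ , eq = repeated-row z m in subst (_∈ₗ _) (sym eq) (row-covered z′∈)
      covered : ∀ {v} → v ∈ₗ H → φ v ∈ₗ cs₀ ++ S.cs b f ++ S.cs b f′
      covered v∈ with ∈-++⁻ (HI ++ Hof f) v∈
      ... | inj₂ m = child-covered f′ f′∈ (∈-++⁺ʳ cs₀ ∘ ∈-++⁺ʳ (S.cs b f)) m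
      ... | inj₁ m with ∈-++⁻ HI m
      ... | inj₂ m′ = child-covered f f∈ (∈-++⁺ʳ cs₀ ∘ ∈-++⁺ˡ) m′
      ... | inj₁ m′ = let z , z∈ , eq = ∈-map⁻ (λ z → sub b z hub) m′ in subst (λ v → φ v ∈ₗ _) (sym eq) (row-covered z∈)
      total : length (cs₀ ++ S.cs b f ++ S.cs b f′) ≤ p + (suc r + suc r)
      total = ≤-trans (≤-reflexive (trans (length-++ cs₀) (cong (length cs₀ +_) (length-++ (S.cs b f)))))
        (+-mono-≤ len (+-mono-≤ (m≤n⇒m≤1+n (S.length-cs b f)) (m≤n⇒m≤1+n (S.length-cs b f′))))

      conclude : (∃[ v ] v ∈ₗ H × (∀ w → w ∈ₗ H → φ w ≡ φ v → w ≡ v) ×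
          M (sub b f (S.tip b f)) (φ v) ≡ true × M (sub b f′ (S.tip b f′)) (φ v) ≡ true) →
        ∃[ z ] z ∈ₗ I × (∀ w → w ∈ₗ I → rowColour b w ≡ rowColour b z → w ≡ z) ×
          newMask b f (rowColour b z) ≡ true × newMask b f′ (rowColour b z) ≡ true
      conclude (v , v∈ , unique , Mf , Mf′) = finish (in-row (∈-++⁻ (HI ++ Hof f) v∈))
        where
        ⊆f : ∀ {w} → w ∈ₗ Hof f → w ∈ₗ H
        ⊆f m = ∈-++⁺ˡ (∈-++⁺ʳ HI m)
        ⊆f′ : ∀ {w} → w ∈ₗ Hof f′ → w ∈ₗ H
        ⊆f′ m = ∈-++⁺ʳ (HI ++ Hof f) m
        row∈ : ∀ {z} → z ∈ₗ I → sub b z hub ∈ₗ H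
        row∈ z∈ = ∈-++⁺ˡ (∈-++⁺ˡ (∈-map⁺ _ z∈))
        ∉cs : ∀ z → (∀ {w} → w ∈ₗ Hof z → w ∈ₗ H) → φ v ∉ₗ S.cs b z
        ∉cs z ⊆H m with A.twice z m
        ... | y , y′ , y∈ , y′∈ , y≢y′ , eq , eq′ = y≢y′ (sub-injective (trans
          (unique _ (⊆H (∈-map⁺ (sub b z) y∈)) eq) (sym (unique _ (⊆H (∈-map⁺ (sub b z) y′∈)) eq′))))
        ∉repeated : ∀ z → (∀ {w} → w ∈ₗ Hof z → w ∈ₗ H) → φ v ∉ₗ repeated z
        ∉repeated z ⊆H m with repeated-row z m | A.again z m
        ... | z′ , z′∈ , eq | y , y∈ , y≢hub , eq′ = clash
          (trans (unique _ (⊆H (∈-map⁺ (sub b z) y∈)) eq′) (sym (unique _ (row∈ z′∈) (sym eq)))) y≢hub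
          where
          clash : ∀ {z z′ y} → sub {V} {B} {r} b z y ≡ sub b z′ hub → y ≢ hub → ⊥
          clash refl ≢ = ≢ refl
        child-hub : ∀ z → z ∈ₗ I → (∀ {w} → w ∈ₗ Hof z → w ∈ₗ H) → v ∈ₗ Hof z → ∃[ z ] z ∈ₗ I × v ≡ sub b z hub
        child-hub z z∈ ⊆H m with ∈-map⁻ (sub b z) m
        ... | y , y∈ , refl with A.colours z y∈
        ... | inj₁ eq = z , z∈ , sym (unique _ (row∈ z∈) (sym eq))
        ... | inj₂ (inj₁ m′) = ⊥-elim (∉cs z ⊆H m′)
        ... | inj₂ (inj₂ m′) = ⊥-elim (∉repeated z ⊆H m′)
        in-row : v ∈ₗ HI ++ Hof f ⊎ v ∈ₗ Hof f′ → ∃[ z ] z ∈ₗ I × v ≡ sub b z hub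
        in-row (inj₂ m) = child-hub f′ f′∈ ⊆f′ m
        in-row (inj₁ m) = [ ∈-map⁻ (λ z → sub b z hub) , child-hub f f∈ ⊆f ]′ (∈-++⁻ HI m)
        finish : ∃[ z ] z ∈ₗ I × v ≡ sub b z hub →
          ∃[ z ] z ∈ₗ I × (∀ w → w ∈ₗ I → rowColour b w ≡ rowColour b z → w ≡ z) ×
            newMask b f (rowColour b z) ≡ true × newMask b f′ (rowColour b z) ≡ true
        finish (z , z∈ , refl) = z , z∈ , (λ w w∈ eq → hub-injective (unique _ (row∈ w∈) eq)) ,
          excluding⁺ {M (sub b f (S.tip b f))} {S.ds b f} Mf (∉ds f ⊆f) , excluding⁺ {M (sub b f′ (S.tip b f′))} {S.ds b f′} Mf′ (∉ds f′ ⊆f′)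
          where
          hub-injective : ∀ {w z} → sub {V} {B} {r} b w hub ≡ sub b z hub → w ≡ z
          hub-injective refl = refl
          ∉ds : ∀ z′ → (∀ {w} → w ∈ₗ Hof z′ → w ∈ₗ H) → rowColour b z ∉ₗ S.ds b z′
          ∉ds z′ ⊆H m = ∉repeated z′ ⊆H (∈-filter⁺ (_∈ₗ? map (rowColour b) I) m (∈-map⁺ (rowColour b) z∈))

    best : ∀ b → ∃[ f ] ∃[ cs ] Unique cs × L ≤ length cs ×
      (∀ {c} → c ∈ₗ cs → newMask b f c ≡ true × ∃[ v ] rowColour b v ≡ c)
    best b = strength k<B (rowColour b) (newMask b) (row-star b)

    module Finish (b b′ : Fin B) (b≢b′ : b ≢ b′) (z z′ : V) (same-colour : rowColour b z ≡ rowColour b′ z′)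
      (es : List (Fin k)) (unique-es : Unique es) (length-es : L ≤ length es)
      (es-ok : ∀ {c} → c ∈ₗ es → newMask b z c ≡ true × ∃[ v ] rowColour b v ≡ c) where

      new-usable : ∀ {c} → newMask b z c ≡ true → M (sub b z (S.tip b z)) c ≡ true × c ∉ₗ S.ds b z
      new-usable = excluding⁻ {M (sub b z (S.tip b z))} {S.ds b z}

      -- The new colours are shown by row vertices, reached through the outer hub. The hub of the
      -- smaller fan becomes an ordinary vertex, so its colour joins `cs` and must occur twice: the
      -- vertex of the same colour in copy b′ serves for this.
      repeat′ : ∀ ds′ → (∀ {c} → c ∈ₗ ds′ → c ∈ₗ S.ds b z ++ es) →
        Repetition φ (sub b z (S.tip b z)) (φ (sub b z hub) ∷ S.cs b z) ds′
      repeat′ ds′ ds′⊆ with select-vertices φ {λ v → ∃[ b ] ∃[ z ] v ≡ sub b z hub} (filter (_∈ₗ? es) ds′)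
          (λ c∈ → let v , eq = proj₂ (es-ok (proj₂ (∈-filter⁻ (_∈ₗ? es) {xs = ds′} c∈))) in sub b v hub , (b , v , refl) , eq)
      ... | E , E-ok , E-all = record
        { H = star-part ++ map (sub b z) H
        ; connected = Conn-++ (Conn-star (FanR-sym R-sym) spokes) (Conn-map (sub b z) inner connected) (there (here refl)) (∈-map⁺ (sub b z) hub∈)
        ; hub∈ = here refl
        ; tip∈ = ∈-++⁺ʳ star-part (∈-map⁺ (sub b z) tip∈)
        ; colours = colours′ ; again = again′ ; twice = twice′ }
        where
        open Repetition (S.repeat b z (filter (_∈ₗ? S.ds b z) ds′) (λ c∈ → proj₂ (∈-filter⁻ (_∈ₗ? S.ds b z) {xs = ds′} c∈)))
        star-part = hub ∷ sub b z hub ∷ sub b′ z′ hub ∷ E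
        spokes : ∀ {v} → v ∈ₗ sub b z hub ∷ sub b′ z′ hub ∷ E → FanR R hub v
        spokes (here refl) = spoke
        spokes (there (here refl)) = spoke
        spokes (there (there m)) with proj₁ (E-ok m)
        ... | _ , _ , refl = spoke
        star-colours : ∀ {v} → v ∈ₗ star-part → φ v ≡ φ hub ⊎ φ v ∈ₗ φ (sub b z hub) ∷ S.cs b z ⊎ φ v ∈ₗ ds′
        star-colours (here refl) = inj₁ refl
        star-colours (there (here refl)) = inj₂ (inj₁ (here refl))
        star-colours (there (there (here refl))) = inj₂ (inj₁ (here (sym same-colour)))
        star-colours (there (there (there m))) = inj₂ (inj₂ (proj₁ (∈-filter⁻ (_∈ₗ? es) {xs = ds′} (proj₂ (E-ok m)))))
        colours′ : ∀ {v} → v ∈ₗ star-part ++ map (sub b z) H →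
          φ v ≡ φ hub ⊎ φ v ∈ₗ φ (sub b z hub) ∷ S.cs b z ⊎ φ v ∈ₗ ds′
        colours′ v∈ with ∈-++⁻ star-part v∈
        ... | inj₁ m = star-colours m
        ... | inj₂ m with ∈-map⁻ (sub b z) m
        ... | y , y∈ , refl with colours y∈
        ... | inj₁ eq = inj₂ (inj₁ (here eq))
        ... | inj₂ (inj₁ m′) = inj₂ (inj₁ (there m′))
        ... | inj₂ (inj₂ m′) = inj₂ (inj₂ (proj₁ (∈-filter⁻ (_∈ₗ? S.ds b z) {xs = ds′} m′)))
        again′ : ∀ {c} → c ∈ₗ ds′ → ∃[ v ] v ∈ₗ star-part ++ map (sub b z) H × v ≢ hub × φ v ≡ c
        again′ c∈ with ∈-++⁻ (S.ds b z) (ds′⊆ c∈)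
        ... | inj₁ m = let y , y∈ , _ , eq = again (∈-filter⁺ (_∈ₗ? S.ds b z) c∈ m) in
          sub b z y , ∈-++⁺ʳ star-part (∈-map⁺ (sub b z) y∈) , (λ ()) , eq
        ... | inj₂ m with E-all (∈-filter⁺ (_∈ₗ? es) c∈ m)
        ... | v , v∈ , eq with proj₁ (E-ok v∈)
        ... | _ , _ , refl = v , ∈-++⁺ˡ (there (there (there v∈))) , (λ ()) , eq
        twice′ : ∀ {c} → c ∈ₗ φ (sub b z hub) ∷ S.cs b z →
          ∃[ v ] ∃[ w ] v ∈ₗ star-part ++ map (sub b z) H × w ∈ₗ star-part ++ map (sub b z) H × v ≢ w × φ v ≡ c × φ w ≡ c
        twice′ (here refl) = sub b z hub , sub b′ z′ hub , there (here refl) , there (there (here refl)) ,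
          (λ eq → b≢b′ (copy eq)) , refl , sym same-colour
          where
          copy : ∀ {b b′ z z′} → sub {V} {B} {r} b z hub ≡ sub b′ z′ hub → b ≡ b′
          copy refl = refl
        twice′ (there m) = let y , y′ , y∈ , y′∈ , y≢y′ , eq , eq′ = twice m in
          sub b z y , sub b z y′ , ∈-++⁺ʳ star-part (∈-map⁺ (sub b z) y∈) , ∈-++⁺ʳ star-part (∈-map⁺ (sub b z) y′∈) ,
          y≢y′ ∘ sub-injective , eq , eq′

      finished : Spine (suc r) φ M
      finished = record
        { tip = sub b z (S.tip b z)
        ; cs = φ (sub b z hub) ∷ S.cs b z
        ; ds = S.ds b z ++ es
        ; length-cs = s≤s (S.length-cs b z)
        ; unique-ds = Unique.++⁺ (S.unique-ds b z) unique-es (λ (c∈ds , c∈es) → proj₂ (new-usable (proj₁ (es-ok c∈es))) c∈ds)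
        ; length-ds = ≤-trans (≤-reflexive (+-comm L (r * L)))
            (≤-trans (+-mono-≤ (S.length-ds b z) length-es) (≤-reflexive (sym (length-++ (S.ds b z)))))
        ; usable = λ c∈ → [ S.usable b z , (λ c∈es → proj₁ (new-usable (proj₁ (es-ok c∈es)))) ]′ (∈-++⁻ (S.ds b z) c∈)
        ; repeat = repeat′
        }

    step-spine : Spine (suc r) φ M
    -- There are more copies than colours, so the best vertices of two copies share a colour.
    step-spine = pick (Fin.pigeonhole k<B (λ b → rowColour b (proj₁ (best b))))
      where
      pick : (∃[ b ] ∃[ b′ ] b Fin.< b′ × rowColour b (proj₁ (best b)) ≡ rowColour b′ (proj₁ (best b′))) → Spine (suc r) φ M
      pick (b , b′ , b<b′ , same) = Finish.finished b b′ (Fin.<⇒≢ b<b′) (proj₁ (best b)) (proj₁ (best b′)) same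
        (proj₁ (proj₂ (best b))) (proj₁ (proj₂ (proj₂ (best b)))) (proj₁ (proj₂ (proj₂ (proj₂ (best b)))))
        (proj₂ (proj₂ (proj₂ (proj₂ (best b)))))

  spine : ∀ r φ M → Star (FanR R) (p + (r + r)) φ M → Spine r φ M
  spine zero φ M _ = record
    { tip = hub ; cs = [] ; ds = [] ; length-cs = z≤n ; unique-ds = [] ; length-ds = z≤n ; usable = λ ()
    ; repeat = λ ds′ ⊆[] → record
        { H = hub ∷ [] ; connected = λ { (here refl) (here refl) → stop (here refl) }
        ; hub∈ = here refl ; tip∈ = here refl ; colours = λ { (here refl) → inj₁ refl }
        ; again = λ c∈ → case ⊆[] c∈ of λ () ; twice = λ () } }
  spine (suc r) φ M star = Step.step-spine φ M star λ b z →
    spine r (φ ∘ sub b z) (M ∘ sub b z) (Star-pullback {φ = φ} {M} (sub b z) sub-injective inner (+-monoʳ-≤ p (+-mono-≤ (n≤1+n r) (n≤1+n r))) star)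

-- Each unit of depth gains L colours at one tip and costs two units of budget, one for each
-- structure hung on an interval.
fan-strength : ∀ {V : Set} {R : V → V → Set} → (∀ {u v} → R u v → R v u) → ∀ B p L r →
  Strength V R B p L → Strength (Fan V B r) (FanR R) B (p + (r + r)) (r * L)
fan-strength {R = R} R-sym B p L r strength k<B φ M star = tip , ds , unique-ds , length-ds ,
  λ {c} c∈ → usable c∈ , attained c∈
  where
  open FanStrength R R-sym B p L strength k<B
  open Spine (spine r φ M star)
  attained : ∀ {c} → c ∈ₗ ds → ∃[ v ] φ v ≡ c
  attained c∈ = let v , _ , _ , eq = Repetition.again (repeat ds id) c∈ in v , eq

-- Fans in outerplanar graphs

PC-star : ∀ {V : Set} {n k p} {R₀ : V → V → Set} {R : Fin n → Fin n → Set} (e : V → Fin n) → Injective _≡_ _≡_ e →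
  (∀ {u v} → R₀ u v → R (e u) (e v)) → {φ : Fin n → Fin k} → PC p R φ → Star R₀ p (φ ∘ e) (λ _ _ → true)
PC-star {V} {n} {k} {p} {R₀} {R} e e-inj hom {φ} pc I cs conn covers len {f} f∈ _ =
  [ ⊥-elim ∘ too-many , unique ]′ (pc image ((e f , ∈-subset⁺ Im? (here∈ f∈)) , conn′))
  where
  Im? : Decidable (λ v → Any (λ u → e u ≡ v) I)
  Im? v = any? (λ u → e u Fin.≟ v) I
  here∈ : ∀ {u} → u ∈ₗ I → Any (λ w → e w ≡ e u) I
  here∈ = Any.map (λ { refl → refl })
  preimage : ∀ {v} → Any (λ u → e u ≡ v) I → ∃[ u ] u ∈ₗ I × e u ≡ v
  preimage = find
  image : Subset n
  image = subset Im?
  conn′ : ∀ u v → u ∈ image → v ∈ image → Reach R image u v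
  conn′ u v u∈ v∈ with preimage (∈-subset⁻ Im? u∈) | preimage (∈-subset⁻ Im? v∈)
  ... | u′ , u′∈ , refl | v′ , v′∈ , refl = walk⇒reach (walk-map e (λ _ _ → hom) (∈-subset⁺ Im? ∘ here∈) (conn u′∈ v′∈))
  covered : ∀ {v} → v ∈ image → φ v ∈ₗ cs
  covered v∈ with preimage (∈-subset⁻ Im? v∈)
  ... | u , u∈ , refl = covers u∈
  too-many : MoreThanColours p φ image → ⊥
  too-many (z , z∈ , inj) = <⇒≱ (s≤s len) (Fin.injective⇒≤ {f = λ t → index (covered (z∈ t))} λ {s} {t} eq →
    inj (trans (Any.lookup-index (covered (z∈ s))) (trans (cong (lookup cs) eq) (sym (Any.lookup-index (covered (z∈ t)))))))
  unique : HasUniqueColour φ image → _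
  unique (v , v∈ , uniq) with preimage (∈-subset⁻ Im? v∈)
  ... | u , u∈ , refl = u , u∈ , (λ w w∈ eq → e-inj (uniq (e w) (∈-subset⁺ Im? (here∈ w∈)) eq)) , refl , refl

unique-length : ∀ {k} {cs : List (Fin k)} → Unique cs → length cs ≤ k
unique-length {cs = cs} unique = Fin.injective⇒≤ (lookup-injective unique)
  where
  lookup-injective : ∀ {A : Set} {xs : List A} → Unique xs → ∀ {i j} → lookup xs i ≡ lookup xs j → i ≡ j
  lookup-injective (_ ∷ _)  {zero}  {zero}  _  = refl
  lookup-injective (x≢ ∷ _) {zero}  {suc j} eq = ⊥-elim (All.lookup x≢ (∈-lookup j) eq)
  lookup-injective (x≢ ∷ _) {suc i} {zero}  eq = ⊥-elim (All.lookup x≢ (∈-lookup i) (sym eq))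
  lookup-injective (_ ∷ u)  {suc i} {suc j} eq = cong suc (lookup-injective u eq)

strength⇒colours : ∀ {V : Set} {R₀ : V → V → Set} {B p L n} {R : Fin n → Fin n → Set} → Strength V R₀ B p L →
  (e : V → Fin n) → Injective _≡_ _≡_ e → (∀ {u v} → R₀ u v → R (e u) (e v)) →
  ∀ {k} → k < B → Σ (Fin n → Fin k) (PC p R) → L ≤ k
strength⇒colours strength e e-inj hom k<B (φ , pc) with strength k<B (φ ∘ e) (λ _ _ → true) (PC-star e e-inj hom pc)
... | _ , cs , unique , long , _ = ≤-trans long (unique-length unique)

does⇒ : ∀ {P : Set} (P? : Dec P) → does P? ≡ true → P
does⇒ (yes P) _ = P

module GraphOf {n : ℕ} {R : Fin n → Fin n → Set} (R? : ∀ u v → Dec (R u v)) (R-irrefl : ∀ {u} → ¬ R u u) where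

  graphOf : Graph n
  graphOf = record
    { adj = λ u v → does (R? u v ⊎-dec R? v u)
    ; symm = λ u v → Bool.∨-comm (does (R? u v)) (does (R? v u))
    ; irrefl = λ u → dec-false (R? u u ⊎-dec R? u u) [ R-irrefl , R-irrefl ]′
    }

  edge⁺ : ∀ {u v} → R u v ⊎ R v u → Edge graphOf u v
  edge⁺ {u} {v} r = dec-true (R? u v ⊎-dec R? v u) r

  edge⁻ : ∀ {u v} → Edge graphOf u v → R u v ⊎ R v u
  edge⁻ {u} {v} = does⇒ (R? u v ⊎-dec R? v u)

combine-next : ∀ {B q} (b : Fin B) {z z′ : Fin q} → toℕ z′ ≡ suc (toℕ z) → toℕ (combine b z′) ≡ suc (toℕ (combine b z))
combine-next {q = q} b {z} {z′} eq = trans (Fin.toℕ-combine b z′) (trans (cong (q * toℕ b +_) eq)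
  (trans (+-suc (q * toℕ b) (toℕ z)) (cong suc (sym (Fin.toℕ-combine b z)))))

-- Listing every fan hub first and then block after block exhibits iterated fans over paths as
-- outerplanar graphs; all the copies of the path may be strung together into a single one.
module OuterplanarFan (q B : ℕ) where

  N : ℕ
  N = B * q

  size : ℕ → ℕ
  size zero    = 1
  size (suc r) = suc (N * size r)

  size>0 : ∀ r → 0 < size r
  size>0 zero    = z<s
  size>0 (suc r) = z<s

  -- The alternatives are the spokes, the steps from one block start to the next, and the edges
  -- inside block w. The step from the last block leads to position `size (suc r)`, where there is
  -- no vertex.
  Lex : ℕ → ℕ → ℕ → Set
  Lex zero    c d = ⊥
  Lex (suc r) c d = ∃[ w ]
    ((c ≡ 0 × d ≡ suc (size r * toℕ {N} w)) ⊎
     (c ≡ suc (size r * toℕ w) × d ≡ suc (size r * suc (toℕ w))) ⊎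
     (∃[ a ] ∃[ b ] c ≡ suc (size r * toℕ w + toℕ {size r} a) × d ≡ suc (size r * toℕ w + toℕ {size r} b) ×
       Lex r (toℕ a) (toℕ b)))

  Lex? : ∀ r c d → Dec (Lex r c d)
  Lex? zero    c d = no λ ()
  Lex? (suc r) c d = Fin.any? λ w →
    (c ≟ 0 ×-dec d ≟ suc (size r * toℕ w)) ⊎-dec
    (c ≟ suc (size r * toℕ w) ×-dec d ≟ suc (size r * suc (toℕ w))) ⊎-dec
    (Fin.any? λ a → Fin.any? λ b → c ≟ suc (size r * toℕ w + toℕ a) ×-dec d ≟ suc (size r * toℕ w + toℕ b) ×-dec
      Lex? r (toℕ a) (toℕ b))

  block-end : ∀ {s} w (a : Fin s) → s * w + toℕ a < s * suc w
  block-end {s} w a = <-≤-trans (+-monoʳ-< (s * w) (Fin.toℕ<n a)) (≤-reflexive (trans (+-comm (s * w) s) (sym (*-suc s w))))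

  block-< : ∀ s {x y} → s * x < s * y → x < y
  block-< s {x} {y} = *-cancelˡ-< s x y

  Lex-< : ∀ r {c d} → Lex r c d → c < d
  Lex-< (suc r) (w , inj₁ (refl , refl)) = z<s
  Lex-< (suc r) (w , inj₂ (inj₁ (refl , refl))) =
    s≤s (<-≤-trans (m<n+m (size r * toℕ w) (size>0 r)) (≤-reflexive (sym (*-suc (size r) (toℕ w)))))
  Lex-< (suc r) (w , inj₂ (inj₂ (a , b , refl , refl , e))) = s≤s (+-monoʳ-< (size r * toℕ w) (Lex-< r e))

  noncrossing : ∀ r {a b c d} → Lex r a b → Lex r c d → a < c → c < b → b < d → ⊥
  noncrossing (suc r) (w , inj₁ (refl , refl)) (w′ , inj₁ (refl , _)) () _ _
  noncrossing (suc r) (w , inj₁ (refl , refl)) (w′ , inj₂ (inj₁ (refl , refl))) _ (s≤s c<b) (s≤s b<d) =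
    <⇒≱ (block-< (size r) c<b) (s≤s⁻¹ (block-< (size r) b<d))
  noncrossing (suc r) (w , inj₁ (refl , refl)) (w′ , inj₂ (inj₂ (a′ , b′ , refl , refl , _))) _ (s≤s c<b) (s≤s b<d) =
    <⇒≱ (block-< (size r) (≤-<-trans (m≤m+n _ (toℕ a′)) c<b)) (s≤s⁻¹ (block-< (size r) (<-trans b<d (block-end (toℕ w′) b′))))
  noncrossing (suc r) (w , inj₂ (inj₁ (refl , refl))) (w′ , inj₁ (refl , _)) () _ _
  noncrossing (suc r) (w , inj₂ (inj₁ (refl , refl))) (w′ , inj₂ (inj₁ (refl , refl))) (s≤s a<c) (s≤s c<b) _ =
    <⇒≱ (block-< (size r) a<c) (s≤s⁻¹ (block-< (size r) c<b))
  noncrossing (suc r) (w , inj₂ (inj₁ (refl , refl))) (w′ , inj₂ (inj₂ (a′ , b′ , refl , refl , _))) _ (s≤s c<b) (s≤s b<d) =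
    <⇒≱ (block-< (size r) (≤-<-trans (m≤m+n _ (toℕ a′)) c<b)) (s≤s⁻¹ (block-< (size r) (<-trans b<d (block-end (toℕ w′) b′))))
  noncrossing (suc r) (w , inj₂ (inj₂ (_ , _ , refl , refl , _))) (w′ , inj₁ (refl , _)) () _ _
  noncrossing (suc r) (w , inj₂ (inj₂ (a₀ , b₀ , refl , refl , _))) (w′ , inj₂ (inj₁ (refl , refl))) (s≤s a<c) (s≤s c<b) _ =
    <⇒≱ (block-< (size r) (≤-<-trans (m≤m+n _ (toℕ a₀)) a<c)) (s≤s⁻¹ (block-< (size r) (<-trans c<b (block-end (toℕ w) b₀))))
  noncrossing (suc r) (w , inj₂ (inj₂ (a₀ , b₀ , refl , refl , e))) (w′ , inj₂ (inj₂ (a′ , b′ , refl , refl , e′)))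
    (s≤s a<c) (s≤s c<b) (s≤s b<d)
    with ≤-antisym (s≤s⁻¹ (block-< (size r) (≤-<-trans (m≤m+n (size r * toℕ w) (toℕ a₀)) (<-trans a<c (block-end (toℕ w′) a′)))))
                   (s≤s⁻¹ (block-< (size r) (≤-<-trans (m≤m+n (size r * toℕ w′) (toℕ a′)) (<-trans c<b (block-end (toℕ w) b₀)))))
  ... | w≡w′ rewrite w≡w′ = noncrossing r e e′ (cancel a<c) (cancel c<b) (cancel b<d)
    where
    cancel : ∀ {x y} → size r * toℕ w′ + x < size r * toℕ w′ + y → x < y
    cancel = +-cancelˡ-< (size r * toℕ w′) _ _

  encode : ∀ {r} → Fan (Fin q) B r → Fin (size r)
  encode {zero}  hub         = zero
  encode {suc r} hub         = zero
  encode {suc r} (sub b z y) = suc (combine (combine b z) (encode y))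

  encode-hub : ∀ r → toℕ (encode {r} hub) ≡ 0
  encode-hub zero    = refl
  encode-hub (suc r) = refl

  encode-injective : ∀ {r} → Injective _≡_ _≡_ (encode {r})
  encode-injective {zero}  {hub}       {hub}          _  = refl
  encode-injective {suc r} {hub}       {hub}          _  = refl
  encode-injective {suc r} {sub b z y} {sub b′ z′ y′} eq
    with Fin.combine-injective (combine b z) (encode y) (combine b′ z′) (encode y′) (Fin.suc-injective eq)
  ... | bz≡ , y≡ with Fin.combine-injective b z b′ z′ bz≡ | encode-injective y≡
  ... | refl , refl | refl = refl

  encode-sub : ∀ {r} b z (y : Fan (Fin q) B r) →
    toℕ (encode (sub b z y)) ≡ suc (size r * toℕ (combine b z) + toℕ (encode y))
  encode-sub b z y = cong suc (Fin.toℕ-combine (combine b z) (encode y))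

  encode-row : ∀ {r} b z → toℕ (encode {suc r} (sub b z hub)) ≡ suc (size r * toℕ (combine b z))
  encode-row {r} b z = trans (encode-sub b z hub) (cong suc (trans (cong (size r * toℕ (combine b z) +_) (encode-hub r)) (+-identityʳ _)))

  encode-row-next : ∀ {r} b {z z′ : Fin q} → toℕ z′ ≡ suc (toℕ z) →
    toℕ (encode {suc r} (sub b z′ hub)) ≡ suc (size r * suc (toℕ (combine b z)))
  encode-row-next {r} b {z} {z′} eq = trans (encode-row b z′) (cong (λ x → suc (size r * x)) (combine-next b eq))

  encode-edge : ∀ {r} {u v : Fan (Fin q) B r} → FanR PathR u v →
    Lex r (toℕ (encode u)) (toℕ (encode v)) ⊎ Lex r (toℕ (encode v)) (toℕ (encode u))
  encode-edge (spoke {b = b} {z})  = inj₁ (combine b z , inj₁ (refl , encode-row b z))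
  encode-edge (spoke⁻ {b = b} {z}) = inj₂ (combine b z , inj₁ (refl , encode-row b z))
  encode-edge (row {b = b} {z} {z′} (inj₁ eq)) = inj₁ (combine b z , inj₂ (inj₁ (encode-row b z , encode-row-next b eq)))
  encode-edge (row {b = b} {z} {z′} (inj₂ eq)) = inj₂ (combine b z′ , inj₂ (inj₁ (encode-row b z′ , encode-row-next b eq)))
  encode-edge (inner {b = b} {z} {y} {y′} e) = Sum.map (embed y y′) (embed y′ y) (encode-edge e)
    where
    embed : ∀ {r} (y y′ : Fan (Fin q) B r) → Lex r (toℕ (encode y)) (toℕ (encode y′)) →
      Lex (suc r) (toℕ (encode (sub b z y))) (toℕ (encode (sub b z y′)))
    embed y y′ l = combine b z , inj₂ (inj₂ (encode y , encode y′ , encode-sub b z y , encode-sub b z y′ , l))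

  module _ (r : ℕ) where

    open GraphOf {size r} {λ u v → Lex r (toℕ u) (toℕ v)} (λ u v → Lex? r (toℕ u) (toℕ v)) (<-irrefl refl ∘ Lex-< r) public

    graphOf-outerplanar : Outerplanar graphOf
    graphOf-outerplanar = id , id , λ a b c d ab cd a<c c<b b<d →
      noncrossing r (forward ab (<-trans a<c c<b)) (forward cd (<-trans c<b b<d)) a<c c<b b<d
      where
      forward : ∀ {u v} → Edge graphOf u v → toℕ u < toℕ v → Lex r (toℕ u) (toℕ v)
      forward {u} {v} e lt = [ id , (λ l → ⊥-elim (<-asym lt (Lex-< r l))) ]′ (edge⁻ {u} {v} e)

    fan-in-graphOf : ∀ {u v : Fan (Fin q) B r} → FanR PathR u v → Edge graphOf (encode u) (encode v)
    fan-in-graphOf {u} {v} e = edge⁺ {encode u} {encode v} (encode-edge e)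

-- Fans in stacked triangulations

-- With natural numbers as corners the name of a face survives later insertions, which change the
-- type `Fin n`. `∼` and `≃` ignore the order of corners and of faces.
Face : Set
Face = ℕ × ℕ × ℕ

data _∼_ : Face → Face → Set where
  same  : ∀ {t} → t ∼ t
  s12   : ∀ {a b c} → (a , b , c) ∼ (b , a , c)
  s23   : ∀ {a b c} → (a , b , c) ∼ (a , c , b)
  _then_ : ∀ {s t u} → s ∼ t → t ∼ u → s ∼ u

data _≃_ : List Face → List Face → Set where
  []    : [] ≃ []
  prep  : ∀ {s t xs ys} → s ∼ t → xs ≃ ys → (s ∷ xs) ≃ (t ∷ ys)
  swap  : ∀ {s t xs ys} → xs ≃ ys → (s ∷ t ∷ xs) ≃ (t ∷ s ∷ ys)
  _thenˡ_ : ∀ {xs ys zs} → xs ≃ ys → ys ≃ zs → xs ≃ zs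

≃-refl : ∀ {xs} → xs ≃ xs
≃-refl {[]}     = []
≃-refl {x ∷ xs} = prep same ≃-refl

≃-reflexive : ∀ {xs ys} → xs ≡ ys → xs ≃ ys
≃-reflexive refl = ≃-refl

≃-++ : ∀ {xs ys zs ws} → xs ≃ ys → zs ≃ ws → (xs ++ zs) ≃ (ys ++ ws)
≃-++ []          f = f
≃-++ (prep s e)  f = prep s (≃-++ e f)
≃-++ (swap e)    f = swap (≃-++ e f)
≃-++ (e thenˡ e′) f = ≃-++ e f thenˡ ≃-++ e′ ≃-refl

≃-to-front : ∀ xs {t ys} → (xs ++ t ∷ ys) ≃ (t ∷ xs ++ ys)
≃-to-front []       = ≃-refl
≃-to-front (x ∷ xs) = prep same (≃-to-front xs) thenˡ swap ≃-refl

≃-remove : ∀ {xs ys} → xs ≃ ys → (j : Fin (length ys)) →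
  ∃[ i ] lookup xs i ∼ lookup ys j × removeAt xs i ≃ removeAt ys j
≃-remove (prep s e) zero    = zero , s , e
≃-remove (prep s e) (suc j) = let i , s′ , e′ = ≃-remove e j in suc i , s′ , prep s e′
≃-remove (swap e) zero          = suc zero , same , prep same e
≃-remove (swap e) (suc zero)    = zero , same , prep same e
≃-remove (swap e) (suc (suc j)) = let i , s′ , e′ = ≃-remove e j in suc (suc i) , s′ , swap e′
≃-remove (e thenˡ e′) j = let i , s , r = ≃-remove e′ j ; i′ , s′ , r′ = ≃-remove e i in i′ , (s′ then s) , (r′ thenˡ r)

face : ∀ {n} → Tri n → Face
face (a , b , c) = toℕ a , toℕ b , toℕ c

faces : ∀ {n} → List (Tri n) → List Face
faces = map face

faces-remove : ∀ {n} (F : List (Tri n)) {t rest} → faces F ≃ (t ∷ rest) →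
  ∃[ i ] face (lookup F i) ∼ t × faces (removeAt F i) ≃ rest
faces-remove F e with ≃-remove e zero
... | i , s , r = go F i s r
  where
  go : ∀ F (i : Fin (length (faces F))) {t rest} → lookup (faces F) i ∼ t → removeAt (faces F) i ≃ rest →
    ∃[ i ] face (lookup F i) ∼ t × faces (removeAt F i) ≃ rest
  go F i s r = let i′ , l≡ , r≡ = index′ F i in
    i′ , subst (_∼ _) l≡ s , subst (_≃ _) r≡ r
    where
    index′ : ∀ F (i : Fin (length (faces F))) → ∃[ i′ ] lookup (faces F) i ≡ face (lookup F i′) ×
      removeAt (faces F) i ≡ faces (removeAt F i′)
    index′ (x ∷ F) zero    = zero , refl , refl
    index′ (x ∷ F) (suc i) = let i′ , l≡ , r≡ = index′ F i in suc i′ , l≡ , cong (face x ∷_) r≡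

faces-lift : ∀ {n} (F : List (Tri n)) → faces (liftF F) ≡ faces F
faces-lift [] = refl
faces-lift ((a , b , c) ∷ F) = cong₂ _∷_
  (cong₂ _,_ (Fin.toℕ-inject₁ a) (cong₂ _,_ (Fin.toℕ-inject₁ b) (Fin.toℕ-inject₁ c))) (faces-lift F)

cone : ℕ → Face → List Face
cone x (a , b , c) = (a , b , x) ∷ (b , c , x) ∷ (a , c , x) ∷ []

cone-∼ : ∀ {x s t} → s ∼ t → cone x s ≃ cone x t
cone-∼ same = ≃-refl
cone-∼ s12 = prep s12 (swap [])
cone-∼ s23 = (prep same (swap []) thenˡ swap ≃-refl) thenˡ prep same (swap [] thenˡ prep s12 ≃-refl)
cone-∼ (e then e′) = cone-∼ e thenˡ cone-∼ e′

NAdj : ∀ {n} → List (Fin n × Fin n) → ℕ → ℕ → Set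
NAdj E u v = ∃[ a ] ∃[ b ] (a , b) ∈ₗ E × ((toℕ a ≡ u × toℕ b ≡ v) ⊎ (toℕ a ≡ v × toℕ b ≡ u))

NAdj-sym : ∀ {n} {E : List (Fin n × Fin n)} {u v} → NAdj E u v → NAdj E v u
NAdj-sym (a , b , ab∈ , e) = a , b , ab∈ , Sum.swap e

_⊑_ : ∀ {n m} → List (Fin n × Fin n) → List (Fin m × Fin m) → Set
E ⊑ E′ = ∀ {u v} → NAdj E u v → NAdj E′ u v

-- The arguments are a range lo to hi of new vertices and an adjacency. As vertices are numbered by
-- insertion, structures built in turn occupy disjoint ranges.
Spec : Set₁
Spec = ℕ → ℕ → (ℕ → ℕ → Set) → Set

-- Inside the face t of any stacked triangulation one can realise P, using only new vertices
-- and leaving all other faces intact.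
Build : Face → Spec → Set
Build t P = ∀ {n E F rest} → Stacked n E F → faces F ≃ (t ∷ rest) →
  ∃[ n′ ] ∃[ E′ ] ∃[ F′ ] ∃[ extra ] Stacked n′ E′ F′ × n ≤ n′ × faces F′ ≃ (rest ++ extra) × E ⊑ E′ ×
    (∀ {m} (E″ : List (Fin m × Fin m)) → E′ ⊑ E″ → P n n′ (NAdj E″))

build-nothing : ∀ {t} {P : Spec} → (∀ {n A} → P n n A) → Build t P
build-nothing P₀ {n} {E} {F} {rest} st e =
  n , E , F , _ ∷ [] , st , ≤-refl , (e thenˡ (≃-to-front-end rest)) , id , λ _ _ → P₀
  where
  ≃-to-front-end : ∀ {t} xs → (t ∷ xs) ≃ (xs ++ t ∷ [])
  ≃-to-front-end []       = ≃-refl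
  ≃-to-front-end (x ∷ xs) = swap ≃-refl thenˡ prep same (≃-to-front-end xs)

build-∼ : ∀ {s t} {P : Spec} → t ∼ s → Build s P → Build t P
build-∼ t∼s build st e = build st (e thenˡ prep t∼s ≃-refl)

build-weaken : ∀ {t} {P P′ : Spec} →
  (∀ {lo hi} {A : ℕ → ℕ → Set} → (∀ {u v} → A u v → A v u) → P lo hi A → P′ lo hi A) → Build t P → Build t P′
build-weaken P⇒P′ build st e = let n′ , E′ , F′ , extra , st′ , n≤ , e′ , E⊑ , P = build st e in
  n′ , E′ , F′ , extra , st′ , n≤ , e′ , E⊑ , λ E″ E′⊑ → P⇒P′ (NAdj-sym {E = E″}) (P E″ E′⊑)

-- Vertex lo enters the face; the numbers after it are split at m₁ and m₂ among the structures in
-- the three resulting faces.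
Insertion : Face → (P₁ P₂ P₃ : ℕ → Spec) → Spec
Insertion (a , b , c) P₁ P₂ P₃ lo hi A = ∃[ m₁ ] ∃[ m₂ ] suc lo ≤ m₁ × m₁ ≤ m₂ × m₂ ≤ hi ×
  A a lo × A b lo × A c lo × P₁ lo (suc lo) m₁ A × P₂ lo m₁ m₂ A × P₃ lo m₂ hi A

inserted-edge : ∀ {n} {E : List (Fin n × Fin n)} {a b c : Fin n} {t : Face} →
  (toℕ a , toℕ b , toℕ c) ∼ t → let (a′ , b′ , c′) = t
                                    E′ = liftE E ++ (inject₁ a , fromℕ n) ∷ (inject₁ b , fromℕ n) ∷ (inject₁ c , fromℕ n) ∷ []
  in NAdj E′ a′ n × NAdj E′ b′ n × NAdj E′ c′ n
inserted-edge {n} {E} {a = a} {b} {c} s = go s (new a (here refl) , new b (there (here refl)) , new c (there (there (here refl))))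
  where
  E′ = liftE E ++ (inject₁ a , fromℕ n) ∷ (inject₁ b , fromℕ n) ∷ (inject₁ c , fromℕ n) ∷ []
  new : ∀ v → (inject₁ v , fromℕ n) ∈ₗ (inject₁ a , fromℕ n) ∷ (inject₁ b , fromℕ n) ∷ (inject₁ c , fromℕ n) ∷ [] →
    NAdj E′ (toℕ v) n
  new v m = inject₁ v , fromℕ n , ∈-++⁺ʳ (liftE E) m , inj₁ (Fin.toℕ-inject₁ v , Fin.toℕ-fromℕ n)
  All₃ : (ℕ → Set) → Face → Set
  All₃ P (a , b , c) = P a × P b × P c
  go : ∀ {P : ℕ → Set} {s t} → s ∼ t → All₃ P s → All₃ P t
  go same x = x
  go s12 (x , y , z) = y , x , z
  go s23 (x , y , z) = x , z , y
  go (e then e′) x = go e′ (go e x)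

⊑-lift : ∀ {n} {E : List (Fin n × Fin n)} {new} → E ⊑ (liftE E ++ new)
⊑-lift (a , b , ab∈ , e) = inject₁ a , inject₁ b , ∈-++⁺ˡ (∈-map⁺ _ ab∈) ,
  Sum.map (λ (p , q) → trans (Fin.toℕ-inject₁ a) p , trans (Fin.toℕ-inject₁ b) q)
          (λ (p , q) → trans (Fin.toℕ-inject₁ a) p , trans (Fin.toℕ-inject₁ b) q) e

build-insert : ∀ {a b c} {P₁ P₂ P₃ : ℕ → Spec} → (∀ x → Build (a , b , x) (P₁ x)) →
  (∀ x → Build (b , c , x) (P₂ x)) → (∀ x → Build (a , c , x) (P₃ x)) → Build (a , b , c) (Insertion (a , b , c) P₁ P₂ P₃)
build-insert {a} {b} {c} build₁ build₂ build₃ {n} {E} {F} {rest} st e with faces-remove F e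
... | i , s , r with build₁ n (add st i) e₁
  where
  new = liftF (removeAt F i)
  e₁ : faces (liftF (removeAt F i) ++ _) ≃ ((a , b , n) ∷ (b , c , n) ∷ (a , c , n) ∷ rest)
  e₁ = (≃-reflexive (trans (map-++ face new _) (cong₂ _++_ (faces-lift (removeAt F i)) heads))
         thenˡ ≃-++ r (cone-∼ s))
         thenˡ (≃-to-front rest thenˡ prep same (≃-to-front rest thenˡ prep same
                (≃-to-front rest thenˡ prep same (≃-reflexive (++-identityʳ rest)))))
    where
    t = lookup F i
    heads : faces ((inject₁ (proj₁ t) , inject₁ (proj₁ (proj₂ t)) , fromℕ n) ∷
                   (inject₁ (proj₁ (proj₂ t)) , inject₁ (proj₂ (proj₂ t)) , fromℕ n) ∷
                   (inject₁ (proj₁ t) , inject₁ (proj₂ (proj₂ t)) , fromℕ n) ∷ []) ≡ cone n (face t)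
    heads rewrite Fin.toℕ-inject₁ (proj₁ t) | Fin.toℕ-inject₁ (proj₁ (proj₂ t))
      | Fin.toℕ-inject₁ (proj₂ (proj₂ t)) | Fin.toℕ-fromℕ n = refl
... | n₁ , E₁ , F₁ , extra₁ , st₁ , n≤₁ , e₁ , E⊑₁ , P₁ with build₂ n st₁ e₁
... | n₂ , E₂ , F₂ , extra₂ , st₂ , n≤₂ , e₂ , E⊑₂ , P₂ with build₃ n st₂ e₂
... | n₃ , E₃ , F₃ , extra₃ , st₃ , n≤₃ , e₃ , E⊑₃ , P₃ =
  n₃ , E₃ , F₃ , extra₁ ++ extra₂ ++ extra₃ , st₃ ,
  ≤-trans (n≤1+n n) (≤-trans n≤₁ (≤-trans n≤₂ n≤₃)) ,
  (e₃ thenˡ ≃-reflexive (trans (++-assoc (rest ++ extra₁) extra₂ extra₃) (++-assoc rest extra₁ (extra₂ ++ extra₃)))) ,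
  (λ uv → E⊑₃ (E⊑₂ (E⊑₁ (⊑-lift uv)))) ,
  λ E″ ⊑″ → let ea , eb , ec = inserted-edge {E = E} s
                lift : ∀ {u v} → NAdj _ u v → NAdj E″ u v
                lift uv = ⊑″ (E⊑₃ (E⊑₂ (E⊑₁ uv)))
            in n₁ , n₂ , n≤₁ , n≤₂ , n≤₃ , lift ea , lift eb , lift ec ,
               P₁ E″ (λ uv → ⊑″ (E⊑₃ (E⊑₂ uv))) , P₂ E″ (λ uv → ⊑″ (E⊑₃ uv)) , P₃ E″ ⊑″

module StackedFan (q B r₀ : ℕ) where

  O Q : ℕ → Set
  O = Fan (Fin q) B
  Q = Fan (O r₀) B

  OR : ∀ {r} → O r → O r → Set
  OR = FanR PathR

  QR : ∀ {s} → Q s → Q s → Set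
  QR = FanR OR

  -- The hub is the existing vertex X. Injectivity presupposes `X < lo` because `Build` places no
  -- bound on the corners of a face.
  record Hang (s : ℕ) (X : ℕ) (lo hi : ℕ) (A : ℕ → ℕ → Set) : Set where
    field
      place     : Q s → ℕ
      place-hub : place hub ≡ X
      new       : ∀ v → v ≢ hub → lo ≤ place v × place v < hi
      injective : X < lo → ∀ {v v′} → place v ≡ place v′ → v ≡ v′
      edges     : ∀ {v v′} → QR v v′ → A (place v) (place v′)

  -- N copies of O r, all joined to X, with their hubs in a path of neighbours of y that starts
  -- next to prev; every vertex of these copies is the hub of a copy of Q s.
  record Rows (s r N : ℕ) (X y prev : ℕ) (lo hi : ℕ) (A : ℕ → ℕ → Set) : Set where
    field
      place     : Fin N → O r → Q s → ℕ
      new       : ∀ i u v → lo ≤ place i u v × place i u v < hi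
      injective : ∀ {i u v i′ u′ v′} → place i u v ≡ place i′ u′ v′ → i ≡ i′ × u ≡ u′ × v ≡ v′
      joined      : ∀ i u → A X (place i u hub)
      centre    : ∀ i → A y (place i hub hub)
      first     : ∀ i → toℕ i ≡ 0 → A prev (place i hub hub)
      next      : ∀ i j → toℕ j ≡ suc (toℕ i) → A (place i hub hub) (place j hub hub)
      inside    : ∀ i {u u′} → OR u u′ → A (place i u hub) (place i u′ hub)
      hang      : ∀ i u {v v′} → QR v v′ → A (place i u v) (place i u v′)

  Child : (s r : ℕ) (X prev x : ℕ) → Spec
  Child s zero    X prev x lo hi A = ⊤
  Child s (suc r) X prev x = Rows s r (B * q) X x prev

  hang-bare : ∀ {X n A} → Hang zero X n n A
  hang-bare {X} = record { place = λ _ → X ; place-hub = refl ; new = λ { hub ≢ → ⊥-elim (≢ refl) }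
    ; injective = λ { _ {hub} {hub} _ → refl } ; edges = λ () }

  hang-rows : ∀ {s X a b lo hi A} → (∀ {u v} → A u v → A v u) → Rows s r₀ B X a b lo hi A → Hang (suc s) X lo hi A
  hang-rows {s} {X} {A = A} A-sym rows = record
    { place = place′ ; place-hub = refl ; new = new′ ; injective = injective′ ; edges = edges′ }
    where
    open Rows rows
    place′ : Q (suc s) → ℕ
    place′ hub         = X
    place′ (sub b u v) = place b u v
    new′ : ∀ v → v ≢ hub → _ ≤ place′ v × place′ v < _
    new′ hub         ≢ = ⊥-elim (≢ refl)
    new′ (sub b u v) _ = new b u v
    injective′ : X < _ → ∀ {v v′} → place′ v ≡ place′ v′ → v ≡ v′
    injective′ X<lo {hub} {hub} _ = refl
    injective′ X<lo {hub} {sub b u v} eq = ⊥-elim (<⇒≱ X<lo (≤-trans (proj₁ (new b u v)) (≤-reflexive (sym eq))))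
    injective′ X<lo {sub b u v} {hub} eq = ⊥-elim (<⇒≱ X<lo (≤-trans (proj₁ (new b u v)) (≤-reflexive eq)))
    injective′ X<lo {sub b u v} {sub b′ u′ v′} eq with injective eq
    ... | refl , refl , refl = refl
    edges′ : ∀ {v v′} → QR v v′ → A (place′ v) (place′ v′)
    edges′ (spoke {b = b} {u})  = joined b u
    edges′ (spoke⁻ {b = b} {u}) = A-sym (joined b u)
    edges′ (row {b = b} e)      = inside b e
    edges′ (inner {b = b} {u} e) = hang b u e

  rows-none : ∀ {s r X y prev n A} → Rows s r zero X y prev n n A
  rows-none = record { place = λ () ; new = λ () ; injective = λ { {()} } ; joined = λ () ; centre = λ ()
    ; first = λ () ; next = λ () ; inside = λ () ; hang = λ () }

  module RowsStep {s r N X y prev lo hi : ℕ} {A : ℕ → ℕ → Set} (A-sym : ∀ {u v} → A u v → A v u)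
    {m₁ m₂ : ℕ} (lo<m₁ : suc lo ≤ m₁) (m₁≤m₂ : m₁ ≤ m₂) (m₂≤hi : m₂ ≤ hi)
    (X-lo : A X lo) (y-lo : A y lo) (prev-lo : A prev lo)
    (rest : Rows s r N X y lo (suc lo) m₁ A) (own : Hang s lo m₁ m₂ A) where

    module R = Rows rest
    module H = Hang own

    lo<hi : lo < hi
    lo<hi = ≤-trans lo<m₁ (≤-trans m₁≤m₂ m₂≤hi)

    hub? : ∀ {r} (v : Q r) → v ≡ hub ⊎ v ≢ hub
    hub? hub         = inj₁ refl
    hub? (sub _ _ _) = inj₂ λ ()

    Own : ℕ → Set
    Own x = x ≡ lo ⊎ (m₁ ≤ x × x < m₂)

    own-range : ∀ v → Own (H.place v)
    own-range v with hub? v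
    ... | inj₁ refl = inj₁ H.place-hub
    ... | inj₂ v≢   = inj₂ (H.new v v≢)

    own-new : ∀ v → lo ≤ H.place v × H.place v < hi
    own-new v with own-range v
    ... | inj₁ eq = ≤-reflexive (sym eq) , ≤-trans (s≤s (≤-reflexive eq)) lo<hi
    ... | inj₂ (l , h) = ≤-trans (<⇒≤ lo<m₁) l , <-≤-trans h m₂≤hi

    rest-new : ∀ i u v → lo ≤ R.place i u v × R.place i u v < hi
    rest-new i u v = <⇒≤ (proj₁ (R.new i u v)) , <-≤-trans (proj₂ (R.new i u v)) (≤-trans m₁≤m₂ m₂≤hi)

    own≢rest : ∀ v {i u v′} → H.place v ≢ R.place i u v′
    own≢rest v {i} {u} {v′} eq with own-range v | R.new i u v′
    ... | inj₁ e | l , _ = <-irrefl (sym (trans (sym eq) e)) l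
    ... | inj₂ (l , _) | _ , h = <⇒≱ h (≤-trans l (≤-reflexive eq))

    rows-step : (r≡ : (r ≡ zero) ⊎ (∃[ r′ ] Σ (r ≡ suc r′) λ _ → Rows s r′ (B * q) X lo prev m₂ hi A)) →
      Rows s r (suc N) X y prev lo hi A
    rows-step (inj₁ refl) = record
      { place = place ; new = new ; injective = injective ; joined = joined ; centre = centre
      ; first = first ; next = next ; inside = inside ; hang = hang }
      where
      place : Fin (suc N) → O zero → Q s → ℕ
      place zero    hub = H.place
      place (suc i) u   = R.place i u
      new : ∀ i u v → lo ≤ place i u v × place i u v < hi
      new zero    hub v = own-new v
      new (suc i) u   v = rest-new i u v
      injective : ∀ {i u v i′ u′ v′} → place i u v ≡ place i′ u′ v′ → i ≡ i′ × u ≡ u′ × v ≡ v′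
      injective {zero} {hub} {v} {zero} {hub} {v′} eq = refl , refl , H.injective lo<m₁ eq
      injective {zero} {hub} {v} {suc i′} eq = ⊥-elim (own≢rest v eq)
      injective {suc i} {i′ = zero} {hub} {v′} eq = ⊥-elim (own≢rest v′ (sym eq))
      injective {suc i} {i′ = suc i′} eq with R.injective eq
      ... | refl , refl , refl = refl , refl , refl
      joined : ∀ i u → A X (place i u hub)
      joined zero    hub = subst (A X) (sym H.place-hub) X-lo
      joined (suc i) u   = R.joined i u
      centre : ∀ i → A y (place i hub hub)
      centre zero    = subst (A y) (sym H.place-hub) y-lo
      centre (suc i) = R.centre i
      first : ∀ i → toℕ i ≡ 0 → A prev (place i hub hub)
      first zero _ = subst (A prev) (sym H.place-hub) prev-lo
      next : ∀ i j → toℕ j ≡ suc (toℕ i) → A (place i hub hub) (place j hub hub)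
      next zero    (suc j) eq = subst (λ x → A x (R.place j hub hub)) (sym H.place-hub) (R.first j (suc-injective eq))
      next (suc i) (suc j) eq = R.next i j (suc-injective eq)
      inside : ∀ i {u u′} → OR u u′ → A (place i u hub) (place i u′ hub)
      inside zero ()
      inside (suc i) e = R.inside i e
      hang : ∀ i u {v v′} → QR v v′ → A (place i u v) (place i u v′)
      hang zero    hub e = H.edges e
      hang (suc i) u   e = R.hang i u e
    rows-step (inj₂ (r′ , refl , child)) = record
      { place = place ; new = new ; injective = injective ; joined = joined ; centre = centre
      ; first = first ; next = next ; inside = inside ; hang = hang }
      where
      module C = Rows child
      place : Fin (suc N) → O (suc r′) → Q s → ℕ
      place zero    hub         = H.place
      place zero    (sub b z u) = C.place (combine b z) u
      place (suc i) u           = R.place i u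
      new : ∀ i u v → lo ≤ place i u v × place i u v < hi
      new zero hub v = own-new v
      new zero (sub b z u) v = let l , h = C.new (combine b z) u v in ≤-trans (<⇒≤ lo<m₁) (≤-trans m₁≤m₂ l) , h
      new (suc i) u v = rest-new i u v
      own≢child : ∀ v {i u v′} → H.place v ≢ C.place i u v′
      own≢child v {i} {u} {v′} eq with own-range v | C.new i u v′
      ... | inj₁ e | l , _ = <⇒≱ lo<m₁ (≤-trans m₁≤m₂ (≤-trans l (≤-reflexive (trans (sym eq) e))))
      ... | inj₂ (_ , h) | l , _ = <⇒≱ h (≤-trans l (≤-reflexive (sym eq)))
      rest≢child : ∀ {i u v i′ u′ v′} → R.place i u v ≢ C.place i′ u′ v′
      rest≢child {i} {u} {v} {i′} {u′} {v′} eq =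
        <⇒≱ (proj₂ (R.new i u v)) (≤-trans m₁≤m₂ (≤-trans (proj₁ (C.new i′ u′ v′)) (≤-reflexive (sym eq))))
      injective : ∀ {i u v i′ u′ v′} → place i u v ≡ place i′ u′ v′ → i ≡ i′ × u ≡ u′ × v ≡ v′
      injective {zero} {hub} {v} {zero} {hub} {v′} eq = refl , refl , H.injective lo<m₁ eq
      injective {zero} {hub} {v} {zero} {sub _ _ _} {v′} eq = ⊥-elim (own≢child v eq)
      injective {zero} {sub _ _ _} {v} {zero} {hub} {v′} eq = ⊥-elim (own≢child v′ (sym eq))
      injective {zero} {sub b z u} {v} {zero} {sub b′ z′ u′} {v′} eq with C.injective eq
      ... | bz≡ , refl , refl with Fin.combine-injective b z b′ z′ bz≡
      ... | refl , refl = refl , refl , refl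
      injective {zero} {hub} {v} {suc i′} eq = ⊥-elim (own≢rest v eq)
      injective {zero} {sub _ _ _} {v} {suc i′} eq = ⊥-elim (rest≢child (sym eq))
      injective {suc i} {i′ = zero} {hub} {v′} eq = ⊥-elim (own≢rest v′ (sym eq))
      injective {suc i} {i′ = zero} {sub _ _ _} {v′} eq = ⊥-elim (rest≢child eq)
      injective {suc i} {i′ = suc i′} eq with R.injective eq
      ... | refl , refl , refl = refl , refl , refl
      joined : ∀ i u → A X (place i u hub)
      joined zero    hub         = subst (A X) (sym H.place-hub) X-lo
      joined zero    (sub b z u) = C.joined (combine b z) u
      joined (suc i) u           = R.joined i u
      centre : ∀ i → A y (place i hub hub)
      centre zero    = subst (A y) (sym H.place-hub) y-lo
      centre (suc i) = R.centre i
      first : ∀ i → toℕ i ≡ 0 → A prev (place i hub hub)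
      first zero _ = subst (A prev) (sym H.place-hub) prev-lo
      next : ∀ i j → toℕ j ≡ suc (toℕ i) → A (place i hub hub) (place j hub hub)
      next zero    (suc j) eq = subst (λ x → A x (R.place j hub hub)) (sym H.place-hub) (R.first j (suc-injective eq))
      next (suc i) (suc j) eq = R.next i j (suc-injective eq)
      inside : ∀ i {u u′} → OR u u′ → A (place i u hub) (place i u′ hub)
      inside zero (spoke {b = b} {z}) = subst (λ x → A x (C.place (combine b z) hub hub)) (sym H.place-hub) (C.centre (combine b z))
      inside zero (spoke⁻ {b = b} {z}) = subst (A (C.place (combine b z) hub hub)) (sym H.place-hub) (A-sym (C.centre (combine b z)))
      inside zero (row {b = b} {z} {z′} (inj₁ eq)) = C.next (combine b z) (combine b z′) (combine-next b eq)
      inside zero (row {b = b} {z} {z′} (inj₂ eq)) = A-sym (C.next (combine b z′) (combine b z) (combine-next b eq))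
      inside zero (inner {b = b} {z} e) = C.inside (combine b z) e
      inside (suc i) e = R.inside i e
      hang : ∀ i u {v v′} → QR v v′ → A (place i u v) (place i u v′)
      hang zero    hub         e = H.edges e
      hang zero    (sub b z u) e = C.hang (combine b z) u e
      hang (suc i) u           e = R.hang i u e

  rows-insert : ∀ {s r N X y prev lo hi A} → (∀ {u v} → A u v → A v u) →
    Insertion (X , y , prev) (λ x → Rows s r N X y x) (λ x → Hang s x) (Child s r X prev) lo hi A →
    Rows s r (suc N) X y prev lo hi A
  rows-insert {r = zero} A-sym (_ , _ , l₁ , l₂ , l₃ , Xl , yl , pl , rest , own , _) =
    RowsStep.rows-step A-sym l₁ l₂ l₃ Xl yl pl rest own (inj₁ refl)
  rows-insert {r = suc r} A-sym (_ , _ , l₁ , l₂ , l₃ , Xl , yl , pl , rest , own , child) =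
    RowsStep.rows-step A-sym l₁ l₂ l₃ Xl yl pl rest own (inj₂ (r , refl , child))

  build-hang  : ∀ s X a b → Build (X , a , b) (Hang s X)
  -- A vertex x inserted into the face X, y, prev is the next in the row. The face X, y, x continues
  -- the row with x as predecessor; the face y, prev, x receives the copy of Q s with hub x; the
  -- face X, prev, x receives the row of which x itself is the hub, whose vertices can still be
  -- joined to X.
  build-rows  : ∀ s r N X y prev → Build (X , y , prev) (Rows s r N X y prev)
  build-child : ∀ s r X prev x → Build (X , prev , x) (Child s r X prev x)

  build-hang zero    X a b = build-nothing {P = Hang zero X} hang-bare
  build-hang (suc s) X a b = build-weaken {P = Rows s r₀ B X a b} {P′ = Hang (suc s) X} hang-rows (build-rows s r₀ B X a b)

  build-rows s r zero    X y prev = build-nothing {P = Rows s r zero X y prev} rows-none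
  build-rows s r (suc N) X y prev =
    build-weaken {P = Insertion (X , y , prev) (λ x → Rows s r N X y x) (λ x → Hang s x) (Child s r X prev)}
      {P′ = Rows s r (suc N) X y prev} rows-insert
      (build-insert {P₁ = λ x → Rows s r N X y x} {P₂ = λ x → Hang s x} {P₃ = Child s r X prev}
        (λ x → build-rows s r N X y x)
        (λ x → build-∼ {P = Hang s x} (s23 then s12) (build-hang s x y prev))
        (λ x → build-child s r X prev x))

  build-child s zero    X prev x = build-nothing {P = Child s zero X prev x} tt
  build-child s (suc r) X prev x = build-∼ {P = Child s (suc r) X prev x} s23 (build-rows s r (B * q) X x prev)

  stacked-fan : ∀ s → ∃[ n ] ∃[ E ] ∃[ F ] Stacked n E F × Σ (Q s → Fin n) λ e → Injective _≡_ _≡_ e ×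
    (∀ {u v} → QR u v → Adj E (e u) (e v))
  stacked-fan s with build-hang s 0 1 2 base ≃-refl
  ... | n , E , F , _ , st , 3≤n , _ , _ , spec = n , E , F , st , e , e-injective , e-edge
    where
    open Hang (spec E id)
    small : ∀ v → place v < n
    small hub = ≤-trans (s≤s (≤-reflexive place-hub)) (≤-trans (s≤s z≤n) 3≤n)
    small (sub b u v) = proj₂ (new (sub b u v) λ ())
    e : Q s → Fin n
    e v = fromℕ< (small v)
    e-injective : Injective _≡_ _≡_ e
    e-injective {u} {v} eq = injective z<s (trans (sym (Fin.toℕ-fromℕ< (small u))) (trans (cong toℕ eq) (Fin.toℕ-fromℕ< (small v))))
    e-edge : ∀ {u v} → QR u v → Adj E (e u) (e v)
    e-edge {u} {v} uv with edges uv
    ... | a , b , ab∈ , ends = Sum.map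
      (λ (a≡ , b≡) → subst₂ (λ x y → (x , y) ∈ₗ E) (is a≡) (is b≡) ab∈)
      (λ (a≡ , b≡) → subst₂ (λ x y → (x , y) ∈ₗ E) (is a≡) (is b≡) ab∈) ends
      where
      is : ∀ {a w} → toℕ a ≡ place w → a ≡ e w
      is {w = w} eq = Fin.toℕ-injective (trans eq (sym (Fin.toℕ-fromℕ< (small w))))

-- Treewidth of graphs with large cliques

subset-size : ∀ {k n} (f : Fin k → Fin n) → Injective _≡_ _≡_ f → (S : Subset n) → (∀ i → f i ∈ S) → k ≤ ∣ S ∣
subset-size {zero}  f inj S f∈ = z≤n
subset-size {suc k} f inj S f∈ = ≤-trans
  (s≤s (subset-size (f ∘ suc) (λ eq → Fin.suc-injective (inj eq)) (S - f zero)
    (λ i → x∈p∧x≢y⇒x∈p-y (f∈ (suc i)) (λ eq → Fin.0≢1+n (sym (inj eq))))))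
  (x∈p⇒∣p-x∣<∣p∣ (f∈ zero))

module _ {m : ℕ} (parent : Fin m → Fin (suc m)) (parent≤ : ∀ i → toℕ (parent i) ≤ toℕ i) where

  data Descendant (s : Fin (suc m)) : Fin (suc m) → Set where
    self  : Descendant s s
    child : ∀ {j} → Descendant s (parent j) → Descendant s (suc j)

  descendant-≤ : ∀ {s x} → Descendant s x → toℕ s ≤ toℕ x
  descendant-≤ self = ≤-refl
  descendant-≤ (child {j} d) = ≤-trans (descendant-≤ d) (≤-trans (parent≤ j) (n≤1+n _))

  -- A walk can leave the descendants of a node only through its parent.
  parent-in : ∀ {S t i} → Reach (TreeEdge parent) S (suc i) t → toℕ t < toℕ (Fin.suc i) → parent i ∈ S
  parent-in {S} {t} {i} walk t<s = [ (λ d → contradiction (descendant-≤ d) (<⇒≱ t<s)) , id ]′ (go walk)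
    where
    go : ∀ {x} → Reach (TreeEdge parent) S (suc i) x → Descendant (suc i) x ⊎ parent i ∈ S
    go (here _) = inj₁ self
    go (step w edge y∈) = [ (λ d → extend d edge y∈) , inj₂ ]′ (go w)
      where
      extend : ∀ {x y} → Descendant (suc i) x → TreeEdge parent x y → y ∈ S → Descendant (suc i) y ⊎ parent i ∈ S
      extend d (_ , inj₂ (refl , refl)) _ = inj₁ (child d)
      extend self (_ , inj₁ (refl , refl)) y∈ = inj₂ y∈
      extend (child d) (_ , inj₁ (refl , refl)) _ = inj₁ d

module _ {n k : ℕ} {G : Graph n} (T : TreeDecomposition G k) where

  open TreeDecomposition T

  ∈-nodes⁺ : ∀ {v t} → v ∈ bag t → t ∈ NodesOf bag v
  ∈-nodes⁺ {v} {t} v∈ = lookup⇒[]= t _ (trans (lookup∘tabulate (λ t → lookupᵥ (bag t) v) t) ([]=⇒lookup v∈))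

  ∈-nodes⁻ : ∀ {v t} → t ∈ NodesOf bag v → v ∈ bag t
  ∈-nodes⁻ {v} {t} t∈ = lookup⇒[]= v _ (trans (sym (lookup∘tabulate (λ t → lookupᵥ (bag t) v) t)) ([]=⇒lookup t∈))

  -- A parent has a smaller number than its child, so the node of smallest number is the root of the
  -- subtree of v.
  top : ∀ v → ∃[ t ] t ∈ NodesOf bag v × (∀ s → s ∈ NodesOf bag v → toℕ t ≤ toℕ s)
  top v = argmin (_∈? NodesOf bag v) toℕ (let t , v∈ = covers v in t , ∈-nodes⁺ v∈)

  -- From a common node s pass to the parent while s is below the top of v. Neither subtree is left,
  -- because the top of u is no later than that of v.
  climb : ∀ {u v} fuel s → toℕ s ≤ fuel → s ∈ NodesOf bag u → s ∈ NodesOf bag v →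
    toℕ (proj₁ (top u)) ≤ toℕ (proj₁ (top v)) → proj₁ (top v) ∈ NodesOf bag u
  climb {u} {v} fuel s s≤ s∈u s∈v tu≤tv with m≤n⇒m<n∨m≡n (proj₂ (proj₂ (top v)) s s∈v)
  ... | inj₂ eq = subst (_∈ NodesOf bag u) (sym (Fin.toℕ-injective eq)) s∈u
  climb zero s s≤ _ _ _ | inj₁ lt = contradiction (≤-trans lt s≤) λ ()
  climb {u} {v} (suc fuel) (suc i) (s≤s i≤) s∈u s∈v tu≤tv | inj₁ lt =
    climb fuel (parent i) (≤-trans (parent≤ i) i≤)
      (parent-in parent parent≤ (connected u (suc i) _ s∈u (proj₁ (proj₂ (top u)))) (≤-<-trans tu≤tv lt))
      (parent-in parent parent≤ (connected v (suc i) _ s∈v (proj₁ (proj₂ (top v)))) lt) tu≤tv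

  -- The bag at the highest-numbered among the tops of the subtrees of a clique contains it.
  clique-bound : ∀ {c} (f : Fin (suc c) → Fin n) → Injective _≡_ _≡_ f → (∀ i j → i ≢ j → Edge G (f i) (f j)) → c ≤ k
  clique-bound {c} f inj clique with argmin {P = λ _ → ⊤} (λ _ → yes tt) (λ i → m ∸ toℕ (proj₁ (top (f i)))) (zero , tt)
  ... | i , _ , last = s≤s⁻¹ (≤-trans (subset-size f inj (bag t) all∈) (width≤ t))
    where
    t = proj₁ (top (f i))
    highest : ∀ j → toℕ (proj₁ (top (f j))) ≤ toℕ t
    highest j = ∸-cancelʳ-≤ (s≤s⁻¹ (Fin.toℕ<n (proj₁ (top (f j))))) (last j tt)
    all∈ : ∀ j → f j ∈ bag t
    all∈ j with j Fin.≟ i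
    ... | yes refl = ∈-nodes⁻ (proj₁ (proj₂ (top (f i))))
    ... | no j≢i with edges (f j) (f i) (clique j i j≢i)
    ... | s , fj∈ , fi∈ = ∈-nodes⁻ (climb (toℕ s) s ≤-refl (∈-nodes⁺ fj∈) (∈-nodes⁺ fi∈) (highest j))

-- The choice of parameters

2^log≤ : ∀ n → 1 ≤ n → 2 ^ ⌊log₂ n ⌋ ≤ n
2^log≤ n = go n n ≤-refl
  where
  go : ∀ fuel n → n ≤ fuel → 1 ≤ n → 2 ^ ⌊log₂ n ⌋ ≤ n
  go zero n n≤ 1≤n = contradiction (≤-trans 1≤n n≤) λ ()
  go (suc fuel) 1 _ _ = ≤-refl
  go (suc fuel) n@(suc (suc n′)) (s≤s n≤) _ = begin
    2 ^ ⌊log₂ n ⌋                    ≡⟨ cong (2 ^_) (sym (m+[n∸m]≡n (1≤log {n} (s≤s (s≤s z≤n))))) ⟩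
    2 * 2 ^ (⌊log₂ n ⌋ ∸ 1)          ≡⟨ cong (λ l → 2 * 2 ^ l) (sym (⌊log₂⌊n/2⌋⌋≡⌊log₂n⌋∸1 n)) ⟩
    2 * 2 ^ ⌊log₂ ⌊ n /2⌋ ⌋          ≤⟨ *-monoʳ-≤ 2 (go fuel ⌊ n /2⌋ (≤-trans (s≤s (⌊n/2⌋≤n n′)) n≤) (s≤s z≤n)) ⟩
    2 * ⌊ n /2⌋                      ≡⟨ cong (⌊ n /2⌋ +_) (+-identityʳ _) ⟩
    ⌊ n /2⌋ + ⌊ n /2⌋                ≤⟨ double-floor-half-≤ n ⟩
    n ∎
    where open ≤-Reasoning

Strength-mono : ∀ {V : Set} {R : V → V → Set} {B p p′ L} → p ≤ p′ → Strength V R B p L → Strength V R B p′ L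
Strength-mono p≤ strength k<B φ M star = strength k<B φ M λ I cs conn covers len →
  star I cs conn covers (≤-trans len p≤)

module Parameters (p : ℕ) (8≤p : 8 ≤ p) where

  -- The path of 2^(2L) vertices takes at most half of the budget p. The other half is 4r, since
  -- each of the two nested fan constructions costs 2r.
  lg L r : ℕ
  lg = ⌊log₂ p ⌋
  L = ⌊ lg ∸ 1 /2⌋
  r = p / 8

  3≤lg : 3 ≤ lg
  3≤lg = ⌊log₂⌋-mono-≤ 8≤p

  1≤L : 1 ≤ L
  1≤L = ⌊n/2⌋-mono (∸-monoˡ-≤ 1 3≤lg)

  -- Tight when `lg` is 4, where L is 1.
  lg≤4L : lg ≤ 4 * L
  lg≤4L = subst (λ l → l ≤ 4 * ⌊ l ∸ 1 /2⌋) (m+[n∸m]≡n 3≤lg) (go (lg ∸ 3))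
    where
    odd : ∀ j → j ≤ suc (⌊ j /2⌋ + ⌊ j /2⌋)
    odd j = ≤-trans (≤-reflexive (sym (⌊n/2⌋+⌈n/2⌉≡n j)))
      (≤-trans (+-monoʳ-≤ ⌊ j /2⌋ (⌊n/2⌋-mono (n≤1+n (suc j)))) (≤-reflexive (+-suc _ _)))
    go : ∀ j → 3 + j ≤ 4 * suc ⌊ j /2⌋
    go j = begin
      3 + j                               ≤⟨ +-monoʳ-≤ 3 (odd j) ⟩
      4 + (⌊ j /2⌋ + ⌊ j /2⌋)             ≤⟨ +-monoʳ-≤ 4 (m≤m+n _ (⌊ j /2⌋ + ⌊ j /2⌋)) ⟩
      4 + ((⌊ j /2⌋ + ⌊ j /2⌋) + (⌊ j /2⌋ + ⌊ j /2⌋)) ≡⟨ regroup ⌊ j /2⌋ ⟩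
      4 * suc ⌊ j /2⌋ ∎
      where
      open ≤-Reasoning
      regroup : ∀ x → 4 + ((x + x) + (x + x)) ≡ 4 * suc x
      regroup = solve-∀

  8r≤p : 8 * r ≤ p
  8r≤p = ≤-trans (≤-reflexive (*-comm 8 r)) (m/n*n≤m p 8)

  1≤r : 1 ≤ r
  1≤r = /-monoˡ-≤ 8 8≤p

  p≤16r : p ≤ 16 * r
  p≤16r = begin
    p                    ≡⟨ m≡m%n+[m/n]*n p 8 ⟩
    p % 8 + r * 8        ≤⟨ +-monoˡ-≤ (r * 8) (<⇒≤ (m%n<n p 8)) ⟩
    8 + r * 8            ≤⟨ +-monoˡ-≤ (r * 8) (*-monoʳ-≤ 8 1≤r) ⟩
    8 * r + r * 8        ≡⟨ collect r ⟩
    16 * r ∎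
    where
    open ≤-Reasoning
    collect : ∀ r → 8 * r + r * 8 ≡ 16 * r
    collect = solve-∀

  2*2^2L≤p : 2 * 2 ^ (2 * L) ≤ p
  2*2^2L≤p = begin
    2 ^ suc (2 * L)      ≤⟨ ^-monoʳ-≤ 2 (s≤s (≤-trans (≤-reflexive (cong (L +_) (+-identityʳ L))) (double-floor-half-≤ (lg ∸ 1)))) ⟩
    2 ^ suc (lg ∸ 1)     ≡⟨ cong (2 ^_) (m+[n∸m]≡n (≤-trans (s≤s z≤n) 3≤lg)) ⟩
    2 ^ lg               ≤⟨ 2^log≤ p (≤-trans (s≤s z≤n) 8≤p) ⟩
    p ∎
    where open ≤-Reasoning

  planar-budget : 2 ^ (2 * L) + (r + r) + (r + r) ≤ p
  planar-budget = *-cancelˡ-≤ 2 (begin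
    2 * (2 ^ (2 * L) + (r + r) + (r + r))  ≡⟨ expand (2 ^ (2 * L)) r ⟩
    2 * 2 ^ (2 * L) + 8 * r                ≤⟨ +-mono-≤ 2*2^2L≤p 8r≤p ⟩
    p + p                                  ≡⟨ cong (p +_) (sym (+-identityʳ p)) ⟩
    2 * p ∎)
    where
    open ≤-Reasoning
    expand : ∀ x r → 2 * (x + (r + r) + (r + r)) ≡ 2 * x + 8 * r
    expand = solve-∀

  outerplanar-budget : 2 ^ (2 * L) + (r + r) ≤ p
  outerplanar-budget = ≤-trans (m≤m+n _ (r + r)) planar-budget

  outerplanar-size : p * lg ≤ 1024 * (r * L)
  outerplanar-size = begin
    p * lg                ≤⟨ *-mono-≤ p≤16r lg≤4L ⟩
    16 * r * (4 * L)      ≡⟨ collect r L ⟩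
    64 * (r * L)          ≤⟨ *-monoˡ-≤ (r * L) (m≤m+n 64 960) ⟩
    1024 * (r * L) ∎
    where
    open ≤-Reasoning
    collect : ∀ r L → 16 * r * (4 * L) ≡ 64 * (r * L)
    collect = solve-∀

  -- The origin of 1024: 16 for each factor p, and 4 for the logarithm.
  planar-size : p * p * lg ≤ 1024 * (r * (r * L))
  planar-size = begin
    p * p * lg                     ≤⟨ *-mono-≤ (*-mono-≤ p≤16r p≤16r) lg≤4L ⟩
    16 * r * (16 * r) * (4 * L)    ≡⟨ collect r L ⟩
    1024 * (r * (r * L)) ∎
    where
    open ≤-Reasoning
    collect : ∀ r L → 16 * r * (16 * r) * (4 * L) ≡ 1024 * (r * (r * L))
    collect = solve-∀

-- With B = K + 1 copies the strength applies to at most K colours; with more than K colours there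
-- is nothing to prove.
needs-colours : ∀ {K S k} → K ≤ 1024 * S → (k < suc K → S ≤ k) → K ≤ 1024 * k
needs-colours {K} {S} {k} K≤ S≤ with ≤-<-connex k K
... | inj₁ k≤K = ≤-trans K≤ (*-monoʳ-≤ 1024 (S≤ (s≤s k≤K)))
... | inj₂ K<k = ≤-trans (<⇒≤ K<k) (m≤n*m k 1024)

outerplanar-χ≥ : ∀ p → 8 ≤ p → Σ ℕ λ n → Σ (Graph n) λ G → Outerplanar G ×
  (∀ k → χ≤ p G k → p * ⌊log₂ p ⌋ ≤ 1024 * k)
outerplanar-χ≥ p 8≤p = size r , graphOf r , graphOf-outerplanar r , λ k χ → needs-colours outerplanar-size λ k<B →
  strength⇒colours {R₀ = FanR PathR} {R = Edge (graphOf r)}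
    (Strength-mono outerplanar-budget (fan-strength PathR-sym B _ L r (path-strength B L _ ≤-refl)))
    encode encode-injective (λ {u} {v} → fan-in-graphOf r {u} {v}) k<B χ
  where
  open Parameters p 8≤p
  B = suc (p * lg)
  open OuterplanarFan (2 ^ (2 * L)) B

module PlanarFan {q B r s : ℕ} (1<q : 1 < q) {n : ℕ} {E : List (Fin n × Fin n)} {F : List (Tri n)} (stacked : Stacked n E F)
  (e : Fan (Fan (Fin q) (suc B) (suc r)) (suc B) (suc s) → Fin n) (e-injective : Injective _≡_ _≡_ e)
  (e-adj : ∀ {u v} → FanR (FanR PathR) u v → Adj E (e u) (e v)) where

  open StackedFan q (suc B) (suc r) using (Q; QR)
  open import Data.Product.Properties using (≡-dec)

  open GraphOf {n} {λ u v → (u , v) ∈ₗ E}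
    (λ u v → any? (≡-dec Fin._≟_ Fin._≟_ (u , v)) E) (<-irrefl refl ∘ Layout.edge-< (layout stacked)) public

  e-edge : ∀ {u v} → QR u v → Edge graphOf (e u) (e v)
  e-edge {u} {v} uv = edge⁺ {e u} {e v} (e-adj uv)

  graphOf-planarTw≤3 : PlanarTw≤3 graphOf
  graphOf-planarTw≤3 = n , E , F , stacked , id , id , λ u v → edge⁻ {u} {v}

  z₀ z₁ : Fin q
  z₀ = fromℕ< (<-trans z<s 1<q)
  z₁ = fromℕ< 1<q

  -- A complete graph on four vertices: the outer hub, the hub of a row copy, and two consecutive
  -- path vertices of that copy. It excludes width 2.
  corner : Fin 4 → Q (suc s)
  corner 0F = hub
  corner 1F = sub zero hub hub
  corner 2F = sub zero (sub zero z₀ hub) hub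
  corner 3F = sub zero (sub zero z₁ hub) hub

  corner-edge : ∀ i j → toℕ i < toℕ j → QR (corner i) (corner j)
  corner-edge 0F 1F _ = spoke
  corner-edge 0F 2F _ = spoke
  corner-edge 0F 3F _ = spoke
  corner-edge 1F 2F _ = row spoke
  corner-edge 1F 3F _ = row spoke
  corner-edge 2F 3F _ = row (row (inj₁ (trans (Fin.toℕ-fromℕ< 1<q) (cong suc (sym (Fin.toℕ-fromℕ< (<-trans z<s 1<q)))))))
  corner-edge 1F 1F (s≤s ())
  corner-edge 2F 1F (s≤s ())
  corner-edge 2F 2F (s≤s (s≤s ()))
  corner-edge 3F 1F (s≤s ())
  corner-edge 3F 2F (s≤s (s≤s ()))
  corner-edge 3F 3F (s≤s (s≤s (s≤s ())))

  corner-clique : ∀ i j → i ≢ j → Edge graphOf (e (corner i)) (e (corner j))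
  corner-clique i j i≢j with <-cmp (toℕ i) (toℕ j)
  ... | tri< lt _ _ = e-edge (corner-edge i j lt)
  ... | tri≈ _ eq _ = ⊥-elim (i≢j (Fin.toℕ-injective eq))
  ... | tri> _ _ gt = trans (symm graphOf (e (corner i)) (e (corner j))) (e-edge (corner-edge j i gt))

  corner-injective : Injective _≡_ _≡_ (e ∘ corner)
  corner-injective {i} {j} eq with i Fin.≟ j
  ... | yes i≡j = i≡j
  ... | no i≢j with trans (sym (irrefl graphOf (e (corner i)))) (trans (cong (adj graphOf (e (corner i))) eq) (corner-clique i j i≢j))
  ... | ()

  graphOf-tw>2 : ¬ Tw≤ graphOf 2
  graphOf-tw>2 T = contradiction (clique-bound T (e ∘ corner) corner-injective corner-clique) λ { (s≤s (s≤s ())) }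

planarTw≤3-χ≥ : ∀ p → 8 ≤ p → Σ ℕ λ n → Σ (Graph n) λ G → PlanarTw≤3 G × ¬ Tw≤ G 2 ×
  (∀ k → χ≤ p G k → p * p * ⌊log₂ p ⌋ ≤ 1024 * k)
planarTw≤3-χ≥ p 8≤p = build r 1≤r planar-budget planar-size
  where
  open Parameters p 8≤p
  K = p * p * lg
  q = 2 ^ (2 * L)
  1<q : 1 < q
  1<q = ^-monoʳ-≤ 2 (≤-trans 1≤L (m≤m+n L (L + 0)))
  lower-bound : ∀ r → q + (suc r + suc r) + (suc r + suc r) ≤ p → K ≤ 1024 * (suc r * (suc r * L)) →
    (∃[ n ] ∃[ E ] ∃[ F ] Stacked n E F × Σ (Fan (Fan (Fin q) (suc K) (suc r)) (suc K) (suc r) → Fin n) λ e →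
      Injective _≡_ _≡_ e × (∀ {u v} → FanR (FanR PathR) u v → Adj E (e u) (e v))) →
    Σ ℕ λ n → Σ (Graph n) λ G → PlanarTw≤3 G × ¬ Tw≤ G 2 × (∀ k → χ≤ p G k → K ≤ 1024 * k)
  lower-bound r budget K≤ (n , E , F , stacked , e , e-injective , e-adj) =
    n , graphOf , graphOf-planarTw≤3 , graphOf-tw>2 , λ k χ → needs-colours K≤ λ k<B →
    strength⇒colours {R₀ = FanR (FanR PathR)} {R = Edge graphOf}
      (Strength-mono budget (fan-strength (FanR-sym PathR-sym) (suc K) _ _ (suc r)
        (fan-strength PathR-sym (suc K) _ L (suc r) (path-strength (suc K) L _ ≤-refl))))
      e e-injective e-edge k<B χ
    where open PlanarFan 1<q stacked e e-injective e-adj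
  build : ∀ r → 1 ≤ r → q + (r + r) + (r + r) ≤ p → K ≤ 1024 * (r * (r * L)) →
    Σ ℕ λ n → Σ (Graph n) λ G → PlanarTw≤3 G × ¬ Tw≤ G 2 × (∀ k → χ≤ p G k → K ≤ 1024 * k)
  build (suc r) _ budget K≤ = lower-bound r budget K≤ (StackedFan.stacked-fan q (suc K) (suc r) (suc r))

-- The constant c is 1/1024, cleared of its denominator, and the logarithm is binary and rounded
-- down. Treewidth exactly 3 is `PlanarTw≤3` together with the exclusion of width 2.
theorem6 : Σ ℕ λ C → Σ ℕ λ d → Σ ℕ λ p₀ → 1 ≤ d ×
    ((p : ℕ) → 2 ≤ p → (n : ℕ) (G : Graph n) → Outerplanar G →
    χ≤ p G (C * p * ⌊log₂ p ⌋)) ×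
    ((p : ℕ) → p₀ ≤ p → Σ ℕ λ n → Σ (Graph n) λ G → Outerplanar G ×
    ((k : ℕ) → χ≤ p G k → p * ⌊log₂ p ⌋ ≤ d * k)) ×
    ((p : ℕ) → 2 ≤ p → (n : ℕ) (G : Graph n) → PlanarTw≤3 G →
    χ≤ p G (C * (p * p) * ⌊log₂ p ⌋)) ×
    ((p : ℕ) → p₀ ≤ p → Σ ℕ λ n → Σ (Graph n) λ G → PlanarTw≤3 G × ¬ Tw≤ G 2 ×
    ((k : ℕ) → χ≤ p G k → p * p * ⌊log₂ p ⌋ ≤ d * k))
theorem6 = 48 , 1024 , 8 , s≤s z≤n , outerplanar-χ≤ , outerplanar-χ≥ , planarTw≤3-χ≤ , planarTw≤3-χ≥
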